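{- Let $V$ be a finite set (case $q=1$) or a finite-dimensional $\mathbb{F}_q$-vector space (case $q\ge 2$ a prime power), $n=\operatorname{rk}V$. Let $k\in\{0,\ldots,n\}$, $f:{V\brack k}\to\mathbb{R}$, and $i\in\{\max(\deg(f),0),\ldots,\min(k,n-k)\}$ (so $f\in\bar V_i^{(k)}$). Then $f^\perp\in\bar V_i^{(n-k)}$ and its $i$-weight distribution is given by $$\operatorname{wt}^{(i)}_{f^\perp}(J)=\sum_{I\in{V\brack i}}\gamma(n-k,i,\operatorname{rk}(I^\perp\cap J))\,\operatorname{wt}^{(i)}_f(I)\qquad\text{for all }J\in{V\brack i},$$ where $$\gamma(k,i,z)=\begin{cases}\delta_{z,k}&\text{if }i=k,\\[1mm] (-1)^{i-z}\,\dfrac{1}{q^{(k-i)(i-z)+\binom{i-z}{2}}}\,\dfrac{[k-i]_q}{[k-z]_q}\,\dfrac{1}{{k\brack z}_q}&\text{otherwise,}\end{cases}$$ with $\delta_{z,k}$ the Kronecker delta.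
   Context: For $q=1$, "subspaces" of $V$ are subsets and $\operatorname{rk}U=\#U$; for $q\ge2$ they are $\mathbb{F}_q$-linear subspaces and $\operatorname{rk}U=\dim U$. $U\le W$ means inclusion. $\mathcal{L}(V)$ is the lattice of all subspaces of $V$ and ${V\brack k}$ the set of those of rank $k$. $[m]_q=1+q+\cdots+q^{m-1}$ (so $[m]_1=m$), and ${n\brack k}_q$ is the Gaussian binomial coefficient (ordinary binomial for $q=1$). For a subspace $U$ of $V$, $\boldsymbol{x}_U^{(k)}$ is the characteristic function of $\{K\in{V\brack k}\mid U\le K\}$. For $i\in\{0,\ldots,\min(k,n-k)\}$, $\bar V_i^{(k)}\subseteq\mathbb{R}^{{V\brack k}}$ is the real span of $\{\boldsymbol{x}_I^{(k)}\mid I\in{V\brack i}\}$; this set is a basis of $\bar V_i^{(k)}$ (a known fact), and the spaces form an increasing chain with $\bar V^{(k)}_{\min(k,n-k)}=\mathbb{R}^{{V\brack k}}$. For $f\in\bar V_i^{(k)}$, the $i$-weight distribution $\operatorname{wt}_f^{(i)}:{V\brack i}\to\mathbb{R}$ is the unique function with $f=\sum_{I\in{V\brack i}}\operatorname{wt}_f^{(i)}(I)\,\boldsymbol{x}_I^{(k)}$. The degree of a non-zero $f$ is the smallest $t\in\{0,\ldots,\min(k,n-k)\}$ with $f\in\bar V_t^{(k)}$; $\deg(\boldsymbol 0)=-\infty$. Dualization: fix an anti-automorphism (order-reversing bijection) $U\mapsto U^\perp$ of $\mathcal{L}(V)$, e.g. $U\mapsto V\setminus U$ for $q=1$, or the orthogonal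 space with respect to a non-degenerate bilinear form for $q\ge2$. The dualized function of $f:{V\brack k}\to\mathbb{R}$ is $f^\perp:{V\brack n-k}\to\mathbb{R}$ with $f^\perp(K^\perp)=f(K)$ for $K\in{V\brack k}$. -}

module Defs where

open import Level using (Level; _⊔_) renaming (suc to lsuc)
open import Algebra.Bundles using (CommutativeRing)
open import Algebra.Module.Bundles using (Module)
import Algebra.Properties.AbelianGroup as AbelianGroupProperties
import Algebra.Properties.Monoid.Sum as Sum
import Relation.Binary.Reasoning.Setoid as SetoidReasoning
open import Data.Bool.Base using (true; false; if_then_else_)
open import Data.Fin.Base using (Fin; zero; suc; finToFun; funToFin)
open import Data.Fin.Properties using (any?; all?; finToFun-funToFin) renaming (_≟_ to _≟ᶠ_)
open import Data.Fin.Subset using (Subset; _∈_; _⊆_; _∩_; ∣_∣) renaming (⊤ to full)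
open import Data.Fin.Subset.Properties using (_∈?_; _⊆?_; ∈⊤; x∈p∩q⁺; x∈p∩q⁻)
open import Data.List.Base using (List; []; _∷_; _++_; map; mapMaybe; foldr; allFin)
import Data.List.Membership.Propositional as List
open import Data.List.Membership.Propositional.Properties using (∈-allFin)
open import Data.List.Relation.Unary.Any using (here; there)
open import Data.Maybe.Base using (Maybe; just; nothing)
open import Data.Nat.Base as ℕ using (ℕ; zero; suc; _∸_; _^_; _⊓_)
open import Data.Nat.Combinatorics using (_C_)
import Data.Nat.Properties as ℕ
open import Data.Integer.Base using (+_)
open import Data.Product.Base using (Σ; ∃; _×_; _,_; proj₁; proj₂)
open import Data.Rational.Base as ℚ using (ℚ; 0ℚ; 1ℚ; ½)
import Data.Rational.Properties as ℚ
open import Data.Rational.Solver using (module +-*-Solver)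
open import Data.Unit.Base using (⊤; tt)
open import Data.Vec.Base using ([]; _∷_)
import Data.Vec.Functional as Vector
open import Function.Base using (_∘_; flip)
open import Function.Bundles using (Inverse)
open import Relation.Binary.Bundles using (Setoid)
open import Relation.Binary.Morphism.Structures using (IsOrderIsomorphism)
open import Relation.Binary.PropositionalEquality as ≡ using (_≡_; refl)
open import Relation.Nullary using (¬_; Dec; yes; no; does; contradiction)
open import Relation.Nullary.Construct.Add.Infimum using (_₋; ⊥₋; [_])
open import Relation.Nullary.Decidable using (map′; _×-dec_; _→-dec_)

private
  variable
    c ℓ m ℓm : Level

-- Real numbers are Cauchy sequences of rationals, considered up to _≈ℝ_: the
-- difference is a null sequence.

record ℝ : Set where
  constructor mkℝ
  field
    seq    : ℕ → ℚ
    cauchy : ∀ ε → 0ℚ ℚ.< ε →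
             ∃ λ N → ∀ a b → N ℕ.≤ a → N ℕ.≤ b → ℚ.∣ seq a ℚ.- seq b ∣ ℚ.< ε

open ℝ

infix 4 _≈ℝ_
_≈ℝ_ : ℝ → ℝ → Set
x ≈ℝ y = ∀ ε → 0ℚ ℚ.< ε → ∃ λ N → ∀ a → N ℕ.≤ a → ℚ.∣ seq x a ℚ.- seq y a ∣ ℚ.< ε

fromℚ : ℚ → ℝ
fromℚ p = mkℝ (λ _ → p) λ ε ε>0 → 0 , λ _ _ _ _ →
  ≡.subst (ℚ._< ε) (≡.sym (≡.cong ℚ.∣_∣ (ℚ.+-inverseʳ p))) ε>0

0ℝ 1ℝ : ℝ
0ℝ = fromℚ 0ℚ
1ℝ = fromℚ 1ℚ

½-pos : ∀ {ε} → 0ℚ ℚ.< ε → 0ℚ ℚ.< ½ ℚ.* ε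
½-pos {ε} ε>0 = ≡.subst (ℚ._< ½ ℚ.* ε) (ℚ.*-zeroʳ ½) (ℚ.*-monoʳ-<-pos ½ ε>0)

halves : ∀ ε → ½ ℚ.* ε ℚ.+ ½ ℚ.* ε ≡ ε
halves ε = ≡.trans (≡.sym (ℚ.*-distribʳ-+ ε ½ ½)) (ℚ.*-identityˡ ε)

scale : ∀ B ε → 0ℚ ℚ.< B → 0ℚ ℚ.< ε → ∃ λ δ → 0ℚ ℚ.< δ × B ℚ.* δ ≡ ½ ℚ.* ε
scale B ε B>0 ε>0 = 1/B ℚ.* (½ ℚ.* ε) , pos , eq
  where
  instance
    B-pos : ℚ.Positive B
    B-pos = ℚ.positive B>0
    B-nz : ℚ.NonZero B
    B-nz = ℚ.pos⇒nonZero B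
  1/B = ℚ.1/ B
  instance
    1/B-pos : ℚ.Positive 1/B
    1/B-pos = ℚ.1/pos⇒pos B
  pos : 0ℚ ℚ.< 1/B ℚ.* (½ ℚ.* ε)
  pos = ≡.subst (ℚ._< 1/B ℚ.* (½ ℚ.* ε)) (ℚ.*-zeroʳ 1/B) (ℚ.*-monoʳ-<-pos 1/B (½-pos ε>0))
  eq : B ℚ.* (1/B ℚ.* (½ ℚ.* ε)) ≡ ½ ℚ.* ε
  eq = ≡.trans (≡.sym (ℚ.*-assoc B 1/B (½ ℚ.* ε)))
      (≡.trans (≡.cong (ℚ._* (½ ℚ.* ε)) (ℚ.*-inverseʳ B)) (ℚ.*-identityˡ (½ ℚ.* ε)))

split : ∀ s t → s ≡ (s ℚ.- t) ℚ.+ t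
split = solve 2 (λ s t → s := (s :- t) :+ t) refl
  where open +-*-Solver

+-difference : ∀ s t u v → (s ℚ.+ t) ℚ.- (u ℚ.+ v) ≡ (s ℚ.- u) ℚ.+ (t ℚ.- v)
+-difference = solve 4 (λ s t u v → (s :+ t) :- (u :+ v) := (s :- u) :+ (t :- v)) refl
  where open +-*-Solver

*-difference : ∀ s t u v → s ℚ.* t ℚ.- u ℚ.* v ≡ s ℚ.* (t ℚ.- v) ℚ.+ v ℚ.* (s ℚ.- u)
*-difference = solve 4 (λ s t u v → s :* t :- u :* v := s :* (t :- v) :+ v :* (s :- u)) refl
  where open +-*-Solver

eventuallyBounded : ∀ x → ∃ λ N → ∃ λ B → 0ℚ ℚ.< B × (∀ a → N ℕ.≤ a → ℚ.∣ seq x a ∣ ℚ.≤ B)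
eventuallyBounded x =
  N , 1ℚ ℚ.+ ℚ.∣ seq x N ∣ , ℚ.+-mono-<-≤ (ℚ.positive⁻¹ 1ℚ) (ℚ.0≤∣p∣ (seq x N)) , bound
  where
  open ℚ.≤-Reasoning
  N = proj₁ (cauchy x 1ℚ (ℚ.positive⁻¹ 1ℚ))
  bound : ∀ a → N ℕ.≤ a → ℚ.∣ seq x a ∣ ℚ.≤ 1ℚ ℚ.+ ℚ.∣ seq x N ∣
  bound a N≤a = begin
    ℚ.∣ seq x a ∣                                  ≡⟨ ≡.cong ℚ.∣_∣ (split (seq x a) (seq x N)) ⟩
    ℚ.∣ (seq x a ℚ.- seq x N) ℚ.+ seq x N ∣        ≤⟨ ℚ.∣p+q∣≤∣p∣+∣q∣ (seq x a ℚ.- seq x N) (seq x N) ⟩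
    ℚ.∣ seq x a ℚ.- seq x N ∣ ℚ.+ ℚ.∣ seq x N ∣    ≤⟨ ℚ.+-monoˡ-≤ ℚ.∣ seq x N ∣ (ℚ.<⇒≤ (proj₂ (cauchy x 1ℚ (ℚ.positive⁻¹ 1ℚ)) a N N≤a ℕ.≤-refl)) ⟩
    1ℚ ℚ.+ ℚ.∣ seq x N ∣                           ∎

*-mono-abs : ∀ p q {B δ} → ℚ.∣ p ∣ ℚ.≤ B → ℚ.∣ q ∣ ℚ.< δ → 0ℚ ℚ.< B → ℚ.∣ p ℚ.* q ∣ ℚ.< B ℚ.* δ
*-mono-abs p q {B} {δ} p≤B q<δ B>0 = begin-strict
  ℚ.∣ p ℚ.* q ∣         ≡⟨ ℚ.∣p*q∣≡∣p∣*∣q∣ p q ⟩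
  ℚ.∣ p ∣ ℚ.* ℚ.∣ q ∣   ≤⟨ ℚ.*-monoʳ-≤-nonNeg ℚ.∣ q ∣ {{ℚ.∣-∣-nonNeg q}} p≤B ⟩
  B ℚ.* ℚ.∣ q ∣         <⟨ ℚ.*-monoʳ-<-pos B {{ℚ.positive B>0}} q<δ ⟩
  B ℚ.* δ               ∎
  where open ℚ.≤-Reasoning

+-close : ∀ s t u v {ε} → ℚ.∣ s ℚ.- u ∣ ℚ.< ½ ℚ.* ε → ℚ.∣ t ℚ.- v ∣ ℚ.< ½ ℚ.* ε →
          ℚ.∣ (s ℚ.+ t) ℚ.- (u ℚ.+ v) ∣ ℚ.< ε
+-close s t u v {ε} su tv = begin-strict
  ℚ.∣ (s ℚ.+ t) ℚ.- (u ℚ.+ v) ∣       ≡⟨ ≡.cong ℚ.∣_∣ (+-difference s t u v) ⟩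
  ℚ.∣ (s ℚ.- u) ℚ.+ (t ℚ.- v) ∣       ≤⟨ ℚ.∣p+q∣≤∣p∣+∣q∣ (s ℚ.- u) (t ℚ.- v) ⟩
  ℚ.∣ s ℚ.- u ∣ ℚ.+ ℚ.∣ t ℚ.- v ∣     <⟨ ℚ.+-mono-< su tv ⟩
  ½ ℚ.* ε ℚ.+ ½ ℚ.* ε                 ≡⟨ halves ε ⟩
  ε                                   ∎
  where open ℚ.≤-Reasoning

*-close : ∀ s t u v {B₁ B₂ δ₁ δ₂ ε} → 0ℚ ℚ.< B₁ → 0ℚ ℚ.< B₂ →
          B₁ ℚ.* δ₁ ≡ ½ ℚ.* ε → B₂ ℚ.* δ₂ ≡ ½ ℚ.* ε →
          ℚ.∣ s ∣ ℚ.≤ B₁ → ℚ.∣ v ∣ ℚ.≤ B₂ →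
          ℚ.∣ t ℚ.- v ∣ ℚ.< δ₁ → ℚ.∣ s ℚ.- u ∣ ℚ.< δ₂ →
          ℚ.∣ s ℚ.* t ℚ.- u ℚ.* v ∣ ℚ.< ε
*-close s t u v {B₁} {B₂} {δ₁} {δ₂} {ε} B₁>0 B₂>0 eq₁ eq₂ s≤ v≤ tv su = begin-strict
  ℚ.∣ s ℚ.* t ℚ.- u ℚ.* v ∣                             ≡⟨ ≡.cong ℚ.∣_∣ (*-difference s t u v) ⟩
  ℚ.∣ s ℚ.* (t ℚ.- v) ℚ.+ v ℚ.* (s ℚ.- u) ∣             ≤⟨ ℚ.∣p+q∣≤∣p∣+∣q∣ (s ℚ.* (t ℚ.- v)) (v ℚ.* (s ℚ.- u)) ⟩
  ℚ.∣ s ℚ.* (t ℚ.- v) ∣ ℚ.+ ℚ.∣ v ℚ.* (s ℚ.- u) ∣       <⟨ ℚ.+-mono-< (*-mono-abs s (t ℚ.- v) s≤ tv B₁>0) (*-mono-abs v (s ℚ.- u) v≤ su B₂>0) ⟩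
  B₁ ℚ.* δ₁ ℚ.+ B₂ ℚ.* δ₂                               ≡⟨ ≡.cong₂ ℚ._+_ eq₁ eq₂ ⟩
  ½ ℚ.* ε ℚ.+ ½ ℚ.* ε                                   ≡⟨ halves ε ⟩
  ε                                                     ∎
  where open ℚ.≤-Reasoning

+-cauchy : ∀ x y ε → 0ℚ ℚ.< ε → ∃ λ N → ∀ a b → N ℕ.≤ a → N ℕ.≤ b →
           ℚ.∣ (seq x a ℚ.+ seq y a) ℚ.- (seq x b ℚ.+ seq y b) ∣ ℚ.< ε
+-cauchy x y ε ε>0 = N₁ ℕ.⊔ N₂ , λ a b N≤a N≤b →
  +-close (seq x a) (seq y a) (seq x b) (seq y b)
    (proj₂ cx a b (ℕ.m⊔n≤o⇒m≤o N₁ N₂ N≤a) (ℕ.m⊔n≤o⇒m≤o N₁ N₂ N≤b))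
    (proj₂ cy a b (ℕ.m⊔n≤o⇒n≤o N₁ N₂ N≤a) (ℕ.m⊔n≤o⇒n≤o N₁ N₂ N≤b))
  where
  cx = cauchy x (½ ℚ.* ε) (½-pos ε>0)
  cy = cauchy y (½ ℚ.* ε) (½-pos ε>0)
  N₁ = proj₁ cx
  N₂ = proj₁ cy

*-cauchy : ∀ x y ε → 0ℚ ℚ.< ε → ∃ λ N → ∀ a b → N ℕ.≤ a → N ℕ.≤ b →
           ℚ.∣ seq x a ℚ.* seq y a ℚ.- seq x b ℚ.* seq y b ∣ ℚ.< ε
*-cauchy x y ε ε>0 =
  let M₁ , B₁ , B₁>0 , bound₁ = eventuallyBounded x
      M₂ , B₂ , B₂>0 , bound₂ = eventuallyBounded y
      δ₁ , δ₁>0 , eq₁ = scale B₁ ε B₁>0 ε>0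
      δ₂ , δ₂>0 , eq₂ = scale B₂ ε B₂>0 ε>0
      N₁ , close₁ = cauchy x δ₂ δ₂>0
      N₂ , close₂ = cauchy y δ₁ δ₁>0
      M = M₁ ℕ.⊔ M₂
      N = N₁ ℕ.⊔ N₂
  in M ℕ.⊔ N , λ a b ≤a ≤b →
    *-close (seq x a) (seq y a) (seq x b) (seq y b) B₁>0 B₂>0 eq₁ eq₂
      (bound₁ a (ℕ.m⊔n≤o⇒m≤o M₁ M₂ (ℕ.m⊔n≤o⇒m≤o M N ≤a)))
      (bound₂ b (ℕ.m⊔n≤o⇒n≤o M₁ M₂ (ℕ.m⊔n≤o⇒m≤o M N ≤b)))
      (close₂ a b (ℕ.m⊔n≤o⇒n≤o N₁ N₂ (ℕ.m⊔n≤o⇒n≤o M N ≤a)) (ℕ.m⊔n≤o⇒n≤o N₁ N₂ (ℕ.m⊔n≤o⇒n≤o M N ≤b)))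
      (close₁ a b (ℕ.m⊔n≤o⇒m≤o N₁ N₂ (ℕ.m⊔n≤o⇒n≤o M N ≤a)) (ℕ.m⊔n≤o⇒m≤o N₁ N₂ (ℕ.m⊔n≤o⇒n≤o M N ≤b)))

infixl 6 _+ℝ_
infixl 7 _*ℝ_

_+ℝ_ : ℝ → ℝ → ℝ
x +ℝ y = mkℝ (λ a → seq x a ℚ.+ seq y a) (+-cauchy x y)

_*ℝ_ : ℝ → ℝ → ℝ
x *ℝ y = mkℝ (λ a → seq x a ℚ.* seq y a) (*-cauchy x y)

record FiniteField c ℓ : Set (lsuc (c ⊔ ℓ)) where
  field
    commutativeRing : CommutativeRing c ℓ
  open CommutativeRing commutativeRing public
  field
    1≉0         : ¬ (1# ≈ 0#)
    inverse     : ∀ x → ¬ (x ≈ 0#) → ∃ λ y → y * x ≈ 1#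
    order       : ℕ
    enumeration : Inverse (≡.setoid (Fin order)) setoid

  scalar : Fin order → Carrier
  scalar = Inverse.to enumeration

  code : Carrier → Fin order
  code = Inverse.from enumeration

  scalar-code : ∀ x → scalar (code x) ≈ x
  scalar-code = Inverse.strictlyInverseˡ enumeration

  _≟_ : ∀ x y → Dec (x ≈ y)
  x ≟ y = map′
    (λ eq → trans (sym (scalar-code x)) (trans (reflexive (≡.cong scalar eq)) (scalar-code y)))
    (Inverse.from-cong enumeration)
    (code x ≟ᶠ code y)

module LinearAlgebra (F : FiniteField c ℓ) (M : Module (FiniteField.commutativeRing F) m ℓm) where
  open FiniteField F
  open Module M
  open Sum +ᴹ-monoid using (sum)

  combination : ∀ {d} → (Fin d → Carrier) → (Fin d → Carrierᴹ) → Carrierᴹ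
  combination a b = sum λ j → a j *ₗ b j

  LinearlyIndependent : ∀ {d} → (Fin d → Carrierᴹ) → Set (c ⊔ ℓ ⊔ ℓm)
  LinearlyIndependent b = ∀ a → combination a b ≈ᴹ 0ᴹ → ∀ j → a j ≈ 0#

  _∈Span_ : ∀ {d} → Carrierᴹ → (Fin d → Carrierᴹ) → Set (c ⊔ ℓm)
  v ∈Span b = ∃ λ a → combination a b ≈ᴹ v

record FiniteDimensional (F : FiniteField c ℓ) m ℓm : Set (c ⊔ ℓ ⊔ lsuc (m ⊔ ℓm)) where
  field
    space : Module (FiniteField.commutativeRing F) m ℓm
  open Module space public
  open LinearAlgebra F space public
  field
    dimension   : ℕ
    basis       : Fin dimension → Carrierᴹ
    independent : LinearlyIndependent basis
    spanning    : ∀ v → v ∈Span basis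

-- Vectors are encoded by their coordinates with respect to the given basis,
-- i.e. by the elements of Fin (order ^ dimension); a set of vectors is then a
-- `Subset` of codes.
module Subspaces (F : FiniteField c ℓ) (V : FiniteDimensional F m ℓm) where
  open FiniteField F hiding (zero; refl)
  open FiniteDimensional V

  cardinality : ℕ
  cardinality = order ^ dimension

  point : Fin cardinality → Carrierᴹ
  point x = combination (scalar ∘ finToFun x) basis

  index : Carrierᴹ → Fin cardinality
  index v = funToFin (code ∘ proj₁ (spanning v))

  record IsLinearSubspace (U : Subset cardinality) : Set where
    field
      0-closed : index 0ᴹ ∈ U
      +-closed : ∀ x y → x ∈ U → y ∈ U → index (point x +ᴹ point y) ∈ U
      *-closed : ∀ s x → x ∈ U → index (scalar s *ₗ point x) ∈ U

  isLinearSubspace? : ∀ U → Dec (IsLinearSubspace U)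
  isLinearSubspace? U = map′
    (λ (z , p , s) → record { 0-closed = z ; +-closed = p ; *-closed = s })
    (λ S → let open IsLinearSubspace S in 0-closed , +-closed , *-closed)
    (index 0ᴹ ∈? U
      ×-dec all? (λ x → all? λ y → (x ∈? U) →-dec ((y ∈? U) →-dec (index (point x +ᴹ point y) ∈? U)))
      ×-dec all? (λ s → all? λ x → (x ∈? U) →-dec (index (scalar s *ₗ point x) ∈? U)))

  record IsBasisOf (U : Subset cardinality) {d : ℕ} (b : Fin d → Fin cardinality) : Set (c ⊔ ℓ ⊔ ℓm) where
    field
      inside    : ∀ j → b j ∈ U
      lin-indep : LinearlyIndependent (point ∘ b)
      spans     : ∀ x → x ∈ U → point x ∈Span (point ∘ b)

  open AbelianGroupProperties +ᴹ-abelianGroup using (x∙y⁻¹≈ε⇒x≈y; x≈y⇒x∙y⁻¹≈ε)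
  open SetoidReasoning ≈ᴹ-setoid

  combination-cong : ∀ {d} {a a′ : Fin d → Carrier} (b : Fin d → Carrierᴹ) →
                     (∀ j → a j ≈ a′ j) → combination a b ≈ᴹ combination a′ b
  combination-cong {zero}  b eq = ≈ᴹ-refl
  combination-cong {suc d} b eq =
    +ᴹ-cong (*ₗ-cong (eq zero) ≈ᴹ-refl) (combination-cong (b ∘ suc) (eq ∘ suc))

  combination-0 : ∀ {d} (a : Fin d → Carrier) (b : Fin d → Carrierᴹ) →
                  (∀ j → a j ≈ 0#) → combination a b ≈ᴹ 0ᴹ
  combination-0 {zero}  a b eq = ≈ᴹ-refl
  combination-0 {suc d} a b eq = ≈ᴹ-trans
    (+ᴹ-cong (≈ᴹ-trans (*ₗ-cong (eq zero) ≈ᴹ-refl) (*ₗ-zeroˡ (b zero)))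
             (combination-0 (a ∘ suc) (b ∘ suc) (eq ∘ suc)))
    (+ᴹ-identityˡ 0ᴹ)

  combination-*ₗ : ∀ {d} s (a : Fin d → Carrier) (b : Fin d → Carrierᴹ) →
                   combination (λ j → s * a j) b ≈ᴹ s *ₗ combination a b
  combination-*ₗ {zero}  s a b = ≈ᴹ-sym (*ₗ-zeroʳ s)
  combination-*ₗ {suc d} s a b = ≈ᴹ-trans
    (+ᴹ-cong (*ₗ-assoc s (a zero) (b zero)) (combination-*ₗ s (a ∘ suc) (b ∘ suc)))
    (≈ᴹ-sym (*ₗ-distribˡ s _ _))

  ≈0? : ∀ v → Dec (v ≈ᴹ 0ᴹ)
  ≈0? v with spanning v
  ... | a , eq = map′
    (λ a≈0 → ≈ᴹ-trans (≈ᴹ-sym eq) (combination-0 a basis a≈0))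
    (λ v≈0 → independent a (≈ᴹ-trans eq v≈0))
    (all? λ j → a j ≟ 0#)

  _≟ᴹ_ : ∀ v w → Dec (v ≈ᴹ w)
  v ≟ᴹ w = map′ (x∙y⁻¹≈ε⇒x≈y v w) (x≈y⇒x∙y⁻¹≈ε) (≈0? (v +ᴹ -ᴹ w))

  _∈Span?_ : ∀ {d} v (b : Fin d → Carrierᴹ) → Dec (v ∈Span b)
  v ∈Span? b = map′
    (λ (x , eq) → scalar ∘ finToFun x , eq)
    (λ (a , eq) → funToFin (code ∘ a) , ≈ᴹ-trans
      (combination-cong b λ j → trans
        (reflexive (≡.cong scalar (finToFun-funToFin (code ∘ a) j))) (scalar-code (a j)))
      eq)
    (any? λ x → combination (scalar ∘ finToFun x) b ≟ᴹ v)

  ∈Span-tail : ∀ {d} {b : Fin (suc d) → Carrierᴹ} {v} → v ∈Span (b ∘ suc) → v ∈Span b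
  ∈Span-tail {b = b} {v} (a , eq) = 0# Vector.∷ a , (begin
    0# *ₗ b zero +ᴹ combination a (b ∘ suc) ≈⟨ +ᴹ-cong (*ₗ-zeroˡ (b zero)) eq ⟩
    0ᴹ +ᴹ v                                 ≈⟨ +ᴹ-identityˡ v ⟩
    v                                       ∎)

  ∈Span-head : ∀ {d} (b : Fin (suc d) → Carrierᴹ) → b zero ∈Span b
  ∈Span-head b = 1# Vector.∷ (λ _ → 0#) , (begin
    1# *ₗ b zero +ᴹ combination (λ _ → 0#) (b ∘ suc)
      ≈⟨ +ᴹ-cong (*ₗ-identityˡ (b zero)) (combination-0 _ (b ∘ suc) λ _ → refl′) ⟩
    b zero +ᴹ 0ᴹ ≈⟨ +ᴹ-identityʳ (b zero) ⟩
    b zero       ∎)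
    where refl′ = CommutativeRing.refl commutativeRing

  extend-independent : ∀ {d} (b : Fin (suc d) → Carrierᴹ) → LinearlyIndependent (b ∘ suc) →
                       ¬ (b zero ∈Span (b ∘ suc)) → LinearlyIndependent b
  extend-independent b ind b₀∉ a eq with a zero ≟ 0#
  ... | yes a₀≈0 = λ where
    zero    → a₀≈0
    (suc j) → ind (a ∘ suc) (begin
      combination (a ∘ suc) (b ∘ suc)                     ≈⟨ +ᴹ-identityˡ _ ⟨
      0ᴹ +ᴹ combination (a ∘ suc) (b ∘ suc)               ≈⟨ +ᴹ-cong (≈ᴹ-trans (*ₗ-cong a₀≈0 ≈ᴹ-refl) (*ₗ-zeroˡ (b zero))) ≈ᴹ-refl ⟨
      a zero *ₗ b zero +ᴹ combination (a ∘ suc) (b ∘ suc) ≈⟨ eq ⟩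
      0ᴹ                                                  ∎) j
  ... | no a₀≉0 = contradiction ((λ j → y * (- 1# * a (suc j))) , (begin
      combination (λ j → y * (- 1# * a (suc j))) (b ∘ suc)  ≈⟨ combination-*ₗ y _ (b ∘ suc) ⟩
      y *ₗ combination (λ j → - 1# * a (suc j)) (b ∘ suc)   ≈⟨ *ₗ-cong refl′ (combination-*ₗ (- 1#) _ (b ∘ suc)) ⟩
      y *ₗ (- 1# *ₗ w)                                      ≈⟨ *ₗ-cong refl′ -w≈u ⟩
      y *ₗ (a zero *ₗ b zero)                               ≈⟨ *ₗ-assoc y (a zero) (b zero) ⟨
      (y * a zero) *ₗ b zero                                ≈⟨ *ₗ-cong (proj₂ (inverse (a zero) a₀≉0)) ≈ᴹ-refl ⟩
      1# *ₗ b zero                                          ≈⟨ *ₗ-identityˡ (b zero) ⟩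
      b zero                                                ∎)) b₀∉
    where
    refl′ = CommutativeRing.refl commutativeRing
    y = proj₁ (inverse (a zero) a₀≉0)
    w = combination (a ∘ suc) (b ∘ suc)
    u = a zero *ₗ b zero
    w-w≈0 : w +ᴹ (- 1# *ₗ w) ≈ᴹ 0ᴹ
    w-w≈0 = begin
      w +ᴹ (- 1# *ₗ w)          ≈⟨ +ᴹ-cong (*ₗ-identityˡ w) ≈ᴹ-refl ⟨
      1# *ₗ w +ᴹ (- 1# *ₗ w)    ≈⟨ *ₗ-distribʳ w 1# (- 1#) ⟨
      (1# + - 1#) *ₗ w          ≈⟨ *ₗ-cong (-‿inverseʳ 1#) ≈ᴹ-refl ⟩
      0# *ₗ w                   ≈⟨ *ₗ-zeroˡ w ⟩
      0ᴹ                        ∎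
    -w≈u : - 1# *ₗ w ≈ᴹ u
    -w≈u = begin
      - 1# *ₗ w                 ≈⟨ +ᴹ-identityˡ _ ⟨
      0ᴹ +ᴹ (- 1# *ₗ w)         ≈⟨ +ᴹ-cong eq ≈ᴹ-refl ⟨
      (u +ᴹ w) +ᴹ (- 1# *ₗ w)   ≈⟨ +ᴹ-assoc u w _ ⟩
      u +ᴹ (w +ᴹ (- 1# *ₗ w))   ≈⟨ +ᴹ-cong ≈ᴹ-refl w-w≈0 ⟩
      u +ᴹ 0ᴹ                   ≈⟨ +ᴹ-identityʳ u ⟩
      u                         ∎

  record PartialBasis (U : Subset cardinality) (xs : List (Fin cardinality)) : Set (c ⊔ ℓ ⊔ ℓm) where
    field
      {length} : ℕ
      vectors  : Fin length → Fin cardinality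
      inside   : ∀ j → vectors j ∈ U
      indep    : LinearlyIndependent (point ∘ vectors)
      spans    : ∀ {x} → x List.∈ xs → x ∈ U → point x ∈Span (point ∘ vectors)
  open PartialBasis

  step : ∀ U x xs (P : PartialBasis U xs) → Dec (x ∈ U) → Dec (point x ∈Span (point ∘ vectors P)) →
         PartialBasis U (x ∷ xs)
  step U x xs P (no x∉U) _ = record
    { vectors = vectors P ; inside = inside P ; indep = indep P
    ; spans = λ { (here refl) x∈U → contradiction x∈U x∉U ; (there y∈) → spans P y∈ } }
  step U x xs P (yes x∈U) (yes x∈) = record
    { vectors = vectors P ; inside = inside P ; indep = indep P
    ; spans = λ { (here refl) _ → x∈ ; (there y∈) → spans P y∈ } }
  step U x xs P (yes x∈U) (no x∉) = record
    { vectors = x Vector.∷ vectors P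
    ; inside = λ { zero → x∈U ; (suc j) → inside P j }
    ; indep = extend-independent (point ∘ (x Vector.∷ vectors P)) (indep P) x∉
    ; spans = λ { (here refl) _ → ∈Span-head (point ∘ (x Vector.∷ vectors P))
                ; (there y∈) y∈U → ∈Span-tail {b = point ∘ (x Vector.∷ vectors P)} (spans P y∈ y∈U) } }

  greedy : ∀ U xs → PartialBasis U xs
  greedy U [] = record { length = 0 ; vectors = λ () ; inside = λ () ; indep = λ _ _ () ; spans = λ () }
  greedy U (x ∷ xs) = step U x xs P (x ∈? U) (point x ∈Span? (point ∘ vectors P))
    where P = greedy U xs

  findBasis : ∀ U → Σ ℕ λ d → Σ (Fin d → Fin cardinality) (IsBasisOf U)
  findBasis U = length P , vectors P , record
    { inside = inside P ; lin-indep = indep P ; spans = λ x → spans P (∈-allFin x) }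
    where P = greedy U (allFin cardinality)

  dim : Subset cardinality → ℕ
  dim U = proj₁ (findBasis U)

-- A finite set with n elements is taken to be Fin n; it is the case q = 1.

data Space c ℓ m ℓm : Set (lsuc (c ⊔ ℓ ⊔ m ⊔ ℓm)) where
  finiteSet   : ℕ → Space c ℓ m ℓm
  vectorSpace : (F : FiniteField c ℓ) → FiniteDimensional F m ℓm → Space c ℓ m ℓm

base : Space c ℓ m ℓm → ℕ
base (finiteSet _)     = 1
base (vectorSpace F _) = FiniteField.order F

size : Space c ℓ m ℓm → ℕ
size (finiteSet n)     = n
size (vectorSpace F V) = Subspaces.cardinality F V

IsSubspace : (V : Space c ℓ m ℓm) → Subset (size V) → Set
IsSubspace (finiteSet _)     U = ⊤
IsSubspace (vectorSpace F V) U = Subspaces.IsLinearSubspace F V U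

isSubspace? : (V : Space c ℓ m ℓm) (U : Subset (size V)) → Dec (IsSubspace V U)
isSubspace? (finiteSet _)     U = yes tt
isSubspace? (vectorSpace F V) U = Subspaces.isLinearSubspace? F V U

-- Irrelevance makes propositional equality of subspaces the same as equality
-- of their carriers.
record Subspace (V : Space c ℓ m ℓm) : Set where
  constructor _,_
  field
    carrier     : Subset (size V)
    .isSubspace : IsSubspace V carrier

open Subspace public

private
  variable
    V : Space c ℓ m ℓm

infix 4 _≤_
_≤_ : Subspace V → Subspace V → Set
U ≤ W = carrier U ⊆ carrier W

rk : Subspace V → ℕ
rk {V = finiteSet _}     U = ∣ carrier U ∣
rk {V = vectorSpace F V} U = Subspaces.dim F V (carrier U)

whole : (V : Space c ℓ m ℓm) → Subspace V
whole V = full , full-isSubspace V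
  where
  full-isSubspace : (V : Space _ _ _ _) → IsSubspace V full
  full-isSubspace (finiteSet _)     = tt
  full-isSubspace (vectorSpace F V) = record
    { 0-closed = ∈⊤ ; +-closed = λ _ _ _ _ → ∈⊤ ; *-closed = λ _ _ _ → ∈⊤ }

rank : Space c ℓ m ℓm → ℕ
rank V = rk (whole V)

infixr 7 _∧_
_∧_ : Subspace V → Subspace V → Subspace V
_∧_ {V = V} (U , U-sub) (W , W-sub) = (U ∩ W) , ∩-isSubspace V U-sub W-sub
  where
  ∩-isSubspace : (V : Space c ℓ m ℓm) {U W : Subset (size V)} →
                 IsSubspace V U → IsSubspace V W → IsSubspace V (U ∩ W)
  ∩-isSubspace (finiteSet _)     _ _ = tt
  ∩-isSubspace (vectorSpace F V) {U} {W} SU SW = record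
    { 0-closed = x∈p∩q⁺ (SU.0-closed , SW.0-closed)
    ; +-closed = λ x y x∈ y∈ →
        let xU , xW = x∈p∩q⁻ U W x∈ ; yU , yW = x∈p∩q⁻ U W y∈
        in x∈p∩q⁺ (SU.+-closed x y xU yU , SW.+-closed x y xW yW)
    ; *-closed = λ s x x∈ →
        let xU , xW = x∈p∩q⁻ U W x∈
        in x∈p∩q⁺ (SU.*-closed s x xU , SW.*-closed s x xW)
    }
    where
    module SU = Subspaces.IsLinearSubspace SU
    module SW = Subspaces.IsLinearSubspace SW

IsAntiAutomorphism : (Subspace V → Subspace V) → Set
IsAntiAutomorphism = IsOrderIsomorphism _≡_ _≡_ _≤_ (flip _≤_)

record Gr (V : Space c ℓ m ℓm) (k : ℕ) : Set where
  constructor _,_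
  field
    subspace : Subspace V
    .hasRank : rk subspace ≡ k

open Gr public

subsets : ∀ n → List (Subset n)
subsets zero    = [] ∷ []
subsets (suc n) = map (false ∷_) (subsets n) ++ map (true ∷_) (subsets n)

members : (V : Space c ℓ m ℓm) (k : ℕ) → List (Gr V k)
members V k = mapMaybe toGr (subsets (size V))
  where
  toGr : Subset (size V) → Maybe (Gr V k)
  toGr U with isSubspace? V U
  ... | no _ = nothing
  ... | yes S with rk {V = V} (U , S) ℕ.≟ k
  ...   | no _  = nothing
  ...   | yes r = just ((U , S) , r)

∑Gr : ∀ k → (Gr V k → ℝ) → ℝ
∑Gr {V = V} k g = foldr (λ I s → g I +ℝ s) 0ℝ (members V k)

char : (k : ℕ) → Subspace V → Gr V k → ℝ
char k U K = if does (carrier U ⊆? carrier (subspace K)) then 1ℝ else 0ℝ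

IsWeightDistribution : ∀ {k} i → (Gr V k → ℝ) → (Gr V i → ℝ) → Set
IsWeightDistribution {k = k} i f wt =
  ∀ K → f K ≈ℝ ∑Gr i λ I → wt I *ℝ char k (subspace I) K

_∈V̄_ : ∀ {k} → (Gr V k → ℝ) → ℕ → Set
f ∈V̄ i = ∃ λ wt → IsWeightDistribution i f wt

IsZero : ∀ {k} → (Gr V k → ℝ) → Set
IsZero f = ∀ K → f K ≈ℝ 0ℝ

-- ⊥₋ plays the role of -∞.
HasDegree : ∀ {k} → (Gr V k → ℝ) → ℕ ₋ → Set
HasDegree f ⊥₋ = IsZero f
HasDegree {V = V} {k = k} f [ t ] =
  ¬ IsZero f × t ℕ.≤ k ⊓ (rank V ∸ k) × f ∈V̄ t × (∀ s → s ℕ.< t → ¬ (f ∈V̄ s))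

max0 : ℕ ₋ → ℕ
max0 ⊥₋    = 0
max0 [ t ] = t

-- As U ↦ U^⊥ maps the subspaces of rank k bijectively onto those of rank
-- n - k, this determines f^⊥.
IsDualized : ∀ {k l} → (Subspace V → Subspace V) → (Gr V k → ℝ) → (Gr V l → ℝ) → Set
IsDualized _^⊥ f f^⊥ = ∀ K L → subspace L ≡ (subspace K) ^⊥ → f^⊥ L ≈ℝ f K

[_]⟨_⟩ : ℕ → ℕ → ℕ
[ zero  ]⟨ q ⟩ = 0
[ suc j ]⟨ q ⟩ = [ j ]⟨ q ⟩ ℕ.+ q ^ j

fromℕ : ℕ → ℚ
fromℕ a = + a ℚ./ 1

-- The value at 0 is junk; γ q k i z does not use it if z ≤ i ≤ k and q ≥ 1.
inv : ℚ → ℚ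
inv p with p ℚ.≟ 0ℚ
... | yes _   = 0ℚ
... | no p≢0 = ℚ.1/_ p {{ℚ.≢-nonZero p≢0}}

-- [ m choose j ]_q as the product of [ m - a ]_q / [ a + 1 ]_q over a < j.
gaussian : (q m j : ℕ) → ℚ
gaussian q m zero    = 1ℚ
gaussian q m (suc j) = gaussian q m j ℚ.* (fromℕ [ m ∸ j ]⟨ q ⟩ ℚ.* inv (fromℕ [ suc j ]⟨ q ⟩))

sign : ℕ → ℚ
sign zero    = 1ℚ
sign (suc a) = ℚ.- sign a

δ : ℕ → ℕ → ℚ
δ a b = if does (a ℕ.≟ b) then 1ℚ else 0ℚ

γ : (q k i z : ℕ) → ℚ
γ q k i z =
  if does (i ℕ.≟ k) then δ z k else
    sign (i ∸ z)
      ℚ.* inv (fromℕ (q ^ ((k ∸ i) ℕ.* (i ∸ z) ℕ.+ (i ∸ z) C 2)))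
      ℚ.* (fromℕ [ k ∸ i ]⟨ q ⟩ ℚ.* inv (fromℕ [ k ∸ z ]⟨ q ⟩))
      ℚ.* inv (gaussian q k z)

{-# OPTIONS --safe #-}
-- For I of rank i the dual of x_I is the indicator of L ≤ I^⊥, so everything rests on
--   Σ γ(k,i,rk(A ∧ J)) [J ≤ L] = [L ≤ A]   (sum over J of rank i ≤ k = rk L, where k ≤ i + rk(A ∧ L)).
-- Here [P] is 1 or 0 for a proposition P, and [m] is the q-number for a number m.
-- Put B = A ∧ L, b = rk B and ζ(X) = rk(X ∧ B). If b < k, weight every pair H < J of ranks i-1 and i below L by
-- a(ζ(H)) ([b - ζ(H)] - [ζ(J) = ζ(H) + 1] [k - i + 1]). Summing over J first gives 0, because H has [k - i + 1]
-- covers in L and [b - ζ(H)] of them raise ζ. Summing over H first gives [k - b] [k - i] Σ γ [J ≤ L] when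
-- a(z) = q^(k-b+z-i) γ(k,i,z). If b = k, every J ≤ L contributes γ(k,i,i), the inverse of
-- their number.
-- The identity in the dual lattice inverts the inclusion matrix from the left, so weights are unique.
-- All counts follow from the numbers of points of subspaces, for sets (q = 1) and vector spaces alike.
module Submission where

open import Data.Nat.Base using (ℕ; _∸_; _⊓_) renaming (_≤_ to _≤ᴺ_)
open import Data.Product.Base using (_×_)
open import Relation.Nullary.Construct.Add.Infimum using (_₋)
open import Defs

open import Level using (Level)
import Algebra.Properties.AbelianGroup as AbelianGroupProperties
open import Data.Bool.Base using (true; false; if_then_else_)
import Data.Bool.Properties as Bool
open import Data.Fin.Base using (Fin; zero; suc; finToFun; funToFin; combine)
import Data.Fin.Properties as Fin
open import Data.Fin.Subset using (Subset; _∈_; _∉_; _⊆_; _∩_; _∪_; ⁅_⁆; ⊥; ∣_∣)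
open import Data.Fin.Subset.Properties using (_∈?_; _⊆?_; ⊆-antisym; ⊆⊤; ⊥⊆; ∣⊥∣≡0; drop-there; p∩q⊆p; p∩q⊆q; x∈p∩q⁺; ∩-comm; p⊆p∪q; q⊆p∪q; x∈p∪q⁻; x∈p∪q⁺; ∪-identityʳ; x∈⁅x⁆; x∈⁅y⁆⇒x≡y; p⊆q⇒∣p∣≤∣q∣; p⊂q⇒∣p∣<∣q∣)
import Data.Integer.Base as ℤ
import Data.Integer.Properties as ℤ
open import Data.List.Base using (List; []; _∷_; _++_; map; mapMaybe; foldr; tabulate; allFin)
open import Data.List.Properties using (map-tabulate)
open import Data.Maybe.Base using (Maybe; just; nothing; maybe′)
open import Data.Nat.Base as ℕ using (zero; suc; pred; _^_)
open import Data.Nat.Combinatorics using (_C_; nC1≡n; nCk+nC[k+1]≡[n+1]C[k+1])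
import Data.Nat.Properties as ℕ
open import Data.Nat.Solver using () renaming (module +-*-Solver to ℕ-Solver)
open import Data.Product.Base using (Σ; ∃; _,_; proj₁; proj₂)
open import Data.Rational.Base as ℚ using (ℚ; 0ℚ; 1ℚ; _+_; _*_; -_; _-_)
import Data.Rational.Properties as ℚ
open import Data.Rational.Solver using (module +-*-Solver)
import Data.Rational.Unnormalised.Base as ℚᵘ
import Data.Rational.Unnormalised.Properties as ℚᵘ
open import Data.Sum.Base using (_⊎_; inj₁; inj₂)
open import Data.Unit.Base using (tt)
open import Data.Vec.Base as Vec using ([]; _∷_; here; there)
import Data.Vec.Functional as Vector
import Data.Vec.Properties as Vec
open import Function.Base using (_∘_)
open import Function.Bundles using (Inverse)
open import Relation.Binary.Definitions using (DecidableEquality; tri<; tri≈; tri>)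
open import Relation.Binary.Morphism.Structures using (IsOrderIsomorphism)
open import Relation.Binary.PropositionalEquality
import Relation.Binary.Reasoning.Setoid as SetoidReasoning
open import Relation.Nullary using (¬_; Dec; yes; no; does; contradiction; recompute)
open import Relation.Nullary.Construct.Add.Infimum using (⊥₋; [_])
open import Relation.Nullary.Decidable using (map′; _×-dec_; ¬?; dec-true; dec-false; decidable-stable)

open ℝ

-- For J ≤ L of rank i with z = rk (J ∧ B), the exponent k-b+z-i of the weight a(z) is the corank of
-- J + B in L; for the lower member H of a pair, k-b+ζ(H)-i is one less than the corank of H + B. If
-- H + B = L the subtraction truncates, but then [b-ζ(H)] = [k-i+1] and every J between H and L
-- raises ζ, so all pairs over this H have weight 0. The bound k ≤ i + b removes the boundary term
-- at z = 0, where no H with ζ(H) = z-1 exists: the residue there is a multiple of [k-b-i]. For A =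
-- I^⊥ the bound holds because A has corank i. Summing over H needs the number of hyperplanes of J
-- above J ∧ B. The given anti-automorphism turns them into covers, so points are the only objects
-- counted directly. The reals are Cauchy sequences up to null sequences. The matrix identities are
-- rational and hold in every term of a sequence; an estimate is needed only to apply a fixed
-- rational combination to functions that agree up to ≈ℝ. Hence uniqueness of weights comes from an
-- explicit rational left inverse.

private
  variable
    ℓ₁ ℓ₂ ℓ₃ ℓ₄ : Level
    A : Set ℓ₁
    B : Set ℓ₂
    Φ : Set ℓ₁
    Ψ : Set ℓ₂
    V : Space ℓ₁ ℓ₂ ℓ₃ ℓ₄


-- Rational arithmetic and finite sums

fromℕ-+ : ∀ m n → fromℕ (m ℕ.+ n) ≡ fromℕ m + fromℕ n
fromℕ-+ m n = ℚ.toℚᵘ-injective (begin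
  ℚ.toℚᵘ (fromℕ (m ℕ.+ n))                    ≈⟨ ℚ.toℚᵘ-fromℚᵘ _ ⟩
  ℚᵘ.mkℚᵘ (ℤ.+ (m ℕ.+ n)) 0                     ≈⟨ ℚᵘ.*≡* (cong (ℤ._* ℤ.+ 1) (trans (ℤ.pos-+ m n) (sym (cong₂ ℤ._+_ (ℤ.*-identityʳ (ℤ.+ m)) (ℤ.*-identityʳ (ℤ.+ n)))))) ⟩
  ℚᵘ.mkℚᵘ (ℤ.+ m) 0 ℚᵘ.+ ℚᵘ.mkℚᵘ (ℤ.+ n) 0        ≈⟨ ℚᵘ.+-cong (ℚ.toℚᵘ-fromℚᵘ (ℚᵘ.mkℚᵘ (ℤ.+ m) 0)) (ℚ.toℚᵘ-fromℚᵘ (ℚᵘ.mkℚᵘ (ℤ.+ n) 0)) ⟨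
  ℚ.toℚᵘ (fromℕ m) ℚᵘ.+ ℚ.toℚᵘ (fromℕ n)      ≈⟨ ℚ.toℚᵘ-homo-+ (fromℕ m) (fromℕ n) ⟨
  ℚ.toℚᵘ (fromℕ m + fromℕ n)                  ∎)
  where open ℚᵘ.≃-Reasoning

fromℕ-* : ∀ m n → fromℕ (m ℕ.* n) ≡ fromℕ m * fromℕ n
fromℕ-* m n = ℚ.toℚᵘ-injective (begin
  ℚ.toℚᵘ (fromℕ (m ℕ.* n))                    ≈⟨ ℚ.toℚᵘ-fromℚᵘ _ ⟩
  ℚᵘ.mkℚᵘ (ℤ.+ (m ℕ.* n)) 0                     ≈⟨ ℚᵘ.*≡* (cong (ℤ._* ℤ.+ 1) (ℤ.pos-* m n)) ⟩
  ℚᵘ.mkℚᵘ (ℤ.+ m) 0 ℚᵘ.* ℚᵘ.mkℚᵘ (ℤ.+ n) 0        ≈⟨ ℚᵘ.*-cong (ℚ.toℚᵘ-fromℚᵘ (ℚᵘ.mkℚᵘ (ℤ.+ m) 0)) (ℚ.toℚᵘ-fromℚᵘ (ℚᵘ.mkℚᵘ (ℤ.+ n) 0)) ⟨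
  ℚ.toℚᵘ (fromℕ m) ℚᵘ.* ℚ.toℚᵘ (fromℕ n)      ≈⟨ ℚ.toℚᵘ-homo-* (fromℕ m) (fromℕ n) ⟨
  ℚ.toℚᵘ (fromℕ m * fromℕ n)                  ∎)
  where open ℚᵘ.≃-Reasoning

fromℕ-injective : ∀ {m n} → fromℕ m ≡ fromℕ n → m ≡ n
fromℕ-injective {m} {n} eq with ℚ.fromℚᵘ-injective {ℚᵘ.mkℚᵘ (ℤ.+ m) 0} {ℚᵘ.mkℚᵘ (ℤ.+ n) 0} eq
... | ℚᵘ.*≡* m≡n = ℤ.+-injective (trans (sym (ℤ.*-identityʳ (ℤ.+ m))) (trans m≡n (ℤ.*-identityʳ (ℤ.+ n))))

fromℕ-≢0 : ∀ {n} → 1 ℕ.≤ n → fromℕ n ≢ 0ℚ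
fromℕ-≢0 {suc n} _ eq with fromℕ-injective {suc n} {0} eq
... | ()

inv-inverse : ∀ {p} → p ≢ 0ℚ → p * inv p ≡ 1ℚ
inv-inverse {p} p≢0 with p ℚ.≟ 0ℚ
... | yes p≡0 = contradiction p≡0 p≢0
... | no _    = ℚ.*-inverseʳ p {{ℚ.≢-nonZero p≢0}}

*-cancelˡ : ∀ r {p q} → r ≢ 0ℚ → r * p ≡ r * q → p ≡ q
*-cancelˡ r {p} {q} r≢0 eq = begin
  p               ≡⟨ unfold p ⟩
  inv r * (r * p) ≡⟨ cong (inv r *_) eq ⟩
  inv r * (r * q) ≡⟨ unfold q ⟨
  q               ∎
  where
  open ≡-Reasoning
  unfold : ∀ s → s ≡ inv r * (r * s)
  unfold s = begin
    s               ≡⟨ ℚ.*-identityˡ s ⟨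
    1ℚ * s          ≡⟨ cong (_* s) (trans (ℚ.*-comm (inv r) r) (inv-inverse r≢0)) ⟨
    inv r * r * s   ≡⟨ ℚ.*-assoc (inv r) r s ⟩
    inv r * (r * s) ∎

*-≢0 : ∀ {p q} → p ≢ 0ℚ → q ≢ 0ℚ → p * q ≢ 0ℚ
*-≢0 {p} p≢0 q≢0 pq≡0 = q≢0 (*-cancelˡ p p≢0 (trans pq≡0 (sym (ℚ.*-zeroʳ p))))

inv-unique : ∀ {p q} → p ≢ 0ℚ → p * q ≡ 1ℚ → q ≡ inv p
inv-unique {p} p≢0 pq≡1 = *-cancelˡ p p≢0 (trans pq≡1 (sym (inv-inverse p≢0)))

inv-≢0 : ∀ {p} → p ≢ 0ℚ → inv p ≢ 0ℚ
inv-≢0 {p} p≢0 i≡0 with trans (sym (inv-inverse p≢0)) (trans (cong (p *_) i≡0) (ℚ.*-zeroʳ p))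
... | ()

inv-* : ∀ {p q} → p ≢ 0ℚ → q ≢ 0ℚ → inv (p * q) ≡ inv p * inv q
inv-* {p} {q} p≢0 q≢0 = sym (inv-unique (*-≢0 p≢0 q≢0) (begin
  p * q * (inv p * inv q)   ≡⟨ solve 4 (λ x y u v → x :* y :* (u :* v) := (x :* u) :* (y :* v)) refl p q (inv p) (inv q) ⟩
  (p * inv p) * (q * inv q) ≡⟨ cong₂ _*_ (inv-inverse p≢0) (inv-inverse q≢0) ⟩
  1ℚ                        ∎))
  where
  open ≡-Reasoning
  open +-*-Solver

∑ : List A → (A → ℚ) → ℚ
∑ []       f = 0ℚ
∑ (x ∷ xs) f = f x + ∑ xs f

∑-cong : ∀ (xs : List A) {f g : A → ℚ} → (∀ x → f x ≡ g x) → ∑ xs f ≡ ∑ xs g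
∑-cong []       eq = refl
∑-cong (x ∷ xs) eq = cong₂ _+_ (eq x) (∑-cong xs eq)

∑-+ : ∀ (xs : List A) (f g : A → ℚ) → ∑ xs (λ x → f x + g x) ≡ ∑ xs f + ∑ xs g
∑-+ []       f g = refl
∑-+ (x ∷ xs) f g = trans (cong (_+_ (f x + g x)) (∑-+ xs f g))
  (solve 4 (λ s t u v → s :+ t :+ (u :+ v) := s :+ u :+ (t :+ v)) refl (f x) (g x) (∑ xs f) (∑ xs g))
  where open +-*-Solver

∑-*ˡ : ∀ (xs : List A) c (f : A → ℚ) → ∑ xs (λ x → c * f x) ≡ c * ∑ xs f
∑-*ˡ []       c f = sym (ℚ.*-zeroʳ c)
∑-*ˡ (x ∷ xs) c f = trans (cong (_+_ (c * f x)) (∑-*ˡ xs c f)) (sym (ℚ.*-distribˡ-+ c (f x) (∑ xs f)))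

∑-*ʳ : ∀ (xs : List A) c (f : A → ℚ) → ∑ xs (λ x → f x * c) ≡ ∑ xs f * c
∑-*ʳ xs c f = trans (∑-cong xs λ x → ℚ.*-comm (f x) c) (trans (∑-*ˡ xs c f) (ℚ.*-comm c _))

∑-- : ∀ (xs : List A) (f g : A → ℚ) → ∑ xs (λ x → f x - g x) ≡ ∑ xs f - ∑ xs g
∑-- []       f g = refl
∑-- (x ∷ xs) f g = trans (cong (_+_ (f x - g x)) (∑-- xs f g))
  (solve 4 (λ s t u v → s :- t :+ (u :- v) := s :+ u :- (t :+ v)) refl (f x) (g x) (∑ xs f) (∑ xs g))
  where open +-*-Solver

∑-zero : ∀ (xs : List A) → ∑ xs (λ _ → 0ℚ) ≡ 0ℚ
∑-zero []       = refl
∑-zero (x ∷ xs) = trans (ℚ.+-identityˡ _) (∑-zero xs)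

∑-swap : ∀ (xs : List A) (ys : List B) (f : A → B → ℚ) →
         ∑ xs (λ x → ∑ ys (f x)) ≡ ∑ ys (λ y → ∑ xs λ x → f x y)
∑-swap []       ys f = sym (∑-zero ys)
∑-swap (x ∷ xs) ys f = trans (cong (∑ ys (f x) +_) (∑-swap xs ys f)) (sym (∑-+ ys (f x) _))

∑-++ : ∀ (xs ys : List A) (f : A → ℚ) → ∑ (xs ++ ys) f ≡ ∑ xs f + ∑ ys f
∑-++ []       ys f = sym (ℚ.+-identityˡ _)
∑-++ (x ∷ xs) ys f = trans (cong (f x +_) (∑-++ xs ys f)) (sym (ℚ.+-assoc (f x) _ _))

∑-map : ∀ (g : A → B) (xs : List A) (f : B → ℚ) → ∑ (map g xs) f ≡ ∑ xs (f ∘ g)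
∑-map g []       f = refl
∑-map g (x ∷ xs) f = cong (f (g x) +_) (∑-map g xs f)

∑-allFin : ∀ n (f : Fin (suc n) → ℚ) → ∑ (allFin (suc n)) f ≡ f zero + ∑ (allFin n) (f ∘ suc)
∑-allFin n f = cong (f zero +_)
  (trans (cong (λ xs → ∑ xs f) (sym (map-tabulate (λ i → i) suc))) (∑-map suc (allFin n) f))

∑-one : ∀ n → ∑ (allFin n) (λ _ → 1ℚ) ≡ fromℕ n
∑-one zero    = refl
∑-one (suc n) = trans (∑-allFin n λ _ → 1ℚ) (trans (cong (1ℚ +_) (∑-one n)) (sym (fromℕ-+ 1 n)))

-- -- Indicators and repetition-free lists

𝟙 : Dec Φ → ℚ
𝟙 p? = if does p? then 1ℚ else 0ℚ

𝟙-true : (p? : Dec Φ) → Φ → 𝟙 p? ≡ 1ℚ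
𝟙-true (yes _) p = refl
𝟙-true (no ¬p) p = contradiction p ¬p

𝟙-false : (p? : Dec Φ) → ¬ Φ → 𝟙 p? ≡ 0ℚ
𝟙-false (yes p) ¬p = contradiction p ¬p
𝟙-false (no _)  ¬p = refl

𝟙-cong : (p? : Dec Φ) (q? : Dec Ψ) → (Φ → Ψ) → (Ψ → Φ) → 𝟙 p? ≡ 𝟙 q?
𝟙-cong (yes p) q? to from = sym (𝟙-true q? (to p))
𝟙-cong (no ¬p) q? to from = sym (𝟙-false q? (¬p ∘ from))

𝟙-× : (p? : Dec Φ) (q? : Dec Ψ) → 𝟙 (p? ×-dec q?) ≡ 𝟙 p? * 𝟙 q?
𝟙-× (yes _) (yes _) = refl
𝟙-× (yes _) (no _)  = refl
𝟙-× (no _)  (yes _) = refl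
𝟙-× (no _)  (no _)  = refl

𝟙-¬ : (p? : Dec Φ) → 𝟙 (¬? p?) ≡ 1ℚ - 𝟙 p?
𝟙-¬ (yes _) = refl
𝟙-¬ (no _)  = refl

-- Replaces summation over a restricted range: all sums run over a full list with indicator factors,
-- and behind such a factor its proposition may be assumed.
𝟙-*-cong : (p? : Dec Φ) {x y : ℚ} → (Φ → x ≡ y) → 𝟙 p? * x ≡ 𝟙 p? * y
𝟙-*-cong (yes p)        eq = cong (1ℚ *_) (eq p)
𝟙-*-cong (no _) {x} {y} eq = trans (ℚ.*-zeroˡ x) (sym (ℚ.*-zeroˡ y))

-- Completeness and absence of repetitions are encoded together, as a sum of indicators equal to 1.
-- This is the form in which sums consume them, and it lets a bijection be handled as an exchange of
-- two summations.
record Listing {A : Set ℓ₁} (xs : List A) : Set ℓ₁ where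
  field
    _≟_  : DecidableEquality A
    once : ∀ x₀ → ∑ xs (λ x → 𝟙 (x ≟ x₀)) ≡ 1ℚ

  ∑-single : ∀ {Φ : A → Set ℓ₂} (Φ? : ∀ x → Dec (Φ x)) x₀ → Φ x₀ → (∀ x → Φ x → x ≡ x₀) →
             ∀ f → ∑ xs (λ x → 𝟙 (Φ? x) * f x) ≡ f x₀
  ∑-single Φ? x₀ Φx₀ unique f = begin
    ∑ xs (λ x → 𝟙 (Φ? x) * f x)       ≡⟨ ∑-cong xs (λ x → cong (_* f x) (𝟙-cong (Φ? x) (x ≟ x₀) (unique x) λ { refl → Φx₀ })) ⟩
    ∑ xs (λ x → 𝟙 (x ≟ x₀) * f x)     ≡⟨ ∑-cong xs (λ x → 𝟙-*-cong (x ≟ x₀) (cong f)) ⟩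
    ∑ xs (λ x → 𝟙 (x ≟ x₀) * f x₀)    ≡⟨ ∑-*ʳ xs (f x₀) _ ⟩
    ∑ xs (λ x → 𝟙 (x ≟ x₀)) * f x₀    ≡⟨ cong (_* f x₀) (once x₀) ⟩
    1ℚ * f x₀                         ≡⟨ ℚ.*-identityˡ (f x₀) ⟩
    f x₀                              ∎
    where open ≡-Reasoning

  ∑-unique : ∀ {Φ : A → Set ℓ₂} (Φ? : ∀ x → Dec (Φ x)) x₀ → Φ x₀ → (∀ x → Φ x → x ≡ x₀) →
             ∑ xs (λ x → 𝟙 (Φ? x)) ≡ 1ℚ
  ∑-unique Φ? x₀ Φx₀ unique =
    trans (∑-cong xs λ x → sym (ℚ.*-identityʳ (𝟙 (Φ? x)))) (∑-single Φ? x₀ Φx₀ unique λ _ → 1ℚ)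

open Listing using (∑-single; ∑-unique)

allFin-listing : ∀ n → Listing (allFin n)
allFin-listing n = record { _≟_ = Fin._≟_ ; once = once n }
  where
  once : ∀ n (x₀ : Fin n) → ∑ (allFin n) (λ x → 𝟙 (x Fin.≟ x₀)) ≡ 1ℚ
  once (suc n) zero     = trans (∑-allFin n λ x → 𝟙 (x Fin.≟ zero)) (trans (cong (1ℚ +_) (∑-zero (allFin n))) (ℚ.+-identityʳ 1ℚ))
  once (suc n) (suc x₀) = trans (∑-allFin n λ x → 𝟙 (x Fin.≟ suc x₀)) (trans (ℚ.+-identityˡ _)
    (trans (∑-cong (allFin n) λ x → 𝟙-cong (suc x Fin.≟ suc x₀) (x Fin.≟ x₀) Fin.suc-injective (cong suc)) (once n x₀)))

-- q-numbers and the coefficients γ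

if-true : ∀ {b} {x y : ℚ} → b ≡ true → (if b then x else y) ≡ x
if-true refl = refl

if-false : ∀ {b} {x y : ℚ} → b ≡ false → (if b then x else y) ≡ y
if-false refl = refl

[]-+ : ∀ q m n → [ m ℕ.+ n ]⟨ q ⟩ ≡ [ m ]⟨ q ⟩ ℕ.+ q ^ m ℕ.* [ n ]⟨ q ⟩
[]-+ q m zero = begin
  [ m ℕ.+ 0 ]⟨ q ⟩              ≡⟨ cong [_]⟨ q ⟩ (ℕ.+-identityʳ m) ⟩
  [ m ]⟨ q ⟩                    ≡⟨ ℕ.+-identityʳ _ ⟨
  [ m ]⟨ q ⟩ ℕ.+ 0              ≡⟨ cong ([ m ]⟨ q ⟩ ℕ.+_) (ℕ.*-zeroʳ (q ^ m)) ⟨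
  [ m ]⟨ q ⟩ ℕ.+ q ^ m ℕ.* 0    ∎
  where open ≡-Reasoning
[]-+ q m (suc n) = begin
  [ m ℕ.+ suc n ]⟨ q ⟩                                      ≡⟨ cong [_]⟨ q ⟩ (ℕ.+-suc m n) ⟩
  [ m ℕ.+ n ]⟨ q ⟩ ℕ.+ q ^ (m ℕ.+ n)                        ≡⟨ cong₂ ℕ._+_ ([]-+ q m n) (ℕ.^-distribˡ-+-* q m n) ⟩
  [ m ]⟨ q ⟩ ℕ.+ q ^ m ℕ.* [ n ]⟨ q ⟩ ℕ.+ q ^ m ℕ.* q ^ n   ≡⟨ ℕ.+-assoc [ m ]⟨ q ⟩ _ _ ⟩
  [ m ]⟨ q ⟩ ℕ.+ (q ^ m ℕ.* [ n ]⟨ q ⟩ ℕ.+ q ^ m ℕ.* q ^ n) ≡⟨ cong ([ m ]⟨ q ⟩ ℕ.+_) (ℕ.*-distribˡ-+ (q ^ m) [ n ]⟨ q ⟩ (q ^ n)) ⟨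
  [ m ]⟨ q ⟩ ℕ.+ q ^ m ℕ.* ([ n ]⟨ q ⟩ ℕ.+ q ^ n)           ∎
  where open ≡-Reasoning

module QNumbers (q : ℕ) (q>0 : 1 ℕ.≤ q) where

  open ≡-Reasoning
  open +-*-Solver

  private
    instance
      q-nonZero : ℕ.NonZero q
      q-nonZero = ℕ.>-nonZero q>0

  ⟪_⟫ : ℕ → ℚ
  ⟪ m ⟫ = fromℕ [ m ]⟨ q ⟩

  pow : ℕ → ℚ
  pow m = fromℕ (q ^ m)

  pow-≢0 : ∀ m → pow m ≢ 0ℚ
  pow-≢0 m = fromℕ-≢0 (ℕ.m^n>0 q m)

  pow-+ : ∀ m n → pow (m ℕ.+ n) ≡ pow m * pow n
  pow-+ m n = trans (cong fromℕ (ℕ.^-distribˡ-+-* q m n)) (fromℕ-* (q ^ m) (q ^ n))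

  ⟪⟫-+ : ∀ m n → ⟪ m ℕ.+ n ⟫ ≡ ⟪ m ⟫ + pow m * ⟪ n ⟫
  ⟪⟫-+ m n = begin
    fromℕ [ m ℕ.+ n ]⟨ q ⟩                        ≡⟨ cong fromℕ ([]-+ q m n) ⟩
    fromℕ ([ m ]⟨ q ⟩ ℕ.+ q ^ m ℕ.* [ n ]⟨ q ⟩)   ≡⟨ fromℕ-+ [ m ]⟨ q ⟩ _ ⟩
    ⟪ m ⟫ + fromℕ (q ^ m ℕ.* [ n ]⟨ q ⟩)          ≡⟨ cong (⟪ m ⟫ +_) (fromℕ-* (q ^ m) [ n ]⟨ q ⟩) ⟩
    ⟪ m ⟫ + pow m * ⟪ n ⟫                         ∎

  []-strict : ∀ {m n} → m ℕ.< n → [ m ]⟨ q ⟩ ℕ.< [ n ]⟨ q ⟩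
  []-strict {m} {suc n} (ℕ.s≤s m≤n) with ℕ.m≤n⇒m<n∨m≡n m≤n
  ... | inj₁ m<n  = ℕ.<-≤-trans ([]-strict m<n) (ℕ.m≤m+n [ n ]⟨ q ⟩ (q ^ n))
  ... | inj₂ refl = ℕ.m<m+n [ m ]⟨ q ⟩ (ℕ.m^n>0 q m)

  ⟪⟫-≢0 : ∀ {m} → 1 ℕ.≤ m → ⟪ m ⟫ ≢ 0ℚ
  ⟪⟫-≢0 1≤m = fromℕ-≢0 ([]-strict 1≤m)

  gaussian-≢0 : ∀ {m} j → j ℕ.≤ m → gaussian q m j ≢ 0ℚ
  gaussian-≢0         zero    _   ()
  gaussian-≢0 {suc m} (suc j) (ℕ.s≤s j≤m) =
    *-≢0 (gaussian-≢0 j (ℕ.m≤n⇒m≤1+n j≤m))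
         (*-≢0 (⟪⟫-≢0 (ℕ.m<n⇒0<n∸m (ℕ.s≤s j≤m))) (inv-≢0 (⟪⟫-≢0 {suc j} (ℕ.s≤s ℕ.z≤n))))

  ⟪⟫-difference : ∀ {l} m n → l ≡ m ℕ.+ n → ⟪ l ⟫ - ⟪ m ⟫ ≡ pow m * ⟪ n ⟫
  ⟪⟫-difference m n refl = trans (cong (_- ⟪ m ⟫) (⟪⟫-+ m n))
    (solve 2 (λ x y → x :+ y :- x := y) refl ⟪ m ⟫ (pow m * ⟪ n ⟫))

  -- The q-analogue of (u + w)(w + v) = uv + w(u + v + w). The solver knows nothing about powers of
  -- q, so the defect is isolated as a multiple of the difference of the two expansions of
  -- `⟪ u + w ⟫`, with u or with w split off first.
  ⟪⟫-cross : ∀ u v w → ⟪ u ℕ.+ w ⟫ * ⟪ w ℕ.+ v ⟫ ≡ pow w * (⟪ u ⟫ * ⟪ v ⟫) + ⟪ w ⟫ * ⟪ u ℕ.+ v ℕ.+ w ⟫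
  ⟪⟫-cross u v w = begin
    ⟪ u ℕ.+ w ⟫ * ⟪ w ℕ.+ v ⟫
      ≡⟨ cong₂ _*_ u+w (⟪⟫-+ w v) ⟩
    (Z + pw * X) * (Z + pw * Y)
      ≡⟨ solve 5 (λ X Y Z x y → (Z :+ x :* X) :* (Z :+ x :* Y) :=
           x :* (X :* Y) :+ Z :* (Z :+ x :* (X :+ y :* Y)) :+ x :* Y :* ((Z :+ x :* X) :- (X :+ y :* Z))) refl X Y Z pw pu ⟩
    pw * (X * Y) + Z * (Z + pw * (X + pu * Y)) + pw * Y * ((Z + pw * X) - (X + pu * Z))
      ≡⟨ cong₂ (λ s t → pw * (X * Y) + Z * s + pw * Y * t) (sym u+v+w) vanish ⟩
    pw * (X * Y) + Z * ⟪ u ℕ.+ v ℕ.+ w ⟫ + pw * Y * 0ℚ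
      ≡⟨ trans (cong (_+_ (pw * (X * Y) + Z * ⟪ u ℕ.+ v ℕ.+ w ⟫)) (ℚ.*-zeroʳ (pw * Y))) (ℚ.+-identityʳ _) ⟩
    pw * (X * Y) + Z * ⟪ u ℕ.+ v ℕ.+ w ⟫ ∎
    where
    X = ⟪ u ⟫
    Y = ⟪ v ⟫
    Z = ⟪ w ⟫
    pu = pow u
    pw = pow w
    u+w : ⟪ u ℕ.+ w ⟫ ≡ Z + pw * X
    u+w = trans (cong ⟪_⟫ (ℕ.+-comm u w)) (⟪⟫-+ w u)
    u+v+w : ⟪ u ℕ.+ v ℕ.+ w ⟫ ≡ Z + pw * (X + pu * Y)
    u+v+w = trans (cong ⟪_⟫ (ℕ.+-comm (u ℕ.+ v) w)) (trans (⟪⟫-+ w (u ℕ.+ v)) (cong (λ s → Z + pw * s) (⟪⟫-+ u v)))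
    vanish : (Z + pw * X) - (X + pu * Z) ≡ 0ℚ
    vanish = trans (cong₂ _-_ (sym u+w) (sym (⟪⟫-+ u w))) (ℚ.+-inverseʳ ⟪ u ℕ.+ w ⟫)

  γ-full : ∀ k z → γ q k k z ≡ δ z k
  γ-full k z = if-true (dec-true (k ℕ.≟ k) refl)

  γ-below : ∀ {k i} z → i ℕ.< k → γ q k i z ≡
    sign (i ∸ z) * inv (pow ((k ∸ i) ℕ.* (i ∸ z) ℕ.+ (i ∸ z) C 2))
      * (⟪ k ∸ i ⟫ * inv ⟪ k ∸ z ⟫) * inv (gaussian q k z)
  γ-below {k} {i} z i<k = if-false (dec-false (i ℕ.≟ k) (ℕ.<⇒≢ i<k))

  γ-top : ∀ {k i} → i ℕ.< k → γ q k i i ≡ inv (gaussian q k i)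
  γ-top {k} {i} i<k = begin
    γ q k i i
      ≡⟨ γ-below i i<k ⟩
    sign (i ∸ i) * inv (pow ((k ∸ i) ℕ.* (i ∸ i) ℕ.+ (i ∸ i) C 2)) * (⟪ k ∸ i ⟫ * inv ⟪ k ∸ i ⟫) * inv (gaussian q k i)
      ≡⟨ cong₂ (λ s t → sign s * inv (pow ((k ∸ i) ℕ.* s ℕ.+ s C 2)) * t * inv (gaussian q k i))
           (ℕ.n∸n≡0 i) (inv-inverse (⟪⟫-≢0 (ℕ.m<n⇒0<n∸m i<k))) ⟩
    1ℚ * inv (pow ((k ∸ i) ℕ.* 0 ℕ.+ 0)) * 1ℚ * inv (gaussian q k i)
      ≡⟨ cong (λ s → 1ℚ * inv (pow (s ℕ.+ 0)) * 1ℚ * inv (gaussian q k i)) (ℕ.*-zeroʳ (k ∸ i)) ⟩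
    1ℚ * inv (gaussian q k i)
      ≡⟨ ℚ.*-identityˡ _ ⟩
    inv (gaussian q k i) ∎

  private
    exponent-suc : ∀ r s → r ℕ.* suc s ℕ.+ suc s C 2 ≡ (r ℕ.* s ℕ.+ s C 2) ℕ.+ (r ℕ.+ s)
    exponent-suc r s = begin
      r ℕ.* suc s ℕ.+ suc s C 2               ≡⟨ cong₂ ℕ._+_ (ℕ.*-suc r s) (sym (trans (cong (ℕ._+ s C 2) (sym (nC1≡n s))) (nCk+nC[k+1]≡[n+1]C[k+1] s 1))) ⟩
      (r ℕ.+ r ℕ.* s) ℕ.+ (s ℕ.+ s C 2)       ≡⟨ ℕ-Solver.solve 4 (λ r t s c → (r ℕ-Solver.:+ t) ℕ-Solver.:+ (s ℕ-Solver.:+ c) ℕ-Solver.:= (t ℕ-Solver.:+ c) ℕ-Solver.:+ (r ℕ-Solver.:+ s)) refl r (r ℕ.* s) s (s C 2) ⟩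
      (r ℕ.* s ℕ.+ s C 2) ℕ.+ (r ℕ.+ s)       ∎

  -- From z to z + 1 the sign flips, the power of q in the denominator loses the exponent k - z - 1,
  -- and the Gaussian coefficient gains [k - z]/[z + 1], whose numerator cancels against the
  -- denominator [k - z] of γ(z). This recursion is all that the telescoping uses about the values
  -- of γ for i < k.
  γ-step : ∀ {k i} z → z ℕ.< i → i ℕ.< k →
           γ q k i (suc z) * ⟪ k ∸ suc z ⟫ ≡ - (pow (k ∸ suc z) * ⟪ suc z ⟫ * γ q k i z)
  γ-step {k} {i} z z<i i<k = begin
    γ q k i (suc z) * ⟪ r ⟫
      ≡⟨ cong (_* ⟪ r ⟫) (γ-below (suc z) i<k) ⟩
    X * P * (D * inv ⟪ r ⟫) * inv (G * (Bz * inv Z)) * ⟪ r ⟫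
      ≡⟨ cong (λ t → X * P * (D * inv ⟪ r ⟫) * t * ⟪ r ⟫)
           (trans (inv-* G≢0 (*-≢0 Bz≢0 (inv-≢0 Z≢0))) (cong (inv G *_)
             (trans (inv-* Bz≢0 (inv-≢0 Z≢0)) (cong (inv Bz *_) (sym (inv-unique (inv-≢0 Z≢0) (trans (ℚ.*-comm (inv Z) Z) (inv-inverse Z≢0)))))))) ⟩
    X * P * (D * inv ⟪ r ⟫) * (inv G * (inv Bz * Z)) * ⟪ r ⟫
      ≡⟨ solve 8 (λ X P D R′ G′ B′ Z R → X :* P :* (D :* R′) :* (G′ :* (B′ :* Z)) :* R := X :* P :* D :* G′ :* B′ :* Z :* (R :* R′)) refl X P D (inv ⟪ r ⟫) (inv G) (inv Bz) Z ⟪ r ⟫ ⟩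
    X * P * D * inv G * inv Bz * Z * (⟪ r ⟫ * inv ⟪ r ⟫)
      ≡⟨ cong (X * P * D * inv G * inv Bz * Z *_) (trans (inv-inverse (⟪⟫-≢0 r>0)) (sym (inv-inverse (pow-≢0 r)))) ⟩
    X * P * D * inv G * inv Bz * Z * (pow r * inv (pow r))
      ≡⟨ solve 8 (λ X P D G′ B′ Z Q Q′ → X :* P :* D :* G′ :* B′ :* Z :* (Q :* Q′) := :- (Q :* Z :* ((:- X) :* (P :* Q′) :* (D :* B′) :* G′))) refl X P D (inv G) (inv Bz) Z (pow r) (inv (pow r)) ⟩
    - (pow r * Z * (- X * (P * inv (pow r)) * (D * inv Bz) * inv G))
      ≡⟨ cong (λ t → - (pow r * Z * (- X * t * (D * inv Bz) * inv G))) (sym (trans (cong inv (trans (cong pow exponent) (pow-+ e r))) (inv-* (pow-≢0 e) (pow-≢0 r)))) ⟩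
    - (pow r * Z * (- X * inv (pow ((k ∸ i) ℕ.* suc s ℕ.+ suc s C 2)) * (D * inv Bz) * inv G))
      ≡⟨ cong (λ t → - (pow r * Z * t)) (sym (trans (γ-below z i<k) (cong (λ t → sign t * inv (pow ((k ∸ i) ℕ.* t ℕ.+ t C 2)) * (D * inv Bz) * inv G) i∸z))) ⟩
    - (pow r * Z * γ q k i z) ∎
    where
    r = k ∸ suc z
    s = i ∸ suc z
    X = sign s
    e = (k ∸ i) ℕ.* s ℕ.+ s C 2
    P = inv (pow e)
    D = ⟪ k ∸ i ⟫
    G = gaussian q k z
    Bz = ⟪ k ∸ z ⟫
    Z = ⟪ suc z ⟫
    z<k : z ℕ.< k
    z<k = ℕ.<-trans z<i i<k
    r>0 : 1 ℕ.≤ r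
    r>0 = ℕ.m<n⇒0<n∸m (ℕ.≤-<-trans z<i i<k)
    G≢0 : G ≢ 0ℚ
    G≢0 = gaussian-≢0 z (ℕ.<⇒≤ z<k)
    Bz≢0 : Bz ≢ 0ℚ
    Bz≢0 = ⟪⟫-≢0 (ℕ.m<n⇒0<n∸m z<k)
    Z≢0 : Z ≢ 0ℚ
    Z≢0 = ⟪⟫-≢0 {suc z} (ℕ.s≤s ℕ.z≤n)
    i∸z : i ∸ z ≡ suc s
    i∸z = ℕ.+-∸-assoc 1 z<i
    r≡ : k ∸ i ℕ.+ s ≡ r
    r≡ = trans (sym (ℕ.+-∸-assoc (k ∸ i) z<i)) (cong (_∸ suc z) (ℕ.m∸n+n≡m (ℕ.<⇒≤ i<k)))
    exponent : (k ∸ i) ℕ.* suc s ℕ.+ suc s C 2 ≡ e ℕ.+ r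
    exponent = trans (exponent-suc (k ∸ i) s) (cong (e ℕ.+_) r≡)

  private
    ∸-from : ∀ {m x} y → m ≡ x ℕ.+ y → m ∸ y ≡ x
    ∸-from {x = x} y refl = ℕ.m+n∸n≡m x y

  -- The coefficients making the alternating sum over a Grassmannian telescope.
  potential : (k b i z : ℕ) → ℚ
  potential k b i z = pow (k ∸ b ℕ.+ z ∸ i) * γ q k i z

  -- With u = i - z, v = b - z and w = k - b + z - i, the recursion turns the subtracted product
  -- into -[w][k - z]γ(z). What remains is q^w [u][v] + [w][u + v + w], which `⟪⟫-cross` factors as
  -- [u + w][w + v] = [k - b][k - i].
  γ-telescope : ∀ {k b h z} → let i = suc h ; c = k ∸ b in
    i ℕ.< k → b ℕ.≤ k → z ℕ.≤ i → z ℕ.≤ b → i ℕ.≤ c ℕ.+ z → c ℕ.≤ i →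
    potential k b i z * ⟪ b ∸ z ⟫ * ⟪ i ∸ z ⟫
      - potential k b i (pred z) * (⟪ k ∸ h ⟫ - ⟪ b ∸ pred z ⟫) * (⟪ i ⟫ - ⟪ i ∸ z ⟫)
    ≡ ⟪ c ⟫ * ⟪ k ∸ i ⟫ * γ q k i z
  γ-telescope {k} {b} {h} {z} i<k b≤k z≤i z≤b i≤c+z c≤i = begin
    pow w * Γ * ⟪ v ⟫ * ⟪ u ⟫ - potential k b i (pred z) * (⟪ k ∸ h ⟫ - ⟪ b ∸ pred z ⟫) * (⟪ i ⟫ - ⟪ u ⟫)
      ≡⟨ cong (_-_ (pow w * Γ * ⟪ v ⟫ * ⟪ u ⟫)) (downward z refl) ⟩
    pow w * Γ * ⟪ v ⟫ * ⟪ u ⟫ - - (⟪ w ⟫ * (Γ * ⟪ k ∸ z ⟫))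
      ≡⟨ solve 6 (λ p g v u w r → p :* g :* v :* u :- :- (w :* (g :* r)) := (p :* (u :* v) :+ w :* r) :* g) refl (pow w) Γ ⟪ v ⟫ ⟪ u ⟫ ⟪ w ⟫ ⟪ k ∸ z ⟫ ⟩
    (pow w * (⟪ u ⟫ * ⟪ v ⟫) + ⟪ w ⟫ * ⟪ k ∸ z ⟫) * Γ
      ≡⟨ cong (λ t → (pow w * (⟪ u ⟫ * ⟪ v ⟫) + ⟪ w ⟫ * ⟪ t ⟫) * Γ) (∸-from z k≡) ⟩
    (pow w * (⟪ u ⟫ * ⟪ v ⟫) + ⟪ w ⟫ * ⟪ u ℕ.+ v ℕ.+ w ⟫) * Γ
      ≡⟨ cong (_* Γ) (⟪⟫-cross u v w) ⟨
    ⟪ u ℕ.+ w ⟫ * ⟪ w ℕ.+ v ⟫ * Γ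
      ≡⟨ cong₂ (λ s t → ⟪ s ⟫ * ⟪ t ⟫ * Γ) c≡ (∸-from i (trans k≡ (trans rearrange (cong (w ℕ.+ v ℕ.+_) (sym i≡))))) ⟨
    ⟪ c ⟫ * ⟪ k ∸ i ⟫ * Γ ∎
    where
    module S = ℕ-Solver
    i = suc h
    c = k ∸ b
    u = i ∸ z
    v = b ∸ z
    w = c ℕ.+ z ∸ i
    Γ = γ q k i z
    i≡ : i ≡ u ℕ.+ z
    i≡ = sym (ℕ.m∸n+n≡m z≤i)
    b≡ : b ≡ v ℕ.+ z
    b≡ = sym (ℕ.m∸n+n≡m z≤b)
    c≡ : c ≡ u ℕ.+ w
    c≡ = ℕ.+-cancelʳ-≡ z c (u ℕ.+ w) (begin
      c ℕ.+ z           ≡⟨ ℕ.m∸n+n≡m i≤c+z ⟨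
      w ℕ.+ i           ≡⟨ cong (w ℕ.+_) i≡ ⟩
      w ℕ.+ (u ℕ.+ z)   ≡⟨ S.solve 3 (λ w u z → w S.:+ (u S.:+ z) S.:= u S.:+ w S.:+ z) refl w u z ⟩
      u ℕ.+ w ℕ.+ z     ∎)
    k≡ : k ≡ u ℕ.+ v ℕ.+ w ℕ.+ z
    k≡ = begin
      k                           ≡⟨ ℕ.m∸n+n≡m b≤k ⟨
      c ℕ.+ b                     ≡⟨ cong₂ ℕ._+_ c≡ b≡ ⟩
      u ℕ.+ w ℕ.+ (v ℕ.+ z)       ≡⟨ S.solve 4 (λ u v w z → u S.:+ w S.:+ (v S.:+ z) S.:= u S.:+ v S.:+ w S.:+ z) refl u v w z ⟩
      u ℕ.+ v ℕ.+ w ℕ.+ z         ∎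
    rearrange : u ℕ.+ v ℕ.+ w ℕ.+ z ≡ w ℕ.+ v ℕ.+ (u ℕ.+ z)
    rearrange = S.solve 4 (λ u v w z → u S.:+ v S.:+ w S.:+ z S.:= w S.:+ v S.:+ (u S.:+ z)) refl u v w z
    downward : ∀ y → z ≡ y →
      potential k b i (pred z) * (⟪ k ∸ h ⟫ - ⟪ b ∸ pred z ⟫) * (⟪ i ⟫ - ⟪ u ⟫) ≡ - (⟪ w ⟫ * (Γ * ⟪ k ∸ z ⟫))
    -- `pred 0` gives a meaningless potential, but its factor [i] - [i - 0] is 0; on the other side
    -- w = 0, because c ≤ i.
    downward zero refl = begin
      X * (⟪ i ⟫ - ⟪ i ⟫)               ≡⟨ cong (X *_) (ℚ.+-inverseʳ ⟪ i ⟫) ⟩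
      X * 0ℚ                            ≡⟨ ℚ.*-zeroʳ X ⟩
      0ℚ                                ≡⟨ cong -_ (ℚ.*-zeroˡ (Γ * ⟪ k ∸ 0 ⟫)) ⟨
      - (⟪ 0 ⟫ * (Γ * ⟪ k ∸ 0 ⟫))       ≡⟨ cong (λ t → - (⟪ t ⟫ * (Γ * ⟪ k ∸ 0 ⟫))) (ℕ.m≤n⇒m∸n≡0 (subst (ℕ._≤ i) (sym (ℕ.+-identityʳ c)) c≤i)) ⟨
      - (⟪ w ⟫ * (Γ * ⟪ k ∸ 0 ⟫))       ∎
      where X = potential k b i 0 * (⟪ k ∸ h ⟫ - ⟪ b ∸ 0 ⟫)
    downward (suc z′) refl = begin
      potential k b i z′ * (⟪ k ∸ h ⟫ - ⟪ b ∸ z′ ⟫) * (⟪ i ⟫ - ⟪ u ⟫)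
        ≡⟨ cong₂ (λ s t → potential k b i z′ * s * t) difference (⟪⟫-difference u z i≡) ⟩
      potential k b i z′ * (pow (suc v) * ⟪ w ⟫) * (pow u * ⟪ z ⟫)
        ≡⟨ solve 6 (λ p g x w y z → p :* g :* (x :* w) :* (y :* z) := (p :* w) :* (x :* y) :* (z :* g)) refl (pow (c ℕ.+ z′ ∸ i)) (γ q k i z′) (pow (suc v)) ⟪ w ⟫ (pow u) ⟪ z ⟫ ⟩
      (pow (c ℕ.+ z′ ∸ i) * ⟪ w ⟫) * (pow (suc v) * pow u) * (⟪ z ⟫ * γ q k i z′)
        ≡⟨ cong (_* (⟪ z ⟫ * γ q k i z′)) (absorb w refl) ⟩
      ⟪ w ⟫ * pow (k ∸ z) * (⟪ z ⟫ * γ q k i z′)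
        ≡⟨ solve 4 (λ w p z g → w :* p :* (z :* g) := :- (w :* (:- (p :* z :* g)))) refl ⟪ w ⟫ (pow (k ∸ z)) ⟪ z ⟫ (γ q k i z′) ⟩
      - (⟪ w ⟫ * - (pow (k ∸ z) * ⟪ z ⟫ * γ q k i z′))
        ≡⟨ cong (λ t → - (⟪ w ⟫ * t)) (γ-step z′ z≤i i<k) ⟨
      - (⟪ w ⟫ * (Γ * ⟪ k ∸ z ⟫)) ∎
      where
      b∸z′ : b ∸ z′ ≡ suc v
      b∸z′ = ∸-from z′ (trans b≡ (ℕ.+-suc v z′))
      k∸h : k ∸ h ≡ suc v ℕ.+ w
      k∸h = ∸-from h (begin
        k                             ≡⟨ k≡ ⟩
        u ℕ.+ v ℕ.+ w ℕ.+ z           ≡⟨ rearrange ⟩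
        w ℕ.+ v ℕ.+ (u ℕ.+ z)         ≡⟨ cong (w ℕ.+ v ℕ.+_) i≡ ⟨
        w ℕ.+ v ℕ.+ suc h             ≡⟨ S.solve 3 (λ w v h → w S.:+ v S.:+ (S.con 1 S.:+ h) S.:= S.con 1 S.:+ v S.:+ w S.:+ h) refl w v h ⟩
        suc v ℕ.+ w ℕ.+ h             ∎)
      difference : ⟪ k ∸ h ⟫ - ⟪ b ∸ z′ ⟫ ≡ pow (suc v) * ⟪ w ⟫
      difference = trans (cong (λ t → ⟪ k ∸ h ⟫ - ⟪ t ⟫) b∸z′) (⟪⟫-difference (suc v) w k∸h)
      absorb : ∀ x → w ≡ x → (pow (c ℕ.+ z′ ∸ i) * ⟪ w ⟫) * (pow (suc v) * pow u) ≡ ⟪ w ⟫ * pow (k ∸ z)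
      -- The true exponent would be -1 here and the subtraction truncates it to 0. The factor
      -- `⟪ 0 ⟫` makes both sides vanish.
      absorb zero w≡0 = trans (cong (_* (pow (suc v) * pow u)) (trans (cong (λ t → pow (c ℕ.+ z′ ∸ i) * ⟪ t ⟫) w≡0) (ℚ.*-zeroʳ (pow (c ℕ.+ z′ ∸ i)))))
        (trans (ℚ.*-zeroˡ (pow (suc v) * pow u)) (sym (trans (cong (λ t → ⟪ t ⟫ * pow (k ∸ z)) w≡0) (ℚ.*-zeroˡ (pow (k ∸ z))))))
      absorb (suc w′) w≡ = begin
        (pow (c ℕ.+ z′ ∸ i) * ⟪ w ⟫) * (pow (suc v) * pow u)
          ≡⟨ cong (λ t → (pow t * ⟪ w ⟫) * (pow (suc v) * pow u)) w′≡ ⟩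
        (pow w′ * ⟪ w ⟫) * (pow (suc v) * pow u)
          ≡⟨ solve 4 (λ p w x y → p :* w :* (x :* y) := w :* (p :* (x :* y))) refl (pow w′) ⟪ w ⟫ (pow (suc v)) (pow u) ⟩
        ⟪ w ⟫ * (pow w′ * (pow (suc v) * pow u))
          ≡⟨ cong (⟪ w ⟫ *_) (trans (pow-+ w′ (suc v ℕ.+ u)) (cong (pow w′ *_) (pow-+ (suc v) u))) ⟨
        ⟪ w ⟫ * pow (w′ ℕ.+ (suc v ℕ.+ u))
          ≡⟨ cong (λ t → ⟪ w ⟫ * pow t) exponent ⟨
        ⟪ w ⟫ * pow (k ∸ z) ∎
        where
        w′≡ : c ℕ.+ z′ ∸ i ≡ w′
        w′≡ = ∸-from i (ℕ.suc-injective (trans (sym (ℕ.+-suc c z′))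
          (trans (sym (ℕ.m∸n+n≡m i≤c+z)) (cong (ℕ._+ i) w≡))))
        exponent : k ∸ z ≡ w′ ℕ.+ (suc v ℕ.+ u)
        exponent = trans (∸-from z k≡) (trans (cong (u ℕ.+ v ℕ.+_) w≡)
          (S.solve 3 (λ u v w → u S.:+ v S.:+ (S.con 1 S.:+ w) S.:= w S.:+ (S.con 1 S.:+ v S.:+ u)) refl u v w′))

-- Enumeration of the Grassmannians

infix 4 _≤?_
_≤?_ : (U W : Subspace V) → Dec (U ≤ W)
U ≤? W = carrier U ⊆? carrier W

_≟ˢ_ : ∀ {n} → DecidableEquality (Subset n)
_≟ˢ_ = Vec.≡-dec Bool._≟_

carrier-injective : ∀ {U W : Subspace V} → carrier U ≡ carrier W → U ≡ W
carrier-injective {U = _ , _} {W = _ , _} refl = refl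

subspace-injective : ∀ {k} {K L : Gr V k} → subspace K ≡ subspace L → K ≡ L
subspace-injective {K = _ , _} {L = _ , _} refl = refl

_≟ᴸ_ : DecidableEquality (Subspace V)
U ≟ᴸ W = map′ carrier-injective (cong carrier) (carrier U ≟ˢ carrier W)

_≟ᴳ_ : ∀ {k} → DecidableEquality (Gr V k)
K ≟ᴳ L = map′ subspace-injective (cong subspace) (subspace K ≟ᴸ subspace L)

rank-of : ∀ {k} (K : Gr V k) → rk (subspace K) ≡ k
rank-of {k = k} (K , r) = recompute (rk K ℕ.≟ k) r

∑-mapMaybe : ∀ (h : A → Maybe B) (xs : List A) (f : B → ℚ) →
             ∑ (mapMaybe h xs) f ≡ ∑ xs (λ x → maybe′ f 0ℚ (h x))
∑-mapMaybe h []       f = refl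
∑-mapMaybe h (x ∷ xs) f with h x
... | just y  = cong (f y +_) (∑-mapMaybe h xs f)
... | nothing = trans (∑-mapMaybe h xs f) (sym (ℚ.+-identityˡ _))

subsets-listing : ∀ n → Listing (subsets n)
subsets-listing n = record { _≟_ = _≟ˢ_ ; once = once n }
  where
  once : ∀ n (U₀ : Subset n) → ∑ (subsets n) (λ U → 𝟙 (U ≟ˢ U₀)) ≡ 1ℚ
  half : ∀ n x y (U₀ : Subset n) →
         ∑ (map (x ∷_) (subsets n)) (λ U → 𝟙 (U ≟ˢ (y ∷ U₀))) ≡ 𝟙 (x Bool.≟ y)
  half n x y U₀ = begin
    ∑ (map (x ∷_) (subsets n)) (λ U → 𝟙 (U ≟ˢ (y ∷ U₀)))
      ≡⟨ ∑-map (x ∷_) (subsets n) _ ⟩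
    ∑ (subsets n) (λ U → 𝟙 ((x ∷ U) ≟ˢ (y ∷ U₀)))
      ≡⟨ ∑-cong (subsets n) (λ U → trans
           (𝟙-cong ((x ∷ U) ≟ˢ (y ∷ U₀)) ((x Bool.≟ y) ×-dec (U ≟ˢ U₀)) Vec.∷-injective λ { (refl , refl) → refl })
           (𝟙-× (x Bool.≟ y) (U ≟ˢ U₀))) ⟩
    ∑ (subsets n) (λ U → 𝟙 (x Bool.≟ y) * 𝟙 (U ≟ˢ U₀))
      ≡⟨ ∑-*ˡ (subsets n) (𝟙 (x Bool.≟ y)) _ ⟩
    𝟙 (x Bool.≟ y) * ∑ (subsets n) (λ U → 𝟙 (U ≟ˢ U₀))
      ≡⟨ trans (cong (𝟙 (x Bool.≟ y) *_) (once n U₀)) (ℚ.*-identityʳ _) ⟩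
    𝟙 (x Bool.≟ y) ∎
    where open ≡-Reasoning
  once zero    []       = refl
  once (suc n) (y ∷ U₀) = trans (∑-++ (map (false ∷_) (subsets n)) _ _)
    (trans (cong₂ _+_ (half n false y U₀) (half n true y U₀)) (total y))
    where
    total : ∀ y → 𝟙 (false Bool.≟ y) + 𝟙 (true Bool.≟ y) ≡ 1ℚ
    total false = refl
    total true  = refl

private
  -- Gives a name to the function local to `members`.
  classifier : ∀ (V : Space ℓ₁ ℓ₂ ℓ₃ ℓ₄) k →
               Σ (Subset (size V) → Maybe (Gr V k)) λ toGr → members V k ≡ mapMaybe toGr (subsets (size V))
  classifier V k = _ , refl

-- Irrelevance of the proofs in `Gr` makes an element the same as its carrier, so its occurrences
-- are those of the carrier among all subsets. `recompute` restores the irrelevant proofs, which are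
-- decidable, where the classifier would reject the carrier.
members-listing : ∀ (V : Space ℓ₁ ℓ₂ ℓ₃ ℓ₄) k → Listing (members V k)
members-listing V k = record { _≟_ = _≟ᴳ_ ; once = once }
  where
  classify : ∀ x₀ U → maybe′ (λ x → 𝟙 (x ≟ᴳ x₀)) 0ℚ (proj₁ (classifier V k) U) ≡ 𝟙 (U ≟ˢ carrier (subspace x₀))
  classify x₀@((U₀ , S₀) , r₀) U with isSubspace? V U
  ... | no ¬S = sym (𝟙-false (U ≟ˢ U₀) λ { refl → ¬S (recompute (isSubspace? V U) S₀) })
  ... | yes S with rk {V = V} (U , S) ℕ.≟ k
  ...   | no ¬r = sym (𝟙-false (U ≟ˢ U₀) λ { refl → ¬r (rank-of x₀) })
  ...   | yes r = 𝟙-cong (((U , S) , r) ≟ᴳ x₀) (U ≟ˢ U₀) (cong (carrier ∘ subspace)) (subspace-injective ∘ carrier-injective)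
  once : ∀ x₀ → ∑ (members V k) (λ x → 𝟙 (x ≟ᴳ x₀)) ≡ 1ℚ
  once x₀ = trans (∑-mapMaybe (proj₁ (classifier V k)) (subsets (size V)) (λ x → 𝟙 (x ≟ᴳ x₀)))
    (trans (∑-cong (subsets (size V)) (classify x₀)) (Listing.once (subsets-listing (size V)) (carrier (subspace x₀))))

-- The subspace lattice through its points

-- The common interface of the two kinds of space. `constant` and `slope` are 0 and 1 for sets,
-- since [r] = r at q = 1, and 1 and q - 1 for vector spaces, since q^r = 1 + (q - 1)[r]. Only joins
-- with a single point occur, and `adjoin-modular` is the modular law for them.
record Geometry (V : Space ℓ₁ ℓ₂ ℓ₃ ℓ₄) : Set where
  field
    base>0      : 1 ℕ.≤ base V
    constant    : ℕ
    slope       : ℕ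
    slope>0     : 1 ℕ.≤ slope
    cardinality : (U : Subspace V) → ∣ carrier U ∣ ≡ constant ℕ.+ slope ℕ.* [ rk U ]⟨ base V ⟩
    bottom      : Subspace V
    bottom-rk   : rk bottom ≡ 0
    bottom-≤    : (U : Subspace V) → bottom ≤ U
    adjoin         : Subspace V → Fin (size V) → Subspace V
    adjoin-≥       : ∀ U x → U ≤ adjoin U x
    adjoin-∋       : ∀ U x → x ∈ carrier (adjoin U x)
    adjoin-least   : ∀ U x W → U ≤ W → x ∈ carrier W → adjoin U x ≤ W
    adjoin-modular : ∀ U x W {y} → x ∈ carrier W → y ∈ carrier W →
                     y ∈ carrier (adjoin U x) → y ∈ carrier (adjoin (U ∧ W) x)
    rk-adjoin      : ∀ U x → x ∉ carrier U → rk (adjoin U x) ≡ suc (rk U)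

∑-∈ : ∀ {n} (U : Subset n) → ∑ (allFin n) (λ x → 𝟙 (x ∈? U)) ≡ fromℕ ∣ U ∣
∑-∈ []          = refl
∑-∈ {suc n} (b ∷ U) = begin
  ∑ (allFin (suc n)) (λ x → 𝟙 (x ∈? (b ∷ U)))
    ≡⟨ ∑-allFin n (λ x → 𝟙 (x ∈? (b ∷ U))) ⟩
  𝟙 (zero ∈? (b ∷ U)) + ∑ (allFin n) (λ x → 𝟙 (suc x ∈? (b ∷ U)))
    ≡⟨ cong (𝟙 (zero ∈? (b ∷ U)) +_) (trans (∑-cong (allFin n) λ x → 𝟙-cong (suc x ∈? (b ∷ U)) (x ∈? U) drop-there there) (∑-∈ U)) ⟩
  𝟙 (zero ∈? (b ∷ U)) + fromℕ ∣ U ∣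
    ≡⟨ head b ⟩
  fromℕ ∣ b ∷ U ∣ ∎
  where
  open ≡-Reasoning
  head : ∀ b → 𝟙 (zero ∈? (b ∷ U)) + fromℕ ∣ U ∣ ≡ fromℕ ∣ b ∷ U ∣
  head true  = sym (fromℕ-+ 1 ∣ U ∣)
  head false = ℚ.+-identityˡ _

module Lattice {c ℓ m ℓm} {V : Space c ℓ m ℓm} (G : Geometry V) where

  open Geometry G
  open QNumbers (base V) base>0
  open ≡-Reasoning

  ≤-antisym : ∀ {U W : Subspace V} → U ≤ W → W ≤ U → U ≡ W
  ≤-antisym U≤W W≤U = carrier-injective (⊆-antisym U≤W W≤U)

  ∧-lower₁ : ∀ (U W : Subspace V) → (U ∧ W) ≤ U
  ∧-lower₁ U W = p∩q⊆p (carrier U) (carrier W)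

  ∧-lower₂ : ∀ (U W : Subspace V) → (U ∧ W) ≤ W
  ∧-lower₂ U W = p∩q⊆q (carrier U) (carrier W)

  ∧-comm : ∀ (U W : Subspace V) → U ∧ W ≡ W ∧ U
  ∧-comm U W = carrier-injective (∩-comm (carrier U) (carrier W))

  ∧-greatest : ∀ {U W X : Subspace V} → X ≤ U → X ≤ W → X ≤ (U ∧ W)
  ∧-greatest X≤U X≤W x∈X = x∈p∩q⁺ (X≤U x∈X , X≤W x∈X)

  ∧-mono : ∀ {U W} (B : Subspace V) → U ≤ W → (U ∧ B) ≤ (W ∧ B)
  ∧-mono {U} {W} B U≤W = ∧-greatest {W} {B} {U ∧ B} (U≤W ∘ ∧-lower₁ U B) (∧-lower₂ U B)

  ∧-absorb : ∀ {U W : Subspace V} → U ≤ W → U ∧ W ≡ U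
  ∧-absorb {U} {W} U≤W = ≤-antisym (∧-lower₁ U W) (∧-greatest {U} {W} {U} (λ x → x) U≤W)

  private
    []-mono : ∀ {r s} → r ℕ.≤ s → [ r ]⟨ base V ⟩ ℕ.≤ [ s ]⟨ base V ⟩
    []-mono r≤s with ℕ.m≤n⇒m<n∨m≡n r≤s
    ... | inj₁ r<s  = ℕ.<⇒≤ ([]-strict r<s)
    ... | inj₂ refl = ℕ.≤-refl

    instance
      slope-nonZero : ℕ.NonZero slope
      slope-nonZero = ℕ.>-nonZero slope>0

  -- The number of points is a strictly increasing function of the rank, so ranks compare as
  -- cardinalities do.
  rk-mono : ∀ {U W : Subspace V} → U ≤ W → rk U ℕ.≤ rk W
  rk-mono {U} {W} U≤W = ℕ.≮⇒≥ λ rkW<rkU → ℕ.<⇒≱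
    (subst₂ ℕ._<_ (sym (cardinality W)) (sym (cardinality U))
      (ℕ.+-monoʳ-< constant (ℕ.*-monoʳ-< slope ([]-strict rkW<rkU))))
    (p⊆q⇒∣p∣≤∣q∣ U≤W)

  witness : ∀ {U W : Subspace V} → ¬ (W ≤ U) → ∃ λ x → x ∈ carrier W × x ∉ carrier U
  witness {U} {W} W≰U with Fin.any? (λ x → (x ∈? carrier W) ×-dec ¬? (x ∈? carrier U))
  ... | yes w = w
  ... | no ¬w = contradiction (λ {x} x∈W → decidable-stable (x ∈? carrier U) λ x∉U → ¬w (x , x∈W , x∉U)) W≰U

  ≤-from-rk : ∀ {U W : Subspace V} → U ≤ W → rk W ℕ.≤ rk U → W ≤ U
  ≤-from-rk {U} {W} U≤W rkW≤rkU with W ≤? U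
  ... | yes W≤U = W≤U
  ... | no W≰U  = contradiction
    (subst₂ ℕ._≤_ (sym (cardinality W)) (sym (cardinality U))
      (ℕ.+-monoʳ-≤ constant (ℕ.*-monoʳ-≤ slope ([]-mono rkW≤rkU))))
    (ℕ.<⇒≱ (p⊂q⇒∣p∣<∣q∣ (U≤W , witness {U} {W} W≰U)))

  witness-rk : ∀ {U W : Subspace V} → rk U ℕ.< rk W → ∃ λ x → x ∈ carrier W × x ∉ carrier U
  witness-rk {U} {W} rkU<rkW = witness {U} {W} λ W≤U → ℕ.<⇒≱ rkU<rkW (rk-mono {W} {U} W≤U)

  -- A point x of J ∧ B outside H yields J = H ∨ x, and the modular law then puts J ∧ B inside (H ∧
  -- B) ∨ x.
  rk-∧-cover : ∀ {H J} (B : Subspace V) → H ≤ J → rk J ≡ suc (rk H) → rk (J ∧ B) ℕ.≤ suc (rk (H ∧ B))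
  rk-∧-cover {H} {J} B H≤J rkJ with (J ∧ B) ≤? H
  ... | yes J∧B≤H = ℕ.m≤n⇒m≤1+n (rk-mono {J ∧ B} {H ∧ B} (∧-greatest {H} {B} {J ∧ B} J∧B≤H (∧-lower₂ J B)))
  ... | no J∧B≰H with witness {H} {J ∧ B} J∧B≰H
  ...   | x , x∈J∧B , x∉H = subst (rk (J ∧ B) ℕ.≤_)
    (rk-adjoin (H ∧ B) x (x∉H ∘ ∧-lower₁ H B))
    (rk-mono {J ∧ B} {adjoin (H ∧ B) x} λ y∈J∧B →
      adjoin-modular H x B (∧-lower₂ J B x∈J∧B) (∧-lower₂ J B y∈J∧B)
        (≤-from-rk {adjoin H x} {J} (adjoin-least H x J H≤J (∧-lower₁ J B x∈J∧B))
          (ℕ.≤-reflexive (trans rkJ (sym (rk-adjoin H x x∉H)))) (∧-lower₁ J B y∈J∧B)))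

  -- Iterates the bound for covers along a chain from U to W. It serves as a lower bound for
  -- `rk (U ∧ B)`: passing to a subspace of corank d costs at most d in the meeting with B.
  rk-∧-chain : ∀ d {U W} (B : Subspace V) → U ≤ W → rk W ≡ d ℕ.+ rk U → rk (W ∧ B) ℕ.≤ d ℕ.+ rk (U ∧ B)
  rk-∧-chain zero {U} {W} B U≤W eq = rk-mono {W ∧ B} {U ∧ B} (∧-mono {W} {U} B (≤-from-rk {U} {W} U≤W (ℕ.≤-reflexive eq)))
  rk-∧-chain (suc d) {U} {W} B U≤W eq with witness-rk {U} {W} (subst (rk U ℕ.<_) (sym eq) (ℕ.s≤s (ℕ.m≤n+m (rk U) d)))
  ... | x , x∈W , x∉U = ℕ.≤-trans
    (rk-∧-chain d {adjoin U x} {W} B (adjoin-least U x W U≤W x∈W)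
      (trans eq (sym (trans (cong (d ℕ.+_) (rk-adjoin U x x∉U)) (ℕ.+-suc d (rk U))))))
    (subst (d ℕ.+ rk (adjoin U x ∧ B) ℕ.≤_) (ℕ.+-suc d _)
      (ℕ.+-monoʳ-≤ d (rk-∧-cover {U} {adjoin U x} B (adjoin-≥ U x) (rk-adjoin U x x∉U))))

  -- Taking a difference makes `constant` drop out, so the zero vector needs no treatment of its
  -- own.
  ∑-points : ∀ (U W : Subspace V) →
             ∑ (allFin (size V)) (λ x → 𝟙 (x ∈? carrier U) - 𝟙 (x ∈? carrier W)) ≡ fromℕ slope * (⟪ rk U ⟫ - ⟪ rk W ⟫)
  ∑-points U W = begin
    ∑ (allFin (size V)) (λ x → 𝟙 (x ∈? carrier U) - 𝟙 (x ∈? carrier W))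
      ≡⟨ ∑-- (allFin (size V)) (λ x → 𝟙 (x ∈? carrier U)) (λ x → 𝟙 (x ∈? carrier W)) ⟩
    ∑ (allFin (size V)) (λ x → 𝟙 (x ∈? carrier U)) - ∑ (allFin (size V)) (λ x → 𝟙 (x ∈? carrier W))
      ≡⟨ cong₂ _-_ (points U) (points W) ⟩
    (fromℕ constant + fromℕ slope * ⟪ rk U ⟫) - (fromℕ constant + fromℕ slope * ⟪ rk W ⟫)
      ≡⟨ solve 4 (λ c s u w → (c :+ s :* u) :- (c :+ s :* w) := s :* (u :- w)) refl (fromℕ constant) (fromℕ slope) ⟪ rk U ⟫ ⟪ rk W ⟫ ⟩
    fromℕ slope * (⟪ rk U ⟫ - ⟪ rk W ⟫) ∎
    where
    open +-*-Solver
    points : ∀ U → ∑ (allFin (size V)) (λ x → 𝟙 (x ∈? carrier U)) ≡ fromℕ constant + fromℕ slope * ⟪ rk U ⟫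
    points U = trans (∑-∈ (carrier U)) (trans (cong fromℕ (cardinality U))
      (trans (fromℕ-+ constant _) (cong (fromℕ constant +_) (fromℕ-* slope _))))

  -- Double counting the points of B outside H: each lies in exactly one cover of H.
  covers-meeting : ∀ {H M B h} → rk H ≡ h → H ≤ M → B ≤ M →
    ∑ (members V (suc h)) (λ X → 𝟙 (H ≤? subspace X) * 𝟙 (subspace X ≤? M) * 𝟙 (rk (subspace X ∧ B) ℕ.≟ suc (rk (H ∧ B))))
    ≡ ⟪ rk B ∸ rk (H ∧ B) ⟫
  covers-meeting {H} {M} {B} {h} rkH H≤M B≤M = *-cancelˡ K (*-≢0 (fromℕ-≢0 slope>0) (pow-≢0 z)) (begin
    K * ∑ Xs (λ X → between X * 𝟙 (rk (subspace X ∧ B) ℕ.≟ suc z))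
      ≡⟨ ∑-*ˡ Xs K _ ⟨
    ∑ Xs (λ X → K * (between X * 𝟙 (rk (subspace X ∧ B) ℕ.≟ suc z)))
      ≡⟨ ∑-cong Xs new-points ⟨
    ∑ Xs (λ X → ∑ xs (λ x → between X * new X x))
      ≡⟨ ∑-swap Xs xs _ ⟩
    ∑ xs (λ x → ∑ Xs (λ X → between X * new X x))
      ≡⟨ ∑-cong xs unique-cover ⟩
    ∑ xs (λ x → 𝟙 (x ∈? carrier B) - 𝟙 (x ∈? carrier (H ∧ B)))
      ≡⟨ ∑-points B (H ∧ B) ⟩
    fromℕ slope * (⟪ rk B ⟫ - ⟪ z ⟫)
      ≡⟨ cong (fromℕ slope *_) (⟪⟫-difference z (rk B ∸ z) (sym (ℕ.m+[n∸m]≡n (rk-mono {H ∧ B} {B} (∧-lower₂ H B))))) ⟩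
    fromℕ slope * (pow z * ⟪ rk B ∸ z ⟫)
      ≡⟨ ℚ.*-assoc (fromℕ slope) (pow z) _ ⟨
    K * ⟪ rk B ∸ z ⟫ ∎)
    where
    open +-*-Solver
    z = rk (H ∧ B)
    -- The number of points that a cover raising the rank of the meeting from z to z + 1 adds to it,
    -- as [z + 1] - [z] = q^z.
    K = fromℕ slope * pow z
    Xs = members V (suc h)
    xs = allFin (size V)
    between : Gr V (suc h) → ℚ
    between X = 𝟙 (H ≤? subspace X) * 𝟙 (subspace X ≤? M)
    new : Gr V (suc h) → Fin (size V) → ℚ
    new X x = 𝟙 (x ∈? carrier (subspace X ∧ B)) - 𝟙 (x ∈? carrier (H ∧ B))

    new-points : ∀ X → ∑ xs (λ x → between X * new X x) ≡ K * (between X * 𝟙 (rk (subspace X ∧ B) ℕ.≟ suc z))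
    new-points X = begin
      ∑ xs (λ x → between X * new X x)
        ≡⟨ ∑-*ˡ xs (between X) _ ⟩
      between X * ∑ xs (new X)
        ≡⟨ cong (between X *_) (∑-points (subspace X ∧ B) (H ∧ B)) ⟩
      𝟙 (H ≤? subspace X) * 𝟙 (subspace X ≤? M) * (fromℕ slope * (⟪ rk (subspace X ∧ B) ⟫ - ⟪ z ⟫))
        ≡⟨ solve 4 (λ a b s d → a :* b :* (s :* d) := a :* (b :* s :* d)) refl (𝟙 (H ≤? subspace X)) (𝟙 (subspace X ≤? M)) (fromℕ slope) _ ⟩
      𝟙 (H ≤? subspace X) * (𝟙 (subspace X ≤? M) * fromℕ slope * (⟪ rk (subspace X ∧ B) ⟫ - ⟪ z ⟫))
        ≡⟨ 𝟙-*-cong (H ≤? subspace X) (λ H≤X → cong (𝟙 (subspace X ≤? M) * fromℕ slope *_) (increment H≤X)) ⟩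
      𝟙 (H ≤? subspace X) * (𝟙 (subspace X ≤? M) * fromℕ slope * (pow z * 𝟙 (rk (subspace X ∧ B) ℕ.≟ suc z)))
        ≡⟨ solve 5 (λ a b s p d → a :* (b :* s :* (p :* d)) := s :* p :* (a :* b :* d)) refl (𝟙 (H ≤? subspace X)) (𝟙 (subspace X ≤? M)) (fromℕ slope) (pow z) _ ⟩
      K * (between X * 𝟙 (rk (subspace X ∧ B) ℕ.≟ suc z)) ∎
      where
      increment : H ≤ subspace X → ⟪ rk (subspace X ∧ B) ⟫ - ⟪ z ⟫ ≡ pow z * 𝟙 (rk (subspace X ∧ B) ℕ.≟ suc z)
      increment H≤X = by-rank (rk (subspace X ∧ B) ℕ.≟ suc z)
        where
        by-rank : Dec (rk (subspace X ∧ B) ≡ suc z) → ⟪ rk (subspace X ∧ B) ⟫ - ⟪ z ⟫ ≡ pow z * 𝟙 (rk (subspace X ∧ B) ℕ.≟ suc z)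
        by-rank (yes eq) = trans (cong (λ t → ⟪ t ⟫ - ⟪ z ⟫) eq) (trans (⟪⟫-difference z 1 (sym (ℕ.+-comm z 1))) (cong (pow z *_) (sym (𝟙-true (rk (subspace X ∧ B) ℕ.≟ suc z) eq))))
        by-rank (no neq) = trans (cong (λ t → ⟪ t ⟫ - ⟪ z ⟫) (ℕ.≤-antisym
            (ℕ.≤-pred (ℕ.≤∧≢⇒< (rk-∧-cover {H} {subspace X} B H≤X (trans (rank-of X) (cong suc (sym rkH)))) neq))
            (rk-mono {H ∧ B} {subspace X ∧ B} (∧-mono {H} {subspace X} B H≤X))))
          (trans (ℚ.+-inverseʳ ⟪ z ⟫) (sym (trans (cong (pow z *_) (𝟙-false (rk (subspace X ∧ B) ℕ.≟ suc z) neq)) (ℚ.*-zeroʳ (pow z)))))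

    unique-cover : ∀ x → ∑ Xs (λ X → between X * new X x) ≡ 𝟙 (x ∈? carrier B) - 𝟙 (x ∈? carrier (H ∧ B))
    unique-cover x with x ∈? carrier B | x ∈? carrier H
    ... | no x∉B | _ = trans (∑-cong Xs λ X → trans
          (cong (between X *_) (cong₂ _-_ (𝟙-false (x ∈? carrier (subspace X ∧ B)) (x∉B ∘ ∧-lower₂ (subspace X) B)) ∉H∧B))
          (ℚ.*-zeroʳ (between X)))
        (trans (∑-zero Xs) (sym (cong (_-_ 0ℚ) ∉H∧B)))
      where ∉H∧B = 𝟙-false (x ∈? carrier (H ∧ B)) (x∉B ∘ ∧-lower₂ H B)
    ... | yes x∈B | yes x∈H = trans (∑-cong Xs λ X → trans
          (ℚ.*-assoc (𝟙 (H ≤? subspace X)) (𝟙 (subspace X ≤? M)) _)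
          (trans (𝟙-*-cong (H ≤? subspace X) λ H≤X → trans (cong (𝟙 (subspace X ≤? M) *_)
              (cong₂ _-_ (𝟙-true (x ∈? carrier (subspace X ∧ B)) (x∈p∩q⁺ (H≤X x∈H , x∈B))) ∈H∧B))
            (ℚ.*-zeroʳ (𝟙 (subspace X ≤? M))))
          (ℚ.*-zeroʳ (𝟙 (H ≤? subspace X)))))
        (trans (∑-zero Xs) (sym (cong (_-_ 1ℚ) ∈H∧B)))
      where ∈H∧B = 𝟙-true (x ∈? carrier (H ∧ B)) (x∈p∩q⁺ (x∈H , x∈B))
    ... | yes x∈B | no x∉H = begin
      ∑ Xs (λ X → between X * new X x)
        ≡⟨ ∑-cong Xs (λ X → cong (between X *_) (cong (_-_ (𝟙 (x ∈? carrier (subspace X ∧ B)))) ∉H∧B)) ⟩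
      ∑ Xs (λ X → between X * (𝟙 (x ∈? carrier (subspace X ∧ B)) - 0ℚ))
        ≡⟨ ∑-cong Xs (λ X → trans
             (cong₂ _*_ (sym (𝟙-× (H ≤? subspace X) (subspace X ≤? M))) (ℚ.+-identityʳ _))
             (sym (𝟙-× ((H ≤? subspace X) ×-dec (subspace X ≤? M)) (x ∈? carrier (subspace X ∧ B))))) ⟩
      ∑ Xs (λ X → 𝟙 (((H ≤? subspace X) ×-dec (subspace X ≤? M)) ×-dec (x ∈? carrier (subspace X ∧ B))))
        ≡⟨ Listing.∑-unique (members-listing V (suc h))
             (λ X → ((H ≤? subspace X) ×-dec (subspace X ≤? M)) ×-dec (x ∈? carrier (subspace X ∧ B))) X₀
             ((adjoin-≥ H x , adjoin-least H x M H≤M (B≤M x∈B)) , x∈p∩q⁺ (adjoin-∋ H x , x∈B))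
             (λ { X ((H≤X , X≤M) , x∈X∧B) → subspace-injective (sym (H+x≡ X H≤X (∧-lower₁ (subspace X) B x∈X∧B))) }) ⟩
      1ℚ
        ≡⟨ cong (_-_ 1ℚ) ∉H∧B ⟨
      1ℚ - 𝟙 (x ∈? carrier (H ∧ B)) ∎
      where
      ∉H∧B = 𝟙-false (x ∈? carrier (H ∧ B)) (x∉H ∘ ∧-lower₁ H B)
      rkH+x : rk (adjoin H x) ≡ suc h
      rkH+x = trans (rk-adjoin H x x∉H) (cong suc rkH)
      X₀ : Gr V (suc h)
      X₀ = adjoin H x , rkH+x
      H+x≡ : ∀ X → H ≤ subspace X → x ∈ carrier (subspace X) → adjoin H x ≡ subspace X
      H+x≡ X H≤X x∈X = ≤-antisym H+x≤X (≤-from-rk {adjoin H x} {subspace X} H+x≤X (ℕ.≤-reflexive (trans (rank-of X) (sym rkH+x))))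
        where
        H+x≤X : adjoin H x ≤ subspace X
        H+x≤X = adjoin-least H x (subspace X) H≤X x∈X

  -- The case B = M of the count above, where every X ≤ M raises the rank of its meeting with M.
  covers : ∀ {H M h} → rk H ≡ h → H ≤ M →
           ∑ (members V (suc h)) (λ X → 𝟙 (H ≤? subspace X) * 𝟙 (subspace X ≤? M)) ≡ ⟪ rk M ∸ h ⟫
  covers {H} {M} {h} rkH H≤M = begin
    ∑ (members V (suc h)) (λ X → 𝟙 (H ≤? subspace X) * 𝟙 (subspace X ≤? M))
      ≡⟨ ∑-cong (members V (suc h)) (λ X → sym (trans
           (ℚ.*-assoc (𝟙 (H ≤? subspace X)) _ _)
           (cong (𝟙 (H ≤? subspace X) *_) (trans
             (𝟙-*-cong (subspace X ≤? M) λ X≤M → 𝟙-true (rk (subspace X ∧ M) ℕ.≟ suc (rk (H ∧ M)))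
               (trans (cong rk (∧-absorb {subspace X} {M} X≤M)) (trans (rank-of X) (cong suc (sym (trans (cong rk (∧-absorb {H} {M} H≤M)) rkH))))))
             (ℚ.*-identityʳ (𝟙 (subspace X ≤? M))))))) ⟩
    ∑ (members V (suc h)) (λ X → 𝟙 (H ≤? subspace X) * 𝟙 (subspace X ≤? M) * 𝟙 (rk (subspace X ∧ M) ℕ.≟ suc (rk (H ∧ M))))
      ≡⟨ covers-meeting {H} {M} {M} rkH H≤M (λ x → x) ⟩
    ⟪ rk M ∸ rk (H ∧ M) ⟫
      ≡⟨ cong (λ t → ⟪ rk M ∸ t ⟫) (trans (cong rk (∧-absorb {H} {M} H≤M)) rkH) ⟩
    ⟪ rk M ∸ h ⟫ ∎

-- Anti-automorphisms

module Duality {c ℓ m ℓm} {V : Space c ℓ m ℓm} (G : Geometry V)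
               (_^⊥ : Subspace V → Subspace V) (iso : IsAntiAutomorphism _^⊥) where

  open Geometry G
  open QNumbers (base V) base>0
  open Lattice G
  open ≡-Reasoning
  open IsOrderIsomorphism iso using (surjective; injective)

  ⊥-anti : ∀ {U W} → U ≤ W → (W ^⊥) ≤ (U ^⊥)
  ⊥-anti {U} {W} U≤W = IsOrderIsomorphism.mono iso {U} {W} U≤W

  ⊥-cancel : ∀ {U W} → (W ^⊥) ≤ (U ^⊥) → U ≤ W
  ⊥-cancel {U} {W} W⊥≤U⊥ = IsOrderIsomorphism.cancel iso {U} {W} W⊥≤U⊥

  _ᵀ : Subspace V → Subspace V
  U ᵀ = proj₁ (surjective U)

  ᵀ-⊥ : ∀ U → (U ᵀ) ^⊥ ≡ U
  ᵀ-⊥ U = proj₂ (surjective U) refl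

  ⊥-ᵀ : ∀ U → (U ^⊥) ᵀ ≡ U
  ⊥-ᵀ U = injective (ᵀ-⊥ (U ^⊥))

  rk≤rank : ∀ (U : Subspace V) → rk U ℕ.≤ rank V
  rk≤rank U = rk-mono {U} {whole V} ⊆⊤

  private
    -- Adjoining a point raises the rank by exactly 1, while the dual becomes strictly smaller and
    -- loses at least 1. The sum of both ranks can therefore only decrease along a chain.
    rk+rk⊥-anti : ∀ d {U W} → U ≤ W → rk W ≡ d ℕ.+ rk U → rk W ℕ.+ rk (W ^⊥) ℕ.≤ rk U ℕ.+ rk (U ^⊥)
    rk+rk⊥-anti zero {U} {W} U≤W eq = ℕ.≤-reflexive (cong (λ U → rk U ℕ.+ rk (U ^⊥))
      (≤-antisym {W} {U} (≤-from-rk {U} {W} U≤W (ℕ.≤-reflexive eq)) U≤W))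
    rk+rk⊥-anti (suc d) {U} {W} U≤W eq with witness-rk {U} {W} (subst (rk U ℕ.<_) (sym eq) (ℕ.s≤s (ℕ.m≤n+m (rk U) d)))
    ... | x , x∈W , x∉U = ℕ.≤-trans
      (rk+rk⊥-anti d {adjoin U x} {W} (adjoin-least U x W U≤W x∈W)
        (trans eq (sym (trans (cong (d ℕ.+_) (rk-adjoin U x x∉U)) (ℕ.+-suc d (rk U))))))
      (subst₂ ℕ._≤_ (trans (ℕ.+-suc (rk U) _) (cong (ℕ._+ rk (adjoin U x ^⊥)) (sym (rk-adjoin U x x∉U)))) refl
        (ℕ.+-monoʳ-≤ (rk U) (ℕ.≰⇒> λ rk≤ → x∉U (⊥-cancel {adjoin U x} {U}
          (≤-from-rk {adjoin U x ^⊥} {U ^⊥} (⊥-anti {U} {adjoin U x} (adjoin-≥ U x)) rk≤) (adjoin-∋ U x)))))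

    rk+rk⊥-mono : ∀ {U W} → U ≤ W → rk W ℕ.+ rk (W ^⊥) ℕ.≤ rk U ℕ.+ rk (U ^⊥)
    rk+rk⊥-mono {U} {W} U≤W = rk+rk⊥-anti (rk W ∸ rk U) {U} {W} U≤W (sym (ℕ.m∸n+n≡m (rk-mono {U} {W} U≤W)))

  -- The sum of both ranks is antitone in U, at most n at `bottom` and at least n at `whole V`,
  -- hence constantly n.
  rk-⊥ : ∀ U → rk U ℕ.+ rk (U ^⊥) ≡ rank V
  rk-⊥ U = ℕ.≤-antisym
    (ℕ.≤-trans (rk+rk⊥-mono {bottom} {U} (bottom-≤ U))
      (subst (λ r → r ℕ.+ rk (bottom ^⊥) ℕ.≤ rank V) (sym bottom-rk) (rk≤rank (bottom ^⊥))))
    (ℕ.≤-trans (ℕ.m≤m+n (rank V) (rk (whole V ^⊥))) (rk+rk⊥-mono {U} {whole V} ⊆⊤))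

  rk-ᵀ : ∀ U → rk (U ᵀ) ℕ.+ rk U ≡ rank V
  rk-ᵀ U = trans (cong (λ W → rk (U ᵀ) ℕ.+ rk W) (sym (ᵀ-⊥ U))) (rk-⊥ (U ᵀ))

  dual : ∀ {j l} → j ℕ.+ l ≡ rank V → Gr V j → Gr V l
  dual {j} {l} j+l K = (subspace K ^⊥) , ℕ.+-cancelˡ-≡ j _ l
    (trans (cong (ℕ._+ rk (subspace K ^⊥)) (sym (rank-of K))) (trans (rk-⊥ (subspace K)) (sym j+l)))

  dual⁻¹ : ∀ {j l} → j ℕ.+ l ≡ rank V → Gr V l → Gr V j
  dual⁻¹ {j} {l} j+l L = (subspace L ᵀ) , ℕ.+-cancelʳ-≡ l _ j
    (trans (cong (rk (subspace L ᵀ) ℕ.+_) (sym (rank-of L))) (trans (rk-ᵀ (subspace L)) (sym j+l)))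

  -- Change of variables along the bijection, carried out as a double sum over its graph: each K has
  -- one L, and each L has one K.
  ∑-dual : ∀ {j l} → j ℕ.+ l ≡ rank V → (g : Subspace V → ℚ) →
           ∑ (members V j) (λ K → g (subspace K)) ≡ ∑ (members V l) (λ L → g (subspace L ᵀ))
  ∑-dual {j} {l} j+l g = begin
    ∑ (members V j) (λ K → g (subspace K))
      ≡⟨ ∑-cong (members V j) (λ K → sym (Listing.∑-single (members-listing V l)
           (λ L → L ≟ᴳ dual j+l K) (dual j+l K) refl (λ _ eq → eq) (λ _ → g (subspace K)))) ⟩
    ∑ (members V j) (λ K → ∑ (members V l) (λ L → 𝟙 (L ≟ᴳ dual j+l K) * g (subspace K)))
      ≡⟨ ∑-swap (members V j) (members V l) _ ⟩
    ∑ (members V l) (λ L → ∑ (members V j) (λ K → 𝟙 (L ≟ᴳ dual j+l K) * g (subspace K)))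
      ≡⟨ ∑-cong (members V l) (λ L → Listing.∑-single (members-listing V j)
           (λ K → L ≟ᴳ dual j+l K) (dual⁻¹ j+l L) (subspace-injective (sym (ᵀ-⊥ (subspace L))))
           (λ { K refl → subspace-injective (sym (⊥-ᵀ (subspace K))) }) (λ K → g (subspace K))) ⟩
    ∑ (members V l) (λ L → g (subspace L ᵀ)) ∎

  -- Dual to `covers`: the hyperplanes of J above A correspond to the covers of J^⊥ below A^⊥.
  hyperplanes : ∀ {A J h} → rk J ≡ suc h → A ≤ J →
                ∑ (members V h) (λ H → 𝟙 (A ≤? subspace H) * 𝟙 (subspace H ≤? J)) ≡ ⟪ suc h ∸ rk A ⟫
  hyperplanes {A} {J} {h} rkJ A≤J = begin
    ∑ (members V h) (λ H → 𝟙 (A ≤? subspace H) * 𝟙 (subspace H ≤? J))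
      ≡⟨ ∑-dual h+l (λ H → 𝟙 (A ≤? H) * 𝟙 (H ≤? J)) ⟩
    ∑ (members V (suc (rk (J ^⊥)))) (λ X → 𝟙 (A ≤? (subspace X ᵀ)) * 𝟙 ((subspace X ᵀ) ≤? J))
      ≡⟨ ∑-cong (members V (suc (rk (J ^⊥)))) (λ X → trans (ℚ.*-comm (𝟙 (A ≤? (subspace X ᵀ))) _) (cong₂ _*_
           (𝟙-cong ((subspace X ᵀ) ≤? J) ((J ^⊥) ≤? subspace X)
             (λ le → subst ((J ^⊥) ≤_) (ᵀ-⊥ (subspace X)) (⊥-anti {subspace X ᵀ} {J} le))
             (λ le → ⊥-cancel {subspace X ᵀ} {J} (subst ((J ^⊥) ≤_) (sym (ᵀ-⊥ (subspace X))) le)))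
           (𝟙-cong (A ≤? (subspace X ᵀ)) (subspace X ≤? (A ^⊥))
             (λ le → subst (_≤ (A ^⊥)) (ᵀ-⊥ (subspace X)) (⊥-anti {A} {subspace X ᵀ} le))
             (λ le → ⊥-cancel {A} {subspace X ᵀ} (subst (_≤ (A ^⊥)) (sym (ᵀ-⊥ (subspace X))) le))))) ⟩
    ∑ (members V (suc (rk (J ^⊥)))) (λ X → 𝟙 ((J ^⊥) ≤? subspace X) * 𝟙 (subspace X ≤? (A ^⊥)))
      ≡⟨ covers {J ^⊥} {A ^⊥} refl (⊥-anti {A} {J} A≤J) ⟩
    ⟪ rk (A ^⊥) ∸ rk (J ^⊥) ⟫
      ≡⟨ cong ⟪_⟫ corank ⟩
    ⟪ suc h ∸ rk A ⟫ ∎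
    where
    h+l : h ℕ.+ suc (rk (J ^⊥)) ≡ rank V
    h+l = trans (ℕ.+-suc h _) (trans (cong (ℕ._+ rk (J ^⊥)) (sym rkJ)) (rk-⊥ J))
    corank : rk (A ^⊥) ∸ rk (J ^⊥) ≡ suc h ∸ rk A
    corank = begin
      rk (A ^⊥) ∸ rk (J ^⊥)                                   ≡⟨ ℕ.[m+n]∸[m+o]≡n∸o (rk A) _ _ ⟨
      (rk A ℕ.+ rk (A ^⊥)) ∸ (rk A ℕ.+ rk (J ^⊥))             ≡⟨ cong (_∸ (rk A ℕ.+ rk (J ^⊥))) (trans (rk-⊥ A) (sym (rk-⊥ J))) ⟩
      (rk J ℕ.+ rk (J ^⊥)) ∸ (rk A ℕ.+ rk (J ^⊥))             ≡⟨ cong₂ _∸_ (ℕ.+-comm (rk J) _) (ℕ.+-comm (rk A) _) ⟩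
      (rk (J ^⊥) ℕ.+ rk J) ∸ (rk (J ^⊥) ℕ.+ rk A)             ≡⟨ ℕ.[m+n]∸[m+o]≡n∸o (rk (J ^⊥)) _ _ ⟩
      rk J ∸ rk A                                             ≡⟨ cong (_∸ rk A) rkJ ⟩
      suc h ∸ rk A                                            ∎

  hyperplane-count : ∀ {h} (J : Gr V (suc h)) → ∑ (members V h) (λ H → 𝟙 (subspace H ≤? subspace J)) ≡ ⟪ suc h ⟫
  hyperplane-count {h} J = begin
    ∑ (members V h) (λ H → 𝟙 (subspace H ≤? subspace J))
      ≡⟨ ∑-cong (members V h) (λ H → trans (cong (_* 𝟙 (subspace H ≤? subspace J)) (𝟙-true (bottom ≤? subspace H) (bottom-≤ (subspace H)))) (ℚ.*-identityˡ _)) ⟨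
    ∑ (members V h) (λ H → 𝟙 (bottom ≤? subspace H) * 𝟙 (subspace H ≤? subspace J))
      ≡⟨ hyperplanes {bottom} {subspace J} (rank-of J) (bottom-≤ (subspace J)) ⟩
    ⟪ suc h ∸ rk bottom ⟫
      ≡⟨ cong (λ t → ⟪ suc h ∸ t ⟫) bottom-rk ⟩
    ⟪ suc h ⟫ ∎

  covers-of : ∀ {h} (H : Gr V h) M →
    ∑ (members V (suc h)) (λ X → 𝟙 (subspace H ≤? subspace X) * 𝟙 (subspace X ≤? M)) ≡ 𝟙 (subspace H ≤? M) * ⟪ rk M ∸ h ⟫
  covers-of {h} H M with subspace H ≤? M
  ... | yes H≤M = trans (covers {subspace H} {M} (rank-of H) H≤M) (sym (ℚ.*-identityˡ _))
  ... | no H≰M  = trans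
    (trans (∑-cong (members V (suc h)) λ X → trans
        (sym (𝟙-× (subspace H ≤? subspace X) (subspace X ≤? M)))
        (𝟙-false ((subspace H ≤? subspace X) ×-dec (subspace X ≤? M)) λ (H≤X , X≤M) → H≰M (X≤M ∘ H≤X)))
      (∑-zero (members V (suc h))))
    (sym (ℚ.*-zeroˡ ⟪ rk M ∸ h ⟫))

  -- Counting pairs H < J ≤ L of ranks h and h + 1 from both sides gives [h + 1] N(h + 1) = N(h)
  -- [k - h], where N(j) is the number of subspaces of rank j in L and k = rk L. This is the
  -- recursion that defines `gaussian`.
  grassmannian-size : ∀ i L → i ℕ.≤ rk L → ∑ (members V i) (λ J → 𝟙 (subspace J ≤? L)) ≡ gaussian (base V) (rk L) i
  grassmannian-size zero L _ = Listing.∑-unique (members-listing V 0) (λ J → subspace J ≤? L)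
    (bottom , bottom-rk) (bottom-≤ L)
    (λ J _ → subspace-injective (≤-antisym {subspace J} {bottom}
      (≤-from-rk {bottom} {subspace J} (bottom-≤ (subspace J)) (ℕ.≤-reflexive (trans (rank-of J) (sym bottom-rk))))
      (bottom-≤ (subspace J))))
  grassmannian-size (suc h) L h<k = *-cancelˡ ⟪ suc h ⟫ (⟪⟫-≢0 {suc h} (ℕ.s≤s ℕ.z≤n)) (begin
    ⟪ suc h ⟫ * ∑ Js (λ J → 𝟙 (subspace J ≤? L))
      ≡⟨ ∑-*ˡ Js ⟪ suc h ⟫ _ ⟨
    ∑ Js (λ J → ⟪ suc h ⟫ * 𝟙 (subspace J ≤? L))
      ≡⟨ ∑-cong Js (λ J → trans (cong (_* 𝟙 (subspace J ≤? L)) (sym (hyperplane-count J))) (sym (∑-*ʳ Hs (𝟙 (subspace J ≤? L)) _))) ⟩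
    ∑ Js (λ J → ∑ Hs (λ H → 𝟙 (subspace H ≤? subspace J) * 𝟙 (subspace J ≤? L)))
      ≡⟨ ∑-swap Js Hs _ ⟩
    ∑ Hs (λ H → ∑ Js (λ J → 𝟙 (subspace H ≤? subspace J) * 𝟙 (subspace J ≤? L)))
      ≡⟨ ∑-cong Hs (λ H → covers-of H L) ⟩
    ∑ Hs (λ H → 𝟙 (subspace H ≤? L) * ⟪ rk L ∸ h ⟫)
      ≡⟨ trans (∑-*ʳ Hs ⟪ rk L ∸ h ⟫ _) (cong (_* ⟪ rk L ∸ h ⟫) (grassmannian-size h L (ℕ.<⇒≤ h<k))) ⟩
    gaussian (base V) (rk L) h * ⟪ rk L ∸ h ⟫
      ≡⟨ ℚ.*-identityʳ _ ⟨
    gaussian (base V) (rk L) h * ⟪ rk L ∸ h ⟫ * 1ℚ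
      ≡⟨ cong (gaussian (base V) (rk L) h * ⟪ rk L ∸ h ⟫ *_) (inv-inverse (⟪⟫-≢0 {suc h} (ℕ.s≤s ℕ.z≤n))) ⟨
    gaussian (base V) (rk L) h * ⟪ rk L ∸ h ⟫ * (⟪ suc h ⟫ * inv ⟪ suc h ⟫)
      ≡⟨ solve 4 (λ g r s s′ → g :* r :* (s :* s′) := s :* (g :* (r :* s′))) refl (gaussian (base V) (rk L) h) ⟪ rk L ∸ h ⟫ ⟪ suc h ⟫ (inv ⟪ suc h ⟫) ⟩
    ⟪ suc h ⟫ * gaussian (base V) (rk L) (suc h) ∎)
    where
    open +-*-Solver
    Js = members V (suc h)
    Hs = members V h

-- The sums of γ over a Grassmannian

module Kernel {c ℓ m ℓm} {V : Space c ℓ m ℓm} (G : Geometry V)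
              (_^⊥ : Subspace V → Subspace V) (iso : IsAntiAutomorphism _^⊥) where

  open Geometry G
  open QNumbers (base V) base>0
  open Lattice G
  open ≡-Reasoning
  open Duality G _^⊥ iso
  open +-*-Solver

  -- Trades a condition on ranks for an inclusion, the form in which `hyperplanes` can count the H.
  meeting-indicator : ∀ {H J} (B : Subspace V) → H ≤ J → rk J ≡ suc (rk H) →
                      𝟙 (rk (J ∧ B) ℕ.≟ suc (rk (H ∧ B))) ≡ 1ℚ - 𝟙 ((J ∧ B) ≤? H)
  meeting-indicator {H} {J} B H≤J rkJ = trans
    (𝟙-cong (rk (J ∧ B) ℕ.≟ suc (rk (H ∧ B))) (¬? ((J ∧ B) ≤? H))
      (λ eq J∧B≤H → ℕ.<⇒≱ (ℕ.≤-reflexive (sym eq)) (rk-mono {J ∧ B} {H ∧ B} (∧-greatest {H} {B} {J ∧ B} J∧B≤H (∧-lower₂ J B))))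
      (λ J∧B≰H → ℕ.≤-antisym (rk-∧-cover {H} {J} B H≤J rkJ)
        (ℕ.≰⇒> λ le → J∧B≰H (∧-lower₁ H B ∘ ≤-from-rk {H ∧ B} {J ∧ B} (∧-mono {H} {J} B H≤J) le))))
    (𝟙-¬ ((J ∧ B) ≤? H))

  module Telescoping {L B : Subspace V} (B≤L : B ≤ L) (h : ℕ) (a : ℕ → ℚ) where
    private
      T = ⟪ rk L ∸ h ⟫
      Js = members V (suc h)
      Hs = members V h

    ζ : Subspace V → ℕ
    ζ X = rk (X ∧ B)

    e : Gr V (suc h) → Gr V h → ℚ
    e J H = 𝟙 (ζ (subspace J) ℕ.≟ suc (ζ (subspace H)))

    term : Gr V (suc h) → Gr V h → ℚ
    term J H = 𝟙 (subspace H ≤? subspace J) * 𝟙 (subspace J ≤? L) * (a (ζ (subspace H)) * (⟪ rk B ∸ ζ (subspace H) ⟫ - e J H * T))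

    ∑-term-J : ∀ H → ∑ Js (λ J → term J H) ≡ 0ℚ
    ∑-term-J H = by-position (subspace H ≤? L)
      where
      a₀ = a (ζ (subspace H))
      s₀ = ⟪ rk B ∸ ζ (subspace H) ⟫
      by-position : Dec (subspace H ≤ L) → ∑ Js (λ J → term J H) ≡ 0ℚ
      by-position (no H≰L) = trans (∑-cong Js λ J → trans
            (cong (_* (a (ζ (subspace H)) * (⟪ rk B ∸ ζ (subspace H) ⟫ - e J H * T))) (trans
              (sym (𝟙-× (subspace H ≤? subspace J) (subspace J ≤? L)))
              (𝟙-false ((subspace H ≤? subspace J) ×-dec (subspace J ≤? L)) λ (H≤J , J≤L) → H≰L (J≤L ∘ H≤J))))
            (ℚ.*-zeroˡ (a (ζ (subspace H)) * (⟪ rk B ∸ ζ (subspace H) ⟫ - e J H * T))))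
          (∑-zero Js)
      by-position (yes H≤L) = begin
        ∑ Js (λ J → term J H)
          ≡⟨ ∑-cong Js (λ J → solve 6 (λ x y a s e t → x :* y :* (a :* (s :- e :* t)) := x :* y :* (a :* s) :- x :* y :* e :* (a :* t)) refl
               (𝟙 (subspace H ≤? subspace J)) (𝟙 (subspace J ≤? L)) a₀ s₀ (e J H) T) ⟩
        ∑ Js (λ J → 𝟙 (subspace H ≤? subspace J) * 𝟙 (subspace J ≤? L) * (a₀ * s₀) - 𝟙 (subspace H ≤? subspace J) * 𝟙 (subspace J ≤? L) * e J H * (a₀ * T))
          ≡⟨ ∑-- Js _ _ ⟩
        ∑ Js (λ J → 𝟙 (subspace H ≤? subspace J) * 𝟙 (subspace J ≤? L) * (a₀ * s₀)) - ∑ Js (λ J → 𝟙 (subspace H ≤? subspace J) * 𝟙 (subspace J ≤? L) * e J H * (a₀ * T))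
          ≡⟨ cong₂ _-_
               (trans (∑-*ʳ Js (a₀ * s₀) _) (cong (_* (a₀ * s₀)) (covers {subspace H} {L} (rank-of H) H≤L)))
               (trans (∑-*ʳ Js (a₀ * T) _) (cong (_* (a₀ * T)) (covers-meeting {subspace H} {L} {B} (rank-of H) H≤L B≤L))) ⟩
        T * (a₀ * s₀) - s₀ * (a₀ * T)
          ≡⟨ solve 3 (λ t a s → t :* (a :* s) :- s :* (a :* t) := con 0ℚ) refl T a₀ s₀ ⟩
        0ℚ ∎

    -- The [i - z] hyperplanes H of J above J ∧ B keep ζ(H) = z and contribute P each; the others
    -- have ζ(H) = z - 1 and contribute -Q. Writing the contribution as 𝟙 d * (P + Q) - Q, affine in
    -- the indicator, reduces the sum to the count of hyperplanes above J ∧ B and the count of all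
    -- hyperplanes.
    ∑-term-H : ∀ J → let z = ζ (subspace J) in
      ∑ Hs (λ H → term J H) ≡
      𝟙 (subspace J ≤? L) * (a z * ⟪ rk B ∸ z ⟫ * ⟪ suc h ∸ z ⟫ - a (pred z) * (T - ⟪ rk B ∸ pred z ⟫) * (⟪ suc h ⟫ - ⟪ suc h ∸ z ⟫))
    ∑-term-H J = begin
      ∑ Hs (λ H → term J H)
        ≡⟨ ∑-cong Hs (λ H → trans
             (solve 3 (λ x y w → x :* y :* w := y :* (x :* w)) refl (𝟙 (subspace H ≤? subspace J)) (𝟙 (subspace J ≤? L)) _)
             (cong (𝟙 (subspace J ≤? L) *_) (separate H))) ⟩
      ∑ Hs (λ H → 𝟙 (subspace J ≤? L) * (e′ H * 𝟙 (subspace H ≤? subspace J) * (P + Q) - 𝟙 (subspace H ≤? subspace J) * Q))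
        ≡⟨ ∑-*ˡ Hs (𝟙 (subspace J ≤? L)) _ ⟩
      𝟙 (subspace J ≤? L) * ∑ Hs (λ H → e′ H * 𝟙 (subspace H ≤? subspace J) * (P + Q) - 𝟙 (subspace H ≤? subspace J) * Q)
        ≡⟨ cong (𝟙 (subspace J ≤? L) *_) (trans (∑-- Hs _ _) (cong₂ _-_
             (trans (∑-*ʳ Hs (P + Q) _) (cong (_* (P + Q)) (hyperplanes {subspace J ∧ B} {subspace J} (rank-of J) (∧-lower₁ (subspace J) B))))
             (trans (∑-*ʳ Hs Q _) (cong (_* Q) (hyperplane-count J))))) ⟩
      𝟙 (subspace J ≤? L) * (⟪ suc h ∸ z ⟫ * (P + Q) - ⟪ suc h ⟫ * Q)
        ≡⟨ cong (𝟙 (subspace J ≤? L) *_)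
             (solve 4 (λ n p q s → n :* (p :+ q) :- s :* q := p :* n :- q :* (s :- n)) refl ⟪ suc h ∸ z ⟫ P Q ⟪ suc h ⟫) ⟩
      𝟙 (subspace J ≤? L) * (P * ⟪ suc h ∸ z ⟫ - Q * (⟪ suc h ⟫ - ⟪ suc h ∸ z ⟫)) ∎
      where
      z = ζ (subspace J)
      P = a z * ⟪ rk B ∸ z ⟫
      Q = a (pred z) * (T - ⟪ rk B ∸ pred z ⟫)
      e′ : Gr V h → ℚ
      e′ H = 𝟙 ((subspace J ∧ B) ≤? subspace H)
      value : ∀ H → H ≤ subspace J → (d : Dec ((subspace J ∧ B) ≤ H)) → 𝟙 (z ℕ.≟ suc (ζ H)) ≡ 1ℚ - 𝟙 d →
              a (ζ H) * (⟪ rk B ∸ ζ H ⟫ - 𝟙 (z ℕ.≟ suc (ζ H)) * T) ≡ 𝟙 d * (P + Q) - Q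
      value H H≤J (yes J∧B≤H) ind = begin
        a (ζ H) * (⟪ rk B ∸ ζ H ⟫ - 𝟙 (z ℕ.≟ suc (ζ H)) * T)
          ≡⟨ cong₂ (λ t u → a t * (⟪ rk B ∸ t ⟫ - u * T)) (cong rk H∧B≡J∧B) ind ⟩
        a z * (⟪ rk B ∸ z ⟫ - (1ℚ - 1ℚ) * T)
          ≡⟨ solve 4 (λ a s t q → a :* (s :- (con 1ℚ :- con 1ℚ) :* t) := con 1ℚ :* (a :* s :+ q) :- q) refl (a z) ⟪ rk B ∸ z ⟫ T Q ⟩
        1ℚ * (P + Q) - Q ∎
        where
        H∧B≡J∧B : H ∧ B ≡ subspace J ∧ B
        H∧B≡J∧B = ≤-antisym {H ∧ B} {subspace J ∧ B} (∧-mono {H} {subspace J} B H≤J)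
          (∧-greatest {H} {B} {subspace J ∧ B} J∧B≤H (∧-lower₂ (subspace J) B))
      value H H≤J (no J∧B≰H) ind = begin
        a (ζ H) * (⟪ rk B ∸ ζ H ⟫ - 𝟙 (z ℕ.≟ suc (ζ H)) * T)
          ≡⟨ cong₂ (λ t u → a t * (⟪ rk B ∸ t ⟫ - u * T)) (cong pred (sym z≡)) ind ⟩
        a (pred z) * (⟪ rk B ∸ pred z ⟫ - (1ℚ - 0ℚ) * T)
          ≡⟨ solve 4 (λ a s t p → a :* (s :- (con 1ℚ :- con 0ℚ) :* t) := con 0ℚ :* (p :+ a :* (t :- s)) :- a :* (t :- s)) refl (a (pred z)) ⟪ rk B ∸ pred z ⟫ T P ⟩
        0ℚ * (P + Q) - Q ∎
        where
        z≡ : z ≡ suc (ζ H)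
        z≡ = decidable-stable (z ℕ.≟ suc (ζ H)) λ neq → contradiction (trans (sym (𝟙-false (z ℕ.≟ suc (ζ H)) neq)) ind) λ ()
      separate : ∀ H → 𝟙 (subspace H ≤? subspace J) * (a (ζ (subspace H)) * (⟪ rk B ∸ ζ (subspace H) ⟫ - e J H * T))
                 ≡ e′ H * 𝟙 (subspace H ≤? subspace J) * (P + Q) - 𝟙 (subspace H ≤? subspace J) * Q
      separate H = trans
        (𝟙-*-cong (subspace H ≤? subspace J) λ H≤J → value (subspace H) H≤J ((subspace J ∧ B) ≤? subspace H)
          (meeting-indicator {subspace H} {subspace J} B H≤J (trans (rank-of J) (cong suc (sym (rank-of H))))))
        (solve 4 (λ x y r q → x :* (y :* r :- q) := y :* x :* r :- x :* q) refl (𝟙 (subspace H ≤? subspace J)) (e′ H) (P + Q) Q)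

    telescope : ∑ Js (λ J → let z = ζ (subspace J) in
      𝟙 (subspace J ≤? L) * (a z * ⟪ rk B ∸ z ⟫ * ⟪ suc h ∸ z ⟫ - a (pred z) * (T - ⟪ rk B ∸ pred z ⟫) * (⟪ suc h ⟫ - ⟪ suc h ∸ z ⟫))) ≡ 0ℚ
    telescope = begin
      _                                    ≡⟨ ∑-cong Js ∑-term-H ⟨
      ∑ Js (λ J → ∑ Hs (λ H → term J H))   ≡⟨ ∑-swap Js Hs term ⟩
      ∑ Hs (λ H → ∑ Js (λ J → term J H))   ≡⟨ ∑-cong Hs ∑-term-J ⟩
      ∑ Hs (λ _ → 0ℚ)                      ≡⟨ ∑-zero Hs ⟩
      0ℚ                                   ∎



  kernel-vanishes : ∀ {L B h} → B ≤ L → suc h ℕ.< rk L → rk B ℕ.< rk L → rk L ℕ.≤ suc h ℕ.+ rk B →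
    ∑ (members V (suc h)) (λ J → 𝟙 (subspace J ≤? L) * γ (base V) (rk L) (suc h) (rk (subspace J ∧ B))) ≡ 0ℚ
  kernel-vanishes {L} {B} {h} B≤L i<k b<k k≤i+b = *-cancelˡ K K≢0 (begin
    K * ∑ Js (λ J → 𝟙 (subspace J ≤? L) * Γ J)
      ≡⟨ ∑-*ˡ Js K _ ⟨
    ∑ Js (λ J → K * (𝟙 (subspace J ≤? L) * Γ J))
      ≡⟨ ∑-cong Js (λ J → trans
           (solve 3 (λ k x g → k :* (x :* g) := x :* (k :* g)) refl K (𝟙 (subspace J ≤? L)) (Γ J))
           (𝟙-*-cong (subspace J ≤? L) λ J≤L → sym (γ-telescope i<k (ℕ.<⇒≤ b<k) (z≤i J) (z≤b J) (i≤c+z J J≤L) c≤i))) ⟩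
    _ ≡⟨ Telescoping.telescope {L} {B} B≤L h (potential k b i) ⟩
    0ℚ
      ≡⟨ ℚ.*-zeroʳ K ⟨
    K * 0ℚ ∎)
    where
    k = rk L
    b = rk B
    i = suc h
    K = ⟪ k ∸ b ⟫ * ⟪ k ∸ i ⟫
    K≢0 : K ≢ 0ℚ
    K≢0 = *-≢0 (⟪⟫-≢0 (ℕ.m<n⇒0<n∸m b<k)) (⟪⟫-≢0 (ℕ.m<n⇒0<n∸m i<k))
    Js = members V i
    Γ : Gr V i → ℚ
    Γ J = γ (base V) k i (rk (subspace J ∧ B))
    z≤i : ∀ J → rk (subspace J ∧ B) ℕ.≤ i
    z≤i J = subst (rk (subspace J ∧ B) ℕ.≤_) (rank-of J) (rk-mono {subspace J ∧ B} {subspace J} (∧-lower₁ (subspace J) B))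
    z≤b : ∀ J → rk (subspace J ∧ B) ℕ.≤ b
    z≤b J = rk-mono {subspace J ∧ B} {B} (∧-lower₂ (subspace J) B)
    -- J = L ∧ J meets B in rank at least i - (k - b), because B has corank k - b in L. This keeps
    -- the exponent of the potential at z from truncating.
    i≤c+z : ∀ J → subspace J ≤ L → i ℕ.≤ (k ∸ b) ℕ.+ rk (subspace J ∧ B)
    i≤c+z J J≤L = subst₂ ℕ._≤_
      (trans (cong rk (trans (∧-comm L (subspace J)) (∧-absorb {subspace J} {L} J≤L))) (rank-of J))
      (cong (λ W → (k ∸ b) ℕ.+ rk W) (∧-comm B (subspace J)))
      (rk-∧-chain (k ∸ b) {B} {L} (subspace J) B≤L (sym (ℕ.m∸n+n≡m (ℕ.<⇒≤ b<k))))
    c≤i : k ∸ b ℕ.≤ i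
    c≤i = ℕ.≤-trans (ℕ.∸-monoˡ-≤ b k≤i+b) (ℕ.≤-reflexive (ℕ.m+n∸n≡m i b))

  private
    -- The telescoping carries the factor [k - i] and says nothing at i = k. That case is separate:
    -- the sum has the single term J = L, and γ is a Kronecker delta there.
    kernel-within : ∀ {L B} i → B ≤ L → i ℕ.≤ rk L → rk L ℕ.≤ i ℕ.+ rk B →
      ∑ (members V i) (λ J → 𝟙 (subspace J ≤? L) * γ (base V) (rk L) i (rk (subspace J ∧ B))) ≡ 𝟙 (L ≤? B)
    kernel-within {L} {B} i B≤L i≤k k≤i+b = by-index (ℕ.m≤n⇒m<n∨m≡n i≤k) (L ≤? B)
      where
      k = rk L
      by-index : i ℕ.< k ⊎ i ≡ k → (d : Dec (L ≤ B)) →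
        ∑ (members V i) (λ J → 𝟙 (subspace J ≤? L) * γ (base V) k i (rk (subspace J ∧ B))) ≡ 𝟙 d
      by-index (inj₂ refl) d = begin
        ∑ (members V k) (λ J → 𝟙 (subspace J ≤? L) * γ (base V) k k (rk (subspace J ∧ B)))
          ≡⟨ Listing.∑-single (members-listing V k) (λ J → subspace J ≤? L) (L , refl) (λ x → x)
               (λ J J≤L → subspace-injective (≤-antisym {subspace J} {L} J≤L
                 (≤-from-rk {subspace J} {L} J≤L (ℕ.≤-reflexive (sym (rank-of J))))))
               (λ J → γ (base V) k k (rk (subspace J ∧ B))) ⟩
        γ (base V) k k (rk (L ∧ B))
          ≡⟨ γ-full k (rk (L ∧ B)) ⟩
        𝟙 (rk (L ∧ B) ℕ.≟ k)
          ≡⟨ 𝟙-cong (rk (L ∧ B) ℕ.≟ k) d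
               (λ eq → ∧-lower₂ L B ∘ ≤-from-rk {L ∧ B} {L} (∧-lower₁ L B) (ℕ.≤-reflexive (sym eq)))
               (λ L≤B → cong rk (∧-absorb {L} {B} L≤B)) ⟩
        𝟙 d ∎
      by-index (inj₁ i<k) (yes L≤B) = begin
        ∑ (members V i) (λ J → 𝟙 (subspace J ≤? L) * γ (base V) k i (rk (subspace J ∧ B)))
          ≡⟨ ∑-cong (members V i) (λ J → 𝟙-*-cong (subspace J ≤? L) λ J≤L → trans
               (cong (γ (base V) k i) (trans (cong rk (∧-absorb {subspace J} {B} (L≤B ∘ J≤L))) (rank-of J))) (γ-top i<k)) ⟩
        ∑ (members V i) (λ J → 𝟙 (subspace J ≤? L) * inv (gaussian (base V) k i))
          ≡⟨ trans (∑-*ʳ (members V i) _ _) (cong (_* inv (gaussian (base V) k i)) (grassmannian-size i L i≤k)) ⟩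
        gaussian (base V) k i * inv (gaussian (base V) k i)
          ≡⟨ inv-inverse (gaussian-≢0 i i≤k) ⟩
        1ℚ ∎
      by-index (inj₁ i<k) (no L≰B) = by-positivity i i<k k≤i+b
        where
        b<k : rk B ℕ.< k
        b<k = ℕ.≰⇒> λ k≤b → L≰B (≤-from-rk {B} {L} B≤L k≤b)
        by-positivity : ∀ i → i ℕ.< k → k ℕ.≤ i ℕ.+ rk B →
          ∑ (members V i) (λ J → 𝟙 (subspace J ≤? L) * γ (base V) k i (rk (subspace J ∧ B))) ≡ 0ℚ
        -- Pairs of ranks i - 1 and i require i > 0; for i = 0 the bound k ≤ i + b contradicts b <
        -- k.
        by-positivity zero    _   k≤b   = contradiction k≤b (ℕ.<⇒≱ b<k)
        by-positivity (suc h) i<k k≤i+b = kernel-vanishes {L} {B} B≤L i<k b<k k≤i+b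

  kernel : ∀ {L A k i} → rk L ≡ k → i ℕ.≤ k → k ℕ.≤ i ℕ.+ rk (A ∧ L) →
           ∑ (members V i) (λ J → γ (base V) k i (rk (A ∧ subspace J)) * 𝟙 (subspace J ≤? L)) ≡ 𝟙 (L ≤? A)
  kernel {L} {A} {i = i} refl i≤k k≤ = begin
    ∑ (members V i) (λ J → γ (base V) (rk L) i (rk (A ∧ subspace J)) * 𝟙 (subspace J ≤? L))
      ≡⟨ ∑-cong (members V i) (λ J → trans (ℚ.*-comm _ (𝟙 (subspace J ≤? L)))
           (𝟙-*-cong (subspace J ≤? L) λ J≤L → cong (λ W → γ (base V) (rk L) i (rk W)) (meet J J≤L))) ⟩
    ∑ (members V i) (λ J → 𝟙 (subspace J ≤? L) * γ (base V) (rk L) i (rk (subspace J ∧ (A ∧ L))))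
      ≡⟨ kernel-within {L} {A ∧ L} i (∧-lower₂ A L) i≤k k≤ ⟩
    𝟙 (L ≤? (A ∧ L))
      ≡⟨ 𝟙-cong (L ≤? (A ∧ L)) (L ≤? A) (∧-lower₁ A L ∘_) (λ L≤A → ∧-greatest {A} {L} {L} L≤A (λ x → x)) ⟩
    𝟙 (L ≤? A) ∎
    where
    meet : ∀ J → subspace J ≤ L → A ∧ subspace J ≡ subspace J ∧ (A ∧ L)
    meet J J≤L = ≤-antisym {A ∧ subspace J} {subspace J ∧ (A ∧ L)}
      (∧-greatest {subspace J} {A ∧ L} {A ∧ subspace J} (∧-lower₂ A (subspace J))
        (∧-greatest {A} {L} {A ∧ subspace J} (∧-lower₁ A (subspace J)) (J≤L ∘ ∧-lower₂ A (subspace J))))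
      (∧-greatest {A} {subspace J} {subspace J ∧ (A ∧ L)} (∧-lower₁ A L ∘ ∧-lower₂ (subspace J) (A ∧ L)) (∧-lower₁ (subspace J) (A ∧ L)))

-- Real-valued functions on the Grassmannians

pointwise : ∀ {x y} → (∀ a → seq x a ≡ seq y a) → x ≈ℝ y
pointwise {x} {y} eq ε ε>0 = 0 , λ a _ → subst (ℚ._< ε)
  (sym (trans (cong (λ t → ℚ.∣ t - seq y a ∣) (eq a)) (cong ℚ.∣_∣ (ℚ.+-inverseʳ (seq y a))))) ε>0

≈ℝ-sym : ∀ {x y} → x ≈ℝ y → y ≈ℝ x
≈ℝ-sym {x} {y} x≈y ε ε>0 with x≈y ε ε>0
... | N , close = N , λ a N≤a → subst (ℚ._< ε)
  (trans (sym (ℚ.∣-p∣≡∣p∣ (seq x a - seq y a)))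
    (cong ℚ.∣_∣ (solve 2 (λ x y → :- (x :- y) := y :- x) refl (seq x a) (seq y a)))) (close a N≤a)
  where open +-*-Solver

≈ℝ-trans : ∀ {x y z} → x ≈ℝ y → y ≈ℝ z → x ≈ℝ z
≈ℝ-trans {x} {y} {z} x≈y y≈z ε ε>0 with x≈y (ℚ.½ * ε) (½-pos ε>0) | y≈z (ℚ.½ * ε) (½-pos ε>0)
... | N₁ , close₁ | N₂ , close₂ = N₁ ℕ.⊔ N₂ , λ a N≤a → subst (λ t → ℚ.∣ t ∣ ℚ.< ε)
  (solve 3 (λ x y z → (x :+ y) :- (y :+ z) := x :- z) refl (seq x a) (seq y a) (seq z a))
  (+-close (seq x a) (seq y a) (seq y a) (seq z a)
    (close₁ a (ℕ.m⊔n≤o⇒m≤o N₁ N₂ N≤a)) (close₂ a (ℕ.m⊔n≤o⇒n≤o N₁ N₂ N≤a)))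
  where open +-*-Solver

+ℝ-cong : ∀ {x x′ y y′} → x ≈ℝ x′ → y ≈ℝ y′ → (x +ℝ y) ≈ℝ (x′ +ℝ y′)
+ℝ-cong {x} {x′} {y} {y′} x≈x′ y≈y′ ε ε>0 with x≈x′ (ℚ.½ * ε) (½-pos ε>0) | y≈y′ (ℚ.½ * ε) (½-pos ε>0)
... | N₁ , close₁ | N₂ , close₂ = N₁ ℕ.⊔ N₂ , λ a N≤a → +-close (seq x a) (seq y a) (seq x′ a) (seq y′ a)
  (close₁ a (ℕ.m⊔n≤o⇒m≤o N₁ N₂ N≤a)) (close₂ a (ℕ.m⊔n≤o⇒n≤o N₁ N₂ N≤a))

fromℚ-*-cong : ∀ p {x y} → x ≈ℝ y → (fromℚ p *ℝ x) ≈ℝ (fromℚ p *ℝ y)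
fromℚ-*-cong p {x} {y} x≈y ε ε>0 =
  -- `scale` returns half of its argument, hence ε + ε; the bound is 1 + |p| because it must be
  -- positive even for p = 0.
  let δ , δ>0 , eq = scale bound (ε + ε) bound>0 (ℚ.+-mono-< ε>0 ε>0)
      N , close = x≈y δ δ>0
  in N , λ a N≤a → subst₂ ℚ._<_
    (cong ℚ.∣_∣ (solve 3 (λ p x y → p :* (x :- y) := p :* x :- p :* y) refl p (seq x a) (seq y a)))
    (trans eq (trans (ℚ.*-distribˡ-+ ℚ.½ ε ε) (halves ε)))
    (*-mono-abs p (seq x a - seq y a) p≤bound (close a N≤a) bound>0)
  where
  open +-*-Solver
  bound = 1ℚ + ℚ.∣ p ∣
  bound>0 : 0ℚ ℚ.< bound
  bound>0 = ℚ.+-mono-<-≤ (ℚ.positive⁻¹ 1ℚ) (ℚ.0≤∣p∣ p)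
  p≤bound : ℚ.∣ p ∣ ℚ.≤ bound
  p≤bound = subst (ℚ._≤ bound) (ℚ.+-identityˡ ℚ.∣ p ∣) (ℚ.+-monoˡ-≤ ℚ.∣ p ∣ (ℚ.<⇒≤ (ℚ.positive⁻¹ 1ℚ)))

module _ {c ℓ m ℓm} {V : Space c ℓ m ℓm} where

  seq-∑Gr : ∀ k (g : Gr V k → ℝ) a → seq (∑Gr k g) a ≡ ∑ (members V k) (λ I → seq (g I) a)
  seq-∑Gr k g a = go (members V k)
    where
    go : ∀ xs → seq (foldr (λ I s → g I +ℝ s) 0ℝ xs) a ≡ ∑ xs (λ I → seq (g I) a)
    go []       = refl
    go (I ∷ xs) = cong (seq (g I) a +_) (go xs)

  ∑Gr-cong : ∀ k {g h : Gr V k → ℝ} → (∀ I → g I ≈ℝ h I) → ∑Gr k g ≈ℝ ∑Gr k h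
  ∑Gr-cong k {g} {h} eq = go (members V k)
    where
    go : ∀ xs → foldr (λ I s → g I +ℝ s) 0ℝ xs ≈ℝ foldr (λ I s → h I +ℝ s) 0ℝ xs
    go []       = pointwise {0ℝ} {0ℝ} λ _ → refl
    go (I ∷ xs) = +ℝ-cong {g I} {h I} {foldr (λ I s → g I +ℝ s) 0ℝ xs} {foldr (λ I s → h I +ℝ s) 0ℝ xs} (eq I) (go xs)

  seq-char : ∀ k (U : Subspace V) (K : Gr V k) a → seq (char k U K) a ≡ 𝟙 (U ≤? subspace K)
  seq-char k U K a = go (U ≤? subspace K)
    where
    go : (d : Dec (U ≤ subspace K)) → seq (if does d then 1ℝ else 0ℝ) a ≡ 𝟙 d
    go (yes _) = refl
    go (no _)  = refl

  seq-superposition : ∀ {k i} (wt : Gr V i → ℝ) (K : Gr V k) a →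
    seq (∑Gr i λ I → wt I *ℝ char k (subspace I) K) a ≡
    ∑ (members V i) (λ I → seq (wt I) a * 𝟙 (subspace I ≤? subspace K))
  seq-superposition {k} {i} wt K a = trans (seq-∑Gr i (λ I → wt I *ℝ char k (subspace I) K) a)
    (∑-cong (members V i) λ I → cong (seq (wt I) a *_) (seq-char k (subspace I) K a))

  transform : ∀ {i j} → (Gr V i → Gr V j → ℚ) → (Gr V i → ℝ) → Gr V j → ℝ
  transform {i} M wt J = ∑Gr i λ I → fromℚ (M I J) *ℝ wt I

  -- An exchange of finite sums, valid in every term of the sequences, so no limit enters. The
  -- matrix M is γ for dualization, and a normalised inclusion matrix for the step from one space of
  -- the chain to the next.
  superposition-transform : ∀ {i j k l} (M : Gr V i → Gr V j → ℚ) (wt : Gr V i → ℝ) (K : Gr V k) (L : Gr V l) →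
    (∀ I → ∑ (members V j) (λ J → M I J * 𝟙 (subspace J ≤? subspace L)) ≡ 𝟙 (subspace I ≤? subspace K)) →
    (∑Gr i λ I → wt I *ℝ char k (subspace I) K) ≈ℝ (∑Gr j λ J → transform M wt J *ℝ char l (subspace J) L)
  superposition-transform {i} {j} {k} {l} M wt K L M-dual =
    pointwise {∑Gr i λ I → wt I *ℝ char k (subspace I) K} {∑Gr j λ J → transform M wt J *ℝ char l (subspace J) L} λ a →
    let w : Gr V i → ℚ
        w I = seq (wt I) a
    in begin
    seq (∑Gr i λ I → wt I *ℝ char k (subspace I) K) a
      ≡⟨ seq-superposition wt K a ⟩
    ∑ (members V i) (λ I → w I * 𝟙 (subspace I ≤? subspace K))
      ≡⟨ ∑-cong (members V i) (λ I → trans (cong (w I *_) (sym (M-dual I))) (sym (∑-*ˡ (members V j) (w I) _))) ⟩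
    ∑ (members V i) (λ I → ∑ (members V j) (λ J → w I * (M I J * 𝟙 (subspace J ≤? subspace L))))
      ≡⟨ ∑-swap (members V i) (members V j) _ ⟩
    ∑ (members V j) (λ J → ∑ (members V i) (λ I → w I * (M I J * 𝟙 (subspace J ≤? subspace L))))
      ≡⟨ ∑-cong (members V j) (λ J → trans
           (∑-cong (members V i) λ I → solve 3 (λ w m x → w :* (m :* x) := m :* w :* x) refl (w I) (M I J) (𝟙 (subspace J ≤? subspace L)))
           (∑-*ʳ (members V i) _ _)) ⟩
    ∑ (members V j) (λ J → ∑ (members V i) (λ I → M I J * w I) * 𝟙 (subspace J ≤? subspace L))
      ≡⟨ ∑-cong (members V j) (λ J → cong (_* 𝟙 (subspace J ≤? subspace L)) (seq-∑Gr i (λ I → fromℚ (M I J) *ℝ wt I) a)) ⟨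
    ∑ (members V j) (λ J → seq (transform M wt J) a * 𝟙 (subspace J ≤? subspace L))
      ≡⟨ seq-superposition (transform M wt) L a ⟨
    seq (∑Gr j λ J → transform M wt J *ℝ char l (subspace J) L) a ∎
    where
    open +-*-Solver
    open ≡-Reasoning

  -- M is a row of a left inverse of the inclusion matrix. Applied to the superposition it returns
  -- the weight exactly; replacing the superposition by g costs an estimate only for multiplication
  -- by rationals. The resulting expression depends on g alone, which gives uniqueness.
  superposition-recover : ∀ {i l} (M : Gr V l → ℚ) (J₀ : Gr V i) →
    (∀ J → ∑ (members V l) (λ L → M L * 𝟙 (subspace J ≤? subspace L)) ≡ 𝟙 (J ≟ᴳ J₀)) →
    ∀ {g : Gr V l → ℝ} {wt} → IsWeightDistribution i g wt → wt J₀ ≈ℝ (∑Gr l λ L → fromℚ (M L) *ℝ g L)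
  superposition-recover {i} {l} M J₀ M-inverse {g} {wt} isWt =
    ≈ℝ-trans {wt J₀} {∑Gr l λ L → fromℚ (M L) *ℝ h L} {∑Gr l λ L → fromℚ (M L) *ℝ g L}
      (pointwise {wt J₀} {∑Gr l λ L → fromℚ (M L) *ℝ h L} recover)
      (∑Gr-cong l {λ L → fromℚ (M L) *ℝ h L} {λ L → fromℚ (M L) *ℝ g L}
        λ L → fromℚ-*-cong (M L) {h L} {g L} (≈ℝ-sym {g L} {h L} (isWt L)))
    where
    open +-*-Solver
    open ≡-Reasoning
    h : Gr V l → ℝ
    h L = ∑Gr i λ J → wt J *ℝ char l (subspace J) L
    recover : ∀ a → seq (wt J₀) a ≡ seq (∑Gr l λ L → fromℚ (M L) *ℝ h L) a
    recover a = begin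
      w J₀
        ≡⟨ Listing.∑-single (members-listing V i) (_≟ᴳ J₀) J₀ refl (λ _ eq → eq) w ⟨
      ∑ (members V i) (λ J → 𝟙 (J ≟ᴳ J₀) * w J)
        ≡⟨ ∑-cong (members V i) (λ J → trans (cong (_* w J) (sym (M-inverse J))) (sym (∑-*ʳ (members V l) (w J) _))) ⟩
      ∑ (members V i) (λ J → ∑ (members V l) (λ L → M L * 𝟙 (subspace J ≤? subspace L) * w J))
        ≡⟨ ∑-swap (members V i) (members V l) _ ⟩
      ∑ (members V l) (λ L → ∑ (members V i) (λ J → M L * 𝟙 (subspace J ≤? subspace L) * w J))
        ≡⟨ ∑-cong (members V l) (λ L → trans
             (∑-cong (members V i) λ J → solve 3 (λ c x w → c :* x :* w := c :* (w :* x)) refl (M L) (𝟙 (subspace J ≤? subspace L)) (w J))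
             (trans (∑-*ˡ (members V i) (M L) _) (cong (M L *_) (sym (seq-superposition wt L a))))) ⟩
      ∑ (members V l) (λ L → M L * seq (h L) a)
        ≡⟨ seq-∑Gr l (λ L → fromℚ (M L) *ℝ h L) a ⟨
      seq (∑Gr l λ L → fromℚ (M L) *ℝ h L) a ∎
      where
      w : Gr V i → ℚ
      w J = seq (wt J) a

-- -- Weight distributions of dualized functions

module Dualization {c ℓ m ℓm} {V : Space c ℓ m ℓm} (G : Geometry V)
                   (_^⊥ : Subspace V → Subspace V) (iso : IsAntiAutomorphism _^⊥) where

  open Geometry G
  open QNumbers (base V) base>0
  open Lattice G
  open Duality G _^⊥ iso
  open Kernel G _^⊥ iso
  open ≡-Reasoning

  private
    rk-via-whole : ∀ {U i} L → i ℕ.+ rk U ≡ rank V → rk L ℕ.≤ i ℕ.+ rk (U ∧ L)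
    rk-via-whole {U} {i} L i+U = subst (λ W → rk W ℕ.≤ i ℕ.+ rk (U ∧ L))
      (trans (∧-comm (whole V) L) (∧-absorb {L} {whole V} ⊆⊤))
      (rk-∧-chain i {U} {whole V} L ⊆⊤ (sym i+U))

  kernel-dual : ∀ {k l i} → k ℕ.+ l ≡ rank V → i ℕ.≤ l → (K : Gr V k) (L : Gr V l) → subspace L ≡ (subspace K) ^⊥ →
    ∀ (I : Gr V i) → ∑ (members V i) (λ J → γ (base V) l i (rk (((subspace I) ^⊥) ∧ subspace J)) * 𝟙 (subspace J ≤? subspace L)) ≡ 𝟙 (subspace I ≤? subspace K)
  kernel-dual {l = l} {i} k+l i≤l K L L≡K⊥ I = trans
    (kernel {subspace L} {subspace I ^⊥} (rank-of L) i≤l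
      (subst (ℕ._≤ i ℕ.+ rk ((subspace I ^⊥) ∧ subspace L)) (rank-of L)
        (rk-via-whole {subspace I ^⊥} {i} (subspace L) (trans (cong (ℕ._+ rk (subspace I ^⊥)) (sym (rank-of I))) (rk-⊥ (subspace I))))))
    (𝟙-cong (subspace L ≤? (subspace I ^⊥)) (subspace I ≤? subspace K)
      (λ le → ⊥-cancel {subspace I} {subspace K} (subst (_≤ (subspace I ^⊥)) L≡K⊥ le))
      (λ le → subst (_≤ (subspace I ^⊥)) (sym L≡K⊥) (⊥-anti {subspace I} {subspace K} le)))

  -- The kernel identity in the dual lattice inverts the inclusion matrix on the other side.
  inverse-kernel : ∀ {k l i} → k ℕ.+ l ≡ rank V → i ℕ.≤ k → i ℕ.≤ l → (J₀ J : Gr V i) →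
    ∑ (members V l) (λ L → γ (base V) (rank V ∸ i) k (rk ((subspace J₀ ᵀ) ∧ (subspace L ᵀ))) * 𝟙 (subspace J ≤? subspace L)) ≡ 𝟙 (J ≟ᴳ J₀)
  inverse-kernel {k} {l} {i} k+l i≤k i≤l J₀ J = begin
    ∑ (members V l) (λ L → γ (base V) (rank V ∸ i) k (rk ((subspace J₀ ᵀ) ∧ (subspace L ᵀ))) * 𝟙 (subspace J ≤? subspace L))
      ≡⟨ ∑-cong (members V l) (λ L → cong (γ (base V) (rank V ∸ i) k (rk ((subspace J₀ ᵀ) ∧ (subspace L ᵀ))) *_)
           (𝟙-cong (subspace J ≤? subspace L) ((subspace L ᵀ) ≤? (subspace J ᵀ)) (ᵀ-anti {subspace J} {subspace L}) (ᵀ-cancel {subspace J} {subspace L}))) ⟩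
    ∑ (members V l) (λ L → γ (base V) (rank V ∸ i) k (rk ((subspace J₀ ᵀ) ∧ (subspace L ᵀ))) * 𝟙 ((subspace L ᵀ) ≤? (subspace J ᵀ)))
      ≡⟨ ∑-dual k+l (λ X → γ (base V) (rank V ∸ i) k (rk ((subspace J₀ ᵀ) ∧ X)) * 𝟙 (X ≤? (subspace J ᵀ))) ⟨
    ∑ (members V k) (λ X → γ (base V) (rank V ∸ i) k (rk ((subspace J₀ ᵀ) ∧ subspace X)) * 𝟙 (subspace X ≤? (subspace J ᵀ)))
      -- The parameters k and i of the kernel identity are n - i and k here. The bound k ≤ n - i
      -- amounts to i ≤ l. As `subspace J₀ ᵀ` has corank i ≤ k, its meeting with `subspace J ᵀ` has
      -- rank at least (n - i) - k.
      ≡⟨ kernel {subspace J ᵀ} {subspace J₀ ᵀ} (rk-Jᵀ J) k≤n∸i (subst (ℕ._≤ k ℕ.+ rk ((subspace J₀ ᵀ) ∧ (subspace J ᵀ))) (rk-Jᵀ J)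
           (ℕ.≤-trans (rk-via-whole {subspace J₀ ᵀ} {i} (subspace J ᵀ)
             (trans (ℕ.+-comm i _) (trans (cong (rk (subspace J₀ ᵀ) ℕ.+_) (sym (rank-of J₀))) (rk-ᵀ (subspace J₀)))))
             (ℕ.+-monoˡ-≤ _ i≤k))) ⟩
    𝟙 ((subspace J ᵀ) ≤? (subspace J₀ ᵀ))
      ≡⟨ 𝟙-cong ((subspace J ᵀ) ≤? (subspace J₀ ᵀ)) (J ≟ᴳ J₀)
           (λ le → let J₀≤J = ᵀ-cancel {subspace J₀} {subspace J} le in
             subspace-injective (≤-antisym {subspace J} {subspace J₀}
               (≤-from-rk {subspace J₀} {subspace J} J₀≤J (ℕ.≤-reflexive (trans (rank-of J) (sym (rank-of J₀))))) J₀≤J))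
           (λ { refl x → x }) ⟩
    𝟙 (J ≟ᴳ J₀) ∎
    where
    ᵀ-anti : ∀ {U W} → U ≤ W → (W ᵀ) ≤ (U ᵀ)
    ᵀ-anti {U} {W} U≤W = ⊥-cancel {W ᵀ} {U ᵀ} (subst₂ _≤_ (sym (ᵀ-⊥ U)) (sym (ᵀ-⊥ W)) U≤W)
    ᵀ-cancel : ∀ {U W} → (W ᵀ) ≤ (U ᵀ) → U ≤ W
    ᵀ-cancel {U} {W} le = subst₂ _≤_ (ᵀ-⊥ U) (ᵀ-⊥ W) (⊥-anti {W ᵀ} {U ᵀ} le)
    rk-Jᵀ : ∀ (J : Gr V i) → rk (subspace J ᵀ) ≡ rank V ∸ i
    rk-Jᵀ J = trans (sym (ℕ.m+n∸n≡m _ (rk (subspace J)))) (cong₂ _∸_ (rk-ᵀ (subspace J)) (rank-of J))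
    k≤n∸i : k ℕ.≤ rank V ∸ i
    k≤n∸i = ℕ.m+n≤o⇒m≤o∸n k (subst (k ℕ.+ i ℕ.≤_) k+l (ℕ.+-monoʳ-≤ k i≤l))

  weight-unique : ∀ {k l i} → k ℕ.+ l ≡ rank V → i ℕ.≤ k → i ℕ.≤ l → {g : Gr V l → ℝ} {wt wt′ : Gr V i → ℝ} →
    IsWeightDistribution i g wt → IsWeightDistribution i g wt′ → ∀ J → wt J ≈ℝ wt′ J
  weight-unique {k} {l} {i} k+l i≤k i≤l {g} {wt} {wt′} isWt isWt′ J₀ =
    ≈ℝ-trans {wt J₀} {∑Gr l λ L → fromℚ (M L) *ℝ g L} {wt′ J₀}
      (superposition-recover M J₀ (inverse-kernel k+l i≤k i≤l J₀) {g} {wt} isWt)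
      (≈ℝ-sym {wt′ J₀} {∑Gr l λ L → fromℚ (M L) *ℝ g L}
        (superposition-recover M J₀ (inverse-kernel k+l i≤k i≤l J₀) {g} {wt′} isWt′))
    where
    M : Gr V l → ℚ
    M L = γ (base V) (rank V ∸ i) k (rk ((subspace J₀ ᵀ) ∧ (subspace L ᵀ)))

  -- Every K above I contains [k - t] covers of I, so x_I is the sum of x_J over the covers J of I,
  -- divided by [k - t]; t < k makes the division possible.
  ∈V̄-suc : ∀ {k t} {f : Gr V k → ℝ} → t ℕ.< k → f ∈V̄ t → f ∈V̄ suc t
  ∈V̄-suc {k} {t} {f} t<k (wt , isWt) = transform M wt , λ K →
    ≈ℝ-trans {f K} {∑Gr t λ I → wt I *ℝ char k (subspace I) K} {∑Gr (suc t) λ J → transform M wt J *ℝ char k (subspace J) K}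
      (isWt K) (superposition-transform M wt K K (normalised K))
    where
    r = inv ⟪ k ∸ t ⟫
    M : Gr V t → Gr V (suc t) → ℚ
    M I J = r * 𝟙 (subspace I ≤? subspace J)
    normalised : ∀ K I → ∑ (members V (suc t)) (λ J → M I J * 𝟙 (subspace J ≤? subspace K)) ≡ 𝟙 (subspace I ≤? subspace K)
    normalised K I = begin
      ∑ (members V (suc t)) (λ J → M I J * 𝟙 (subspace J ≤? subspace K))
        ≡⟨ trans (∑-cong (members V (suc t)) λ J → ℚ.*-assoc r _ _) (∑-*ˡ (members V (suc t)) r _) ⟩
      r * ∑ (members V (suc t)) (λ J → 𝟙 (subspace I ≤? subspace J) * 𝟙 (subspace J ≤? subspace K))
        ≡⟨ cong (r *_) (trans (covers-of I (subspace K)) (cong (λ s → 𝟙 (subspace I ≤? subspace K) * ⟪ s ∸ t ⟫) (rank-of K))) ⟩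
      r * (𝟙 (subspace I ≤? subspace K) * ⟪ k ∸ t ⟫)
        ≡⟨ solve 3 (λ r x s → r :* (x :* s) := x :* (s :* r)) refl r (𝟙 (subspace I ≤? subspace K)) ⟪ k ∸ t ⟫ ⟩
      𝟙 (subspace I ≤? subspace K) * (⟪ k ∸ t ⟫ * r)
        ≡⟨ trans (cong (𝟙 (subspace I ≤? subspace K) *_) (inv-inverse (⟪⟫-≢0 (ℕ.m<n⇒0<n∸m t<k)))) (ℚ.*-identityʳ _) ⟩
      𝟙 (subspace I ≤? subspace K) ∎
      where open +-*-Solver

  ∈V̄-mono : ∀ d {k t} {f : Gr V k → ℝ} → d ℕ.+ t ℕ.≤ k → f ∈V̄ t → f ∈V̄ (d ℕ.+ t)
  ∈V̄-mono zero            _  f∈ = f∈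
  ∈V̄-mono (suc d) {f = f} le f∈ = ∈V̄-suc {f = f} le (∈V̄-mono d {f = f} (ℕ.<⇒≤ le) f∈)

  ∈V̄-zero : ∀ {k} i {f : Gr V k → ℝ} → IsZero f → f ∈V̄ i
  ∈V̄-zero {k} i {f} f≈0 = (λ _ → 0ℝ) , λ K →
    ≈ℝ-trans {f K} {0ℝ} {∑Gr i λ I → 0ℝ *ℝ char k (subspace I) K} (f≈0 K)
      (pointwise {0ℝ} {∑Gr i λ I → 0ℝ *ℝ char k (subspace I) K} λ a → sym
        (trans (seq-∑Gr i (λ I → 0ℝ *ℝ char k (subspace I) K) a)
          (trans (∑-cong (members V i) λ I → ℚ.*-zeroˡ (ℝ.seq (char k (subspace I) K) a)) (∑-zero (members V i)))))

  degree⇒∈V̄ : ∀ {k} {f : Gr V k → ℝ} d {i} → HasDegree f d → max0 d ℕ.≤ i → i ℕ.≤ k → f ∈V̄ i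
  degree⇒∈V̄ {f = f} ⊥₋ {i} f≈0 _ _ = ∈V̄-zero i {f} f≈0
  degree⇒∈V̄ {k} {f} [ t ] {i} (_ , _ , f∈ , _) t≤i i≤k = subst (f ∈V̄_) i≡
    (∈V̄-mono (i ∸ t) {f = f} (subst (ℕ._≤ k) (sym i≡) i≤k) f∈)
    where
    i≡ : i ∸ t ℕ.+ t ≡ i
    i≡ = ℕ.m∸n+n≡m t≤i

  superposition-dual : ∀ {k l i} → k ℕ.+ l ≡ rank V → i ℕ.≤ l → (K : Gr V k) (L : Gr V l) → subspace L ≡ (subspace K) ^⊥ →
    (wt : Gr V i → ℝ) → (∑Gr i λ I → wt I *ℝ char k (subspace I) K) ≈ℝ
      (∑Gr i λ J → transform (λ I J → γ (base V) l i (rk (((subspace I) ^⊥) ∧ subspace J))) wt J *ℝ char l (subspace J) L)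
  superposition-dual {k} {l} {i} k+l i≤l K L L≡K⊥ wt =
    superposition-transform (λ I J → γ (base V) l i (rk (((subspace I) ^⊥) ∧ subspace J))) wt K L (kernel-dual k+l i≤l K L L≡K⊥)

  dual-weight : ∀ {k l i} → k ℕ.+ l ≡ rank V → i ℕ.≤ l →
    {f : Gr V k → ℝ} {f^⊥ : Gr V l → ℝ} → IsDualized _^⊥ f f^⊥ → {wt : Gr V i → ℝ} → IsWeightDistribution i f wt →
    IsWeightDistribution i f^⊥ (transform (λ I J → γ (base V) l i (rk (((subspace I) ^⊥) ∧ subspace J))) wt)
  dual-weight {k} {l} {i} k+l i≤l {f} {f^⊥} dualized {wt} isWt L =
    ≈ℝ-trans {f^⊥ L} {f K} {∑Gr i λ J → transform (λ I J → γ (base V) l i (rk (((subspace I) ^⊥) ∧ subspace J))) wt J *ℝ char l (subspace J) L} (dualized K L L≡K⊥)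
      (≈ℝ-trans {f K} {∑Gr i λ I → wt I *ℝ char k (subspace I) K} {∑Gr i λ J → transform (λ I J → γ (base V) l i (rk (((subspace I) ^⊥) ∧ subspace J))) wt J *ℝ char l (subspace J) L}
        (isWt K) (superposition-dual k+l i≤l K L L≡K⊥ wt))
    where
    K : Gr V k
    K = dual⁻¹ k+l L
    L≡K⊥ : subspace L ≡ (subspace K) ^⊥
    L≡K⊥ = sym (ᵀ-⊥ (subspace L))

  -- The transform by γ of a weight distribution of f is one of the dualized function, which proves
  -- membership; uniqueness identifies it with any other.
  dualized-weights : ∀ k → k ℕ.≤ rank V → (f : Gr V k → ℝ) (d : ℕ ₋) → HasDegree f d →
    (i : ℕ) → max0 d ℕ.≤ i → i ℕ.≤ k ⊓ (rank V ∸ k) →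
    (f^⊥ : Gr V (rank V ∸ k) → ℝ) → IsDualized _^⊥ f f^⊥ →
    (f^⊥ ∈V̄ i) ×
    ((wt-f wt-f^⊥ : Gr V i → ℝ) →
     IsWeightDistribution i f wt-f → IsWeightDistribution i f^⊥ wt-f^⊥ →
     ∀ J → wt-f^⊥ J ≈ℝ
       ∑Gr i (λ I → fromℚ (γ (base V) (rank V ∸ k) i (rk (((subspace I) ^⊥) ∧ subspace J))) *ℝ wt-f I))
  dualized-weights k k≤n f d deg i d≤i i≤ f^⊥ dualized = exists , λ wt-f wt-f^⊥ isWt isWt^⊥ → agrees wt-f isWt wt-f^⊥ isWt^⊥
    where
    k+l : k ℕ.+ (rank V ∸ k) ≡ rank V
    k+l = ℕ.m+[n∸m]≡n k≤n
    i≤k : i ℕ.≤ k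
    i≤k = ℕ.m≤n⊓o⇒m≤n k (rank V ∸ k) i≤
    i≤l : i ℕ.≤ rank V ∸ k
    i≤l = ℕ.m≤n⊓o⇒m≤o k (rank V ∸ k) i≤
    f∈V̄ : f ∈V̄ i
    f∈V̄ = degree⇒∈V̄ {f = f} d deg d≤i i≤k
    exists : f^⊥ ∈V̄ i
    exists = transform (λ I J → γ (base V) (rank V ∸ k) i (rk (((subspace I) ^⊥) ∧ subspace J))) (proj₁ f∈V̄) , dual-weight k+l i≤l {f} {f^⊥} dualized {proj₁ f∈V̄} (proj₂ f∈V̄)
    agrees : ∀ wt → IsWeightDistribution i f wt → ∀ wt^⊥ → IsWeightDistribution i f^⊥ wt^⊥ → ∀ J →
             wt^⊥ J ≈ℝ transform (λ I J → γ (base V) (rank V ∸ k) i (rk (((subspace I) ^⊥) ∧ subspace J))) wt J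
    agrees wt isWt wt^⊥ isWt^⊥ J = weight-unique k+l i≤k i≤l {f^⊥} {wt^⊥} {transform (λ I J → γ (base V) (rank V ∸ k) i (rk (((subspace I) ^⊥) ∧ subspace J))) wt} isWt^⊥
      (dual-weight k+l i≤l {f} {f^⊥} dualized {wt} isWt) J

-- Finite sets

[]⟨1⟩ : ∀ r → [ r ]⟨ 1 ⟩ ≡ r
[]⟨1⟩ zero    = refl
[]⟨1⟩ (suc r) = trans (cong₂ ℕ._+_ ([]⟨1⟩ r) (ℕ.^-zeroˡ r)) (ℕ.+-comm r 1)

∣p∪⁅x⁆∣ : ∀ {n} (U : Subset n) {x} → x ∉ U → ∣ U ∪ ⁅ x ⁆ ∣ ≡ suc ∣ U ∣
∣p∪⁅x⁆∣ (true  ∷ U) {zero}  x∉ = contradiction here x∉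
∣p∪⁅x⁆∣ (false ∷ U) {zero}  x∉ = cong (suc ∘ ∣_∣) (∪-identityʳ U)
∣p∪⁅x⁆∣ (true  ∷ U) {suc x} x∉ = cong suc (∣p∪⁅x⁆∣ U (x∉ ∘ there))
∣p∪⁅x⁆∣ (false ∷ U) {suc x} x∉ = ∣p∪⁅x⁆∣ U (x∉ ∘ there)

finiteSet-geometry : ∀ {c ℓ m ℓm} n → Geometry (finiteSet {c} {ℓ} {m} {ℓm} n)
finiteSet-geometry {c} {ℓ} {m} {ℓm} n = record
  { base>0         = ℕ.≤-refl
  ; constant       = 0
  ; slope          = 1
  ; slope>0        = ℕ.≤-refl
  ; cardinality    = λ U → sym (trans (ℕ.*-identityˡ _) ([]⟨1⟩ ∣ carrier U ∣))
  ; bottom         = ⊥ , tt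
  ; bottom-rk      = ∣⊥∣≡0 n
  ; bottom-≤       = λ U → ⊥⊆
  ; adjoin         = λ U x → (carrier U ∪ ⁅ x ⁆) , tt
  ; adjoin-≥       = λ U x → p⊆p∪q ⁅ x ⁆
  ; adjoin-∋       = λ U x → q⊆p∪q (carrier U) ⁅ x ⁆ (x∈⁅x⁆ x)
  ; adjoin-least   = λ U x W U≤W x∈W y∈ → least U x W U≤W x∈W (x∈p∪q⁻ (carrier U) ⁅ x ⁆ y∈)
  ; adjoin-modular = λ U x W x∈W y∈W y∈ → modular U x W y∈W (x∈p∪q⁻ (carrier U) ⁅ x ⁆ y∈)
  ; rk-adjoin      = λ U x → ∣p∪⁅x⁆∣ (carrier U)
  }
  where
  S : Space c ℓ m ℓm
  S = finiteSet n
  least : ∀ (U : Subspace S) x (W : Subspace S) {y} → U ≤ W → x ∈ carrier W → y ∈ carrier U ⊎ y ∈ ⁅ x ⁆ → y ∈ carrier W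
  least U x W U≤W x∈W (inj₁ y∈U) = U≤W y∈U
  least U x W U≤W x∈W (inj₂ y∈x) = subst (_∈ carrier W) (sym (x∈⁅y⁆⇒x≡y x y∈x)) x∈W
  modular : ∀ (U : Subspace S) x (W : Subspace S) {y} → y ∈ carrier W → y ∈ carrier U ⊎ y ∈ ⁅ x ⁆ →
            y ∈ (carrier U ∩ carrier W) ∪ ⁅ x ⁆
  modular U x W y∈W (inj₁ y∈U) = x∈p∪q⁺ (inj₁ (x∈p∩q⁺ (y∈U , y∈W)))
  modular U x W y∈W (inj₂ y∈x) = x∈p∪q⁺ (inj₂ y∈x)

-- Vector spaces over finite fields

-- The pairs (e, x) with φ e = x are counted once by x and once by e.
∣∣-parametrised : ∀ {m n} (U : Subset n) (φ : Fin m → Fin n) → (∀ {e e′} → φ e ≡ φ e′ → e ≡ e′) →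
                  (∀ e → φ e ∈ U) → (∀ x → x ∈ U → ∃ λ e → φ e ≡ x) → ∣ U ∣ ≡ m
∣∣-parametrised {m} {n} U φ injective φ∈U surjective = fromℕ-injective (begin
  fromℕ ∣ U ∣
    ≡⟨ ∑-∈ U ⟨
  ∑ (allFin n) (λ x → 𝟙 (x ∈? U))
    ≡⟨ ∑-cong (allFin n) (λ x → fibre x (x ∈? U)) ⟩
  ∑ (allFin n) (λ x → ∑ (allFin m) (λ e → 𝟙 (φ e Fin.≟ x)))
    ≡⟨ ∑-swap (allFin n) (allFin m) (λ x e → 𝟙 (φ e Fin.≟ x)) ⟩
  ∑ (allFin m) (λ e → ∑ (allFin n) (λ x → 𝟙 (φ e Fin.≟ x)))
    ≡⟨ ∑-cong (allFin m) (λ e → Listing.∑-unique (allFin-listing n) (λ x → φ e Fin.≟ x) (φ e) refl (λ _ → sym)) ⟩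
  ∑ (allFin m) (λ _ → 1ℚ)
    ≡⟨ ∑-one m ⟩
  fromℕ m ∎)
  where
  open ≡-Reasoning
  fibre : ∀ x (d : Dec (x ∈ U)) → 𝟙 d ≡ ∑ (allFin m) (λ e → 𝟙 (φ e Fin.≟ x))
  fibre x (yes x∈U) with surjective x x∈U
  ... | e₀ , φe₀≡x = sym (Listing.∑-unique (allFin-listing m) (λ e → φ e Fin.≟ x) e₀ φe₀≡x λ e φe≡x → injective (trans φe≡x (sym φe₀≡x)))
  fibre x (no x∉U) = sym (trans (∑-cong (allFin m) λ e → 𝟙-false (φ e Fin.≟ x) λ φe≡x → x∉U (subst (_∈ U) φe≡x (φ∈U e))) (∑-zero (allFin m)))

funToFin-cong : ∀ {m n} {f g : Fin m → Fin n} → (∀ j → f j ≡ g j) → funToFin f ≡ funToFin g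
funToFin-cong {zero}  eq = refl
funToFin-cong {suc m} eq = cong₂ combine (eq zero) (funToFin-cong (eq ∘ suc))

finToFun-injective : ∀ {m n} {x y : Fin (n ^ m)} → (∀ j → finToFun {n} {m} x j ≡ finToFun y j) → x ≡ y
finToFun-injective {m} {n} {x} {y} eq =
  trans (sym (Fin.funToFin-finToFin {m} {n} x)) (trans (funToFin-cong eq) (Fin.funToFin-finToFin {m} {n} y))

^-injective : ∀ q {d e} → 1 ℕ.< q → q ^ d ≡ q ^ e → d ≡ e
^-injective q {d} {e} 1<q eq with ℕ.<-cmp d e
... | tri< d<e _ _ = contradiction eq (ℕ.<⇒≢ (ℕ.^-monoʳ-< q 1<q d<e))
... | tri≈ _ d≡e _ = d≡e
... | tri> _ _ e<d = contradiction (sym eq) (ℕ.<⇒≢ (ℕ.^-monoʳ-< q 1<q e<d))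

^-via-[] : ∀ p d → suc p ^ d ≡ 1 ℕ.+ p ℕ.* [ d ]⟨ suc p ⟩
^-via-[] p zero    = cong suc (sym (ℕ.*-zeroʳ p))
^-via-[] p (suc d) = trans (cong (ℕ._+ p ℕ.* suc p ^ d) (^-via-[] p d))
  (cong suc (sym (ℕ.*-distribˡ-+ p [ d ]⟨ suc p ⟩ (suc p ^ d))))

2≤-from-≢ : ∀ {n} (x y : Fin n) → x ≢ y → 2 ℕ.≤ n
2≤-from-≢ {suc zero}    zero zero x≢y = contradiction refl x≢y
2≤-from-≢ {suc (suc n)} x    y    _   = ℕ.s≤s (ℕ.s≤s ℕ.z≤n)

comprehension : ∀ {n p} {P : Fin n → Set p} → (∀ x → Dec (P x)) → Subset n
comprehension P? = Vec.tabulate (does ∘ P?)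

∈-comprehension⁺ : ∀ {n p} {P : Fin n → Set p} (P? : ∀ x → Dec (P x)) {x} → P x → x ∈ comprehension P?
∈-comprehension⁺ P? {x} Px = Vec.lookup⇒[]= x _ (trans (Vec.lookup∘tabulate (does ∘ P?) x) (dec-true (P? x) Px))

∈-comprehension⁻ : ∀ {n p} {P : Fin n → Set p} (P? : ∀ x → Dec (P x)) {x} → x ∈ comprehension P? → P x
∈-comprehension⁻ P? {x} x∈ = decidable-stable (P? x) λ ¬Px →
  contradiction (trans (sym (dec-false (P? x) ¬Px)) (trans (sym (Vec.lookup∘tabulate (does ∘ P?) x)) (Vec.[]=⇒lookup x∈))) λ ()

module LinearGeometry {c ℓ m ℓm} (F : FiniteField c ℓ) (W : FiniteDimensional F m ℓm) where
  open FiniteField F using (Carrier; _≈_; 0#; 1#; 1≉0; order; enumeration; scalar; code; scalar-code)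
    renaming (_+_ to _+ᶠ_; _*_ to _*ᶠ_; -_ to -ᶠ_)
  module R = FiniteField F
  open FiniteDimensional W
  open Subspaces F W
  open SetoidReasoning ≈ᴹ-setoid
  open AbelianGroupProperties +ᴹ-abelianGroup using () renaming (x∙y⁻¹≈ε⇒x≈y to x-y≈0⇒x≈y)
  open AbelianGroupProperties R.+-abelianGroup using () renaming (x∙y⁻¹≈ε⇒x≈y to s-t≈0⇒s≈t)

  private
    variable
      d : ℕ
      U : Subset cardinality

  code-cong : ∀ {s t} → s ≈ t → code s ≡ code t
  code-cong = Inverse.from-cong enumeration

  code-scalar : ∀ s → code (scalar s) ≡ s
  code-scalar = Inverse.strictlyInverseʳ enumeration

  scalar-injective : ∀ {s t} → scalar s ≈ scalar t → s ≡ t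
  scalar-injective {s} {t} eq = trans (sym (code-scalar s)) (trans (code-cong eq) (code-scalar t))

  *ₗ-inverse : ∀ s v → s *ₗ v +ᴹ (-ᶠ s) *ₗ v ≈ᴹ 0ᴹ
  *ₗ-inverse s v = begin
    s *ₗ v +ᴹ (-ᶠ s) *ₗ v ≈⟨ *ₗ-distribʳ v s (-ᶠ s) ⟨
    (s +ᶠ (-ᶠ s)) *ₗ v    ≈⟨ *ₗ-cong (R.-‿inverseʳ s) ≈ᴹ-refl ⟩
    0# *ₗ v               ≈⟨ *ₗ-zeroˡ v ⟩
    0ᴹ                    ∎

  -- Adding the second combination on the left avoids negated vectors, so the induction cancels
  -- scalars only.
  combination-- : ∀ (a a′ : Fin d → Carrier) (b : Fin d → Carrierᴹ) →
                  combination (λ j → a j +ᶠ (-ᶠ a′ j)) b +ᴹ combination a′ b ≈ᴹ combination a b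
  combination-- {zero}  a a′ b = +ᴹ-identityˡ 0ᴹ
  combination-- {suc d} a a′ b = begin
    ((a zero +ᶠ (-ᶠ a′ zero)) *ₗ b zero +ᴹ X) +ᴹ (a′ zero *ₗ b zero +ᴹ X′)
      ≈⟨ +ᴹ-assoc _ _ _ ⟩
    (a zero +ᶠ (-ᶠ a′ zero)) *ₗ b zero +ᴹ (X +ᴹ (a′ zero *ₗ b zero +ᴹ X′))
      ≈⟨ +ᴹ-cong ≈ᴹ-refl (≈ᴹ-trans (≈ᴹ-sym (+ᴹ-assoc _ _ _)) (≈ᴹ-trans (+ᴹ-cong (+ᴹ-comm _ _) ≈ᴹ-refl) (+ᴹ-assoc _ _ _))) ⟩
    (a zero +ᶠ (-ᶠ a′ zero)) *ₗ b zero +ᴹ (a′ zero *ₗ b zero +ᴹ (X +ᴹ X′))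
      ≈⟨ +ᴹ-assoc _ _ _ ⟨
    ((a zero +ᶠ (-ᶠ a′ zero)) *ₗ b zero +ᴹ a′ zero *ₗ b zero) +ᴹ (X +ᴹ X′)
      ≈⟨ +ᴹ-cong (≈ᴹ-trans (≈ᴹ-sym (*ₗ-distribʳ (b zero) _ _)) (*ₗ-cong cancel ≈ᴹ-refl)) (combination-- (a ∘ suc) (a′ ∘ suc) (b ∘ suc)) ⟩
    a zero *ₗ b zero +ᴹ combination (a ∘ suc) (b ∘ suc) ∎
    where
    X = combination (λ j → a (suc j) +ᶠ (-ᶠ a′ (suc j))) (b ∘ suc)
    X′ = combination (a′ ∘ suc) (b ∘ suc)
    cancel : (a zero +ᶠ (-ᶠ a′ zero)) +ᶠ a′ zero ≈ a zero
    cancel = R.trans (R.+-assoc _ _ _) (R.trans (R.+-cong R.refl (R.-‿inverseˡ (a′ zero))) (R.+-identityʳ (a zero)))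

  coefficients-unique : ∀ {b : Fin d → Carrierᴹ} → LinearlyIndependent b → ∀ {a a′} →
                        combination a b ≈ᴹ combination a′ b → ∀ j → a j ≈ a′ j
  coefficients-unique {b = b} ind {a} {a′} eq j = s-t≈0⇒s≈t (a j) (a′ j) (ind (λ j → a j +ᶠ (-ᶠ a′ j)) (begin
    D                                     ≈⟨ +ᴹ-identityʳ D ⟨
    D +ᴹ 0ᴹ                               ≈⟨ +ᴹ-cong ≈ᴹ-refl (-ᴹ‿inverseʳ v′) ⟨
    D +ᴹ (v′ +ᴹ -ᴹ v′)                    ≈⟨ +ᴹ-assoc _ _ _ ⟨
    (D +ᴹ v′) +ᴹ -ᴹ v′                    ≈⟨ +ᴹ-cong (≈ᴹ-trans (combination-- a a′ b) eq) ≈ᴹ-refl ⟩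
    v′ +ᴹ -ᴹ v′                           ≈⟨ -ᴹ‿inverseʳ v′ ⟩
    0ᴹ                                    ∎) j)
    where
    D = combination (λ j → a j +ᶠ (-ᶠ a′ j)) b
    v′ = combination a′ b

  combination-code : ∀ (a : Fin d → Carrier) (b : Fin d → Carrierᴹ) →
                     combination (scalar ∘ finToFun (funToFin (code ∘ a))) b ≈ᴹ combination a b
  combination-code a b = combination-cong b λ j →
    R.trans (R.reflexive (cong scalar (Fin.finToFun-funToFin (code ∘ a) j))) (scalar-code (a j))

  combination-injective : ∀ {b : Fin d → Carrierᴹ} → LinearlyIndependent b → ∀ {x y : Fin (order ^ d)} →
                          combination (scalar ∘ finToFun x) b ≈ᴹ combination (scalar ∘ finToFun y) b → x ≡ y
  combination-injective {d} {b} ind eq = finToFun-injective {d} {order} λ j → scalar-injective (coefficients-unique ind eq j)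

  point-index : ∀ v → point (index v) ≈ᴹ v
  point-index v = ≈ᴹ-trans (combination-code (proj₁ (spanning v)) basis) (proj₂ (spanning v))

  point-injective : ∀ {x y} → point x ≈ᴹ point y → x ≡ y
  point-injective = combination-injective independent

  index-point : ∀ x → index (point x) ≡ x
  index-point x = point-injective (point-index (point x))

  index-cong : ∀ {v w} → v ≈ᴹ w → index v ≡ index w
  index-cong {v} {w} v≈w = point-injective (≈ᴹ-trans (point-index v) (≈ᴹ-trans v≈w (≈ᴹ-sym (point-index w))))

  infix 4 _∋_
  -- Membership of a vector instead of its code. It respects ≈ᴹ, so closure can be used for
  -- arbitrary vectors without passing through the coordinates.
  _∋_ : Subset cardinality → Carrierᴹ → Set
  U ∋ v = index v ∈ U

  ∋-cong : ∀ {v w} → v ≈ᴹ w → U ∋ v → U ∋ w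
  ∋-cong {U} v≈w = subst (_∈ U) (index-cong v≈w)

  ∋-point : ∀ {x} → x ∈ U → U ∋ point x
  ∋-point {U} {x} = subst (_∈ U) (sym (index-point x))

  ∋-point⁻ : ∀ {x} → U ∋ point x → x ∈ U
  ∋-point⁻ {U} {x} = subst (_∈ U) (index-point x)

  module Closed (S : IsLinearSubspace U) where
    open IsLinearSubspace S

    ∋-+ : ∀ {v w} → U ∋ v → U ∋ w → U ∋ v +ᴹ w
    ∋-+ {v} {w} v∈ w∈ = ∋-cong {U} (+ᴹ-cong (point-index v) (point-index w)) (+-closed (index v) (index w) v∈ w∈)

    ∋-*ₗ : ∀ s {v} → U ∋ v → U ∋ s *ₗ v
    ∋-*ₗ s {v} v∈ = ∋-cong {U} (*ₗ-cong (scalar-code s) (point-index v)) (*-closed (code s) (index v) v∈)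

    ∋-combination : ∀ (a : Fin d → Carrier) {b : Fin d → Carrierᴹ} → (∀ j → U ∋ b j) → U ∋ combination a b
    ∋-combination {zero}  a b∈ = 0-closed
    ∋-combination {suc d} a b∈ = ∋-+ (∋-*ₗ (a zero) (b∈ zero)) (∋-combination (a ∘ suc) (b∈ ∘ suc))

  -- Coordinates with respect to the basis parametrise U bijectively by `Fin (order ^ d)`.
  basis-size : IsLinearSubspace U → {b : Fin d → Fin cardinality} → IsBasisOf U b → ∣ U ∣ ≡ order ^ d
  basis-size {U} {d} S {b} B = ∣∣-parametrised U φ
    (λ {e} {e′} eq → combination-injective Basis.lin-indep (≈ᴹ-trans (≈ᴹ-sym (point-index (vector e)))
      (≈ᴹ-trans (≈ᴹ-reflexive (cong point eq)) (point-index (vector e′)))))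
    (λ e → Closed.∋-combination S (scalar ∘ finToFun e) λ j → ∋-point (Basis.inside j))
    (λ x x∈U → let a , eq = Basis.spans x x∈U in
      funToFin (code ∘ a) , trans (index-cong (≈ᴹ-trans (combination-code a (point ∘ b)) eq)) (index-point x))
    where
    module Basis = IsBasisOf B
    vector : Fin (order ^ d) → Carrierᴹ
    vector e = combination (scalar ∘ finToFun e) (point ∘ b)
    φ : Fin (order ^ d) → Fin cardinality
    φ = index ∘ vector

  order≥2 : 2 ℕ.≤ order
  order≥2 = 2≤-from-≢ (code 1#) (code 0#) λ eq →
    1≉0 (R.trans (R.sym (scalar-code 1#)) (R.trans (R.reflexive (cong scalar eq)) (scalar-code 0#)))

  -- Invariance of dimension by counting: two bases give q^d = q^e, and q ≥ 2. It frees `dim` from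
  -- the particular basis found by the greedy search.
  dim-basis : IsLinearSubspace U → {b : Fin d → Fin cardinality} → IsBasisOf U b → dim U ≡ d
  dim-basis {U} S B = ^-injective order order≥2 (trans (sym (basis-size S (proj₂ (proj₂ (findBasis U))))) (basis-size S B))

  linear : (U : Subspace (vectorSpace F W)) → IsLinearSubspace (carrier U)
  linear (U , S) = recompute (isLinearSubspace? U) S

  zero-isLinearSubspace : IsLinearSubspace ⁅ index 0ᴹ ⁆
  zero-isLinearSubspace = record
    { 0-closed = x∈⁅x⁆ (index 0ᴹ)
    ; +-closed = λ x y x∈ y∈ → ∈0 (≈ᴹ-trans (+ᴹ-cong (≈0 x∈) (≈0 y∈)) (+ᴹ-identityˡ 0ᴹ))
    ; *-closed = λ s x x∈ → ∈0 (≈ᴹ-trans (*ₗ-cong R.refl (≈0 x∈)) (*ₗ-zeroʳ (scalar s)))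
    }
    where
    ∈0 : ∀ {v} → v ≈ᴹ 0ᴹ → index v ∈ ⁅ index 0ᴹ ⁆
    ∈0 v≈0 = subst (_∈ ⁅ index 0ᴹ ⁆) (sym (index-cong v≈0)) (x∈⁅x⁆ (index 0ᴹ))
    ≈0 : ∀ {x} → x ∈ ⁅ index 0ᴹ ⁆ → point x ≈ᴹ 0ᴹ
    ≈0 x∈ = ≈ᴹ-trans (≈ᴹ-reflexive (cong point (x∈⁅y⁆⇒x≡y _ x∈))) (point-index 0ᴹ)

  zero-dim : dim ⁅ index 0ᴹ ⁆ ≡ 0
  zero-dim = dim-basis zero-isLinearSubspace {λ ()} record
    { inside    = λ ()
    ; lin-indep = λ _ _ ()
    ; spans     = λ x x∈ → (λ ()) , ≈ᴹ-sym (≈ᴹ-trans (≈ᴹ-reflexive (cong point (x∈⁅y⁆⇒x≡y _ x∈))) (point-index 0ᴹ))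
    }

  module Adjunction (U : Subset cardinality) (x : Fin cardinality) where

    p = point x

    -- The sum of U and the line through x. Only the scalar is quantified, the part in U being y + s
    -- x, so membership is decided by a search through the field.
    InAdjunction : Fin cardinality → Set
    InAdjunction y = ∃ λ s → U ∋ point y +ᴹ scalar s *ₗ p

    inAdjunction? : ∀ y → Dec (InAdjunction y)
    inAdjunction? y = Fin.any? λ s → index (point y +ᴹ scalar s *ₗ p) ∈? U

    adjunction : Subset cardinality
    adjunction = comprehension inAdjunction?

    ∈⁺ : ∀ s {v} → U ∋ v +ᴹ s *ₗ p → index v ∈ adjunction
    ∈⁺ s {v} ∋u = ∈-comprehension⁺ inAdjunction? (code s ,
      ∋-cong {U} (+ᴹ-cong (≈ᴹ-sym (point-index v)) (*ₗ-cong (R.sym (scalar-code s)) ≈ᴹ-refl)) ∋u)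

    ∈⁻ : ∀ {y} → y ∈ adjunction → InAdjunction y
    ∈⁻ = ∈-comprehension⁻ inAdjunction?

    module _ (S : IsLinearSubspace U) where
      open IsLinearSubspace S
      open Closed S

      ≥ : U ⊆ adjunction
      ≥ {y} y∈U = subst (_∈ adjunction) (index-point y) (∈⁺ 0#
        (∋-cong {U} (≈ᴹ-sym (≈ᴹ-trans (+ᴹ-cong ≈ᴹ-refl (*ₗ-zeroˡ p)) (+ᴹ-identityʳ (point y)))) (∋-point y∈U)))

      ∋x : x ∈ adjunction
      -- The scalar -1 works, as x - x = 0 lies in U.
      ∋x = subst (_∈ adjunction) (index-point x) (∈⁺ (-ᶠ 1#)
        (∋-cong {U} (≈ᴹ-sym (≈ᴹ-trans (+ᴹ-cong (≈ᴹ-sym (*ₗ-identityˡ p)) ≈ᴹ-refl) (*ₗ-inverse 1# p))) 0-closed))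

      isLinearSubspace : IsLinearSubspace adjunction
      isLinearSubspace = record
        { 0-closed = ≥ 0-closed
        ; +-closed = λ y z y∈ z∈ → let s , u∈ = ∈⁻ y∈ ; t , w∈ = ∈⁻ z∈ in
            ∈⁺ (scalar s +ᶠ scalar t) (∋-cong {U} (begin
              (point y +ᴹ scalar s *ₗ p) +ᴹ (point z +ᴹ scalar t *ₗ p)   ≈⟨ interchange _ _ _ _ ⟩
              (point y +ᴹ point z) +ᴹ (scalar s *ₗ p +ᴹ scalar t *ₗ p)   ≈⟨ +ᴹ-cong ≈ᴹ-refl (*ₗ-distribʳ p _ _) ⟨
              (point y +ᴹ point z) +ᴹ (scalar s +ᶠ scalar t) *ₗ p        ∎) (∋-+ u∈ w∈))
        ; *-closed = λ r y y∈ → let s , u∈ = ∈⁻ y∈ in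
            ∈⁺ (scalar r *ᶠ scalar s) (∋-cong {U} (begin
              scalar r *ₗ (point y +ᴹ scalar s *ₗ p)                     ≈⟨ *ₗ-distribˡ (scalar r) _ _ ⟩
              scalar r *ₗ point y +ᴹ scalar r *ₗ (scalar s *ₗ p)         ≈⟨ +ᴹ-cong ≈ᴹ-refl (*ₗ-assoc _ _ p) ⟨
              scalar r *ₗ point y +ᴹ (scalar r *ᶠ scalar s) *ₗ p         ∎) (∋-*ₗ (scalar r) u∈))
        }
        where
        interchange : ∀ a b c d → (a +ᴹ b) +ᴹ (c +ᴹ d) ≈ᴹ (a +ᴹ c) +ᴹ (b +ᴹ d)
        interchange a b c d = begin
          (a +ᴹ b) +ᴹ (c +ᴹ d) ≈⟨ +ᴹ-assoc a b _ ⟩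
          a +ᴹ (b +ᴹ (c +ᴹ d)) ≈⟨ +ᴹ-cong ≈ᴹ-refl (≈ᴹ-trans (≈ᴹ-sym (+ᴹ-assoc b c d)) (≈ᴹ-trans (+ᴹ-cong (+ᴹ-comm b c) ≈ᴹ-refl) (+ᴹ-assoc c b d))) ⟩
          a +ᴹ (c +ᴹ (b +ᴹ d)) ≈⟨ +ᴹ-assoc a c _ ⟨
          (a +ᴹ c) +ᴹ (b +ᴹ d) ∎

      dim-suc : {b : Fin d → Fin cardinality} → IsBasisOf U b → x ∉ U → dim adjunction ≡ suc d
      dim-suc {b = b} B x∉U = dim-basis isLinearSubspace {x Vector.∷ b} record
        { inside    = λ { zero → ∋x ; (suc j) → ≥ (Basis.inside j) }
        ; lin-indep = extend-independent (point ∘ (x Vector.∷ b)) Basis.lin-indep λ (a , eq) →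
            x∉U (∋-point⁻ (∋-cong {U} eq (∋-combination a λ j → ∋-point (Basis.inside j))))
        ; spans     = λ y y∈ → let s , u∈ = ∈⁻ y∈ ; a , eq = Basis.spans _ u∈ in
            -- From u = y + s x with u in U follows y = -s x + u, so the coefficient of x is -s.
            ((-ᶠ scalar s) Vector.∷ a) , recover y (scalar s) (≈ᴹ-trans eq (point-index _))
        }
        where
        module Basis = IsBasisOf B
        recover : ∀ y s {w} → w ≈ᴹ point y +ᴹ s *ₗ p → (-ᶠ s) *ₗ p +ᴹ w ≈ᴹ point y
        recover y s {w} eq = begin
          (-ᶠ s) *ₗ p +ᴹ w                        ≈⟨ +ᴹ-cong ≈ᴹ-refl eq ⟩
          (-ᶠ s) *ₗ p +ᴹ (point y +ᴹ s *ₗ p)      ≈⟨ +ᴹ-comm _ _ ⟩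
          (point y +ᴹ s *ₗ p) +ᴹ (-ᶠ s) *ₗ p      ≈⟨ +ᴹ-assoc _ _ _ ⟩
          point y +ᴹ (s *ₗ p +ᴹ (-ᶠ s) *ₗ p)      ≈⟨ +ᴹ-cong ≈ᴹ-refl (*ₗ-inverse s p) ⟩
          point y +ᴹ 0ᴹ                           ≈⟨ +ᴹ-identityʳ (point y) ⟩
          point y                                 ∎

    least : ∀ {X} → IsLinearSubspace X → U ⊆ X → x ∈ X → adjunction ⊆ X
    least {X} T U⊆X x∈X {y} y∈ = let s , u∈ = ∈⁻ y∈ in
      ∋-point⁻ (∋-cong {X} (begin
        (point y +ᴹ scalar s *ₗ p) +ᴹ (-ᶠ scalar s) *ₗ p  ≈⟨ +ᴹ-assoc _ _ _ ⟩
        point y +ᴹ (scalar s *ₗ p +ᴹ (-ᶠ scalar s) *ₗ p)  ≈⟨ +ᴹ-cong ≈ᴹ-refl (*ₗ-inverse (scalar s) p) ⟩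
        point y +ᴹ 0ᴹ                                     ≈⟨ +ᴹ-identityʳ (point y) ⟩
        point y                                           ∎)
        (Closed.∋-+ T (U⊆X u∈) (Closed.∋-*ₗ T (-ᶠ scalar s) (∋-point x∈X))))

  -- The scalar that places y in the larger adjunction works again: y + s x lies in U by assumption,
  -- and in X because x and y do.
  adjunction-modular : ∀ {U X x y} → IsLinearSubspace X → x ∈ X → y ∈ X →
                       y ∈ Adjunction.adjunction U x → y ∈ Adjunction.adjunction (U ∩ X) x
  adjunction-modular {U} {X} {x} {y} T x∈X y∈X y∈ = let s , u∈ = Adjunction.∈⁻ U x y∈ in
    subst (_∈ Adjunction.adjunction (U ∩ X) x) (index-point y) (Adjunction.∈⁺ (U ∩ X) x (scalar s)
      (x∈p∩q⁺ (u∈ , Closed.∋-+ T (∋-point y∈X) (Closed.∋-*ₗ T (scalar s) (∋-point x∈X)))))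

  geometry : Geometry (vectorSpace F W)
  geometry = record
    { base>0         = ℕ.<⇒≤ order≥2
    ; constant       = 1
    ; slope          = ℕ.pred order
    ; slope>0        = ℕ.pred-mono-≤ order≥2
    ; cardinality    = λ U → trans (basis-size (linear U) (proj₂ (proj₂ (findBasis (carrier U))))) (power (rk U))
    ; bottom         = ⁅ index 0ᴹ ⁆ , zero-isLinearSubspace
    ; bottom-rk      = zero-dim
    ; bottom-≤       = λ U x∈ → subst (_∈ carrier U) (sym (x∈⁅y⁆⇒x≡y _ x∈)) (IsLinearSubspace.0-closed (linear U))
    ; adjoin         = λ U x → Adjunction.adjunction (carrier U) x , Adjunction.isLinearSubspace (carrier U) x (linear U)
    ; adjoin-≥       = λ U x → Adjunction.≥ (carrier U) x (linear U)
    ; adjoin-∋       = λ U x → Adjunction.∋x (carrier U) x (linear U)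
    ; adjoin-least   = λ U x X U≤X x∈X → Adjunction.least (carrier U) x (linear X) U≤X x∈X
    ; adjoin-modular = λ U x X → adjunction-modular {carrier U} {carrier X} {x} (linear X)
    ; rk-adjoin      = λ U x → Adjunction.dim-suc (carrier U) x (linear U) (proj₂ (proj₂ (findBasis (carrier U))))
    }
    where
    power : ∀ d → order ^ d ≡ 1 ℕ.+ ℕ.pred order ℕ.* [ d ]⟨ order ⟩
    power d = subst (λ q → q ^ d ≡ 1 ℕ.+ ℕ.pred order ℕ.* [ d ]⟨ q ⟩) (ℕ.suc-pred order {{ℕ.>-nonZero (ℕ.<⇒≤ order≥2)}}) (^-via-[] (ℕ.pred order) d)

geometry : (V : Space ℓ₁ ℓ₂ ℓ₃ ℓ₄) → Geometry V
geometry (finiteSet n)     = finiteSet-geometry n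
geometry (vectorSpace F W) = LinearGeometry.geometry F W

theorem5p8 : ∀ {c ℓ m ℓm} (V : Space c ℓ m ℓm)
    (_^⊥ : Subspace V → Subspace V) → IsAntiAutomorphism _^⊥ →
    (k : ℕ) → k ≤ᴺ rank V →
    (f : Gr V k → ℝ) (d : ℕ ₋) → HasDegree f d →
    (i : ℕ) → max0 d ≤ᴺ i → i ≤ᴺ k ⊓ (rank V ∸ k) →
    (f^⊥ : Gr V (rank V ∸ k) → ℝ) → IsDualized _^⊥ f f^⊥ →
    (f^⊥ ∈V̄ i) ×
    ((wt-f wt-f^⊥ : Gr V i → ℝ) →
    IsWeightDistribution i f wt-f → IsWeightDistribution i f^⊥ wt-f^⊥ →
    ∀ J → wt-f^⊥ J ≈ℝ
    ∑Gr i (λ I → fromℚ (γ (base V) (rank V ∸ k) i (rk (((subspace I) ^⊥) ∧ subspace J))) *ℝ wt-f I))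
theorem5p8 V _^⊥ iso = Dualization.dualized-weights (geometry V) _^⊥ iso
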